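{- Let $G=(V,E)$ be a $2$-edge-connected graph, $s,t\in V$ distinct vertices, and $k\ge 2$ an integer. Fix a hierarchical $k$-chain decomposition of $G$ (with respect to $s,t$), with $\mathcal{S}$ the set of all edges in its separators. A subgraph $H$ of $G$ is a feasible solution to SD-$k$-RSND on $G$ with demand $(s,t,k)$ if and only if all edges in $\mathcal{S}$ are included in $H$ and, for each $h$-component $R^h_i$ in the decomposition, the subgraph $H^h_i=H[R^h_i]$ satisfies the following: 1. $H^h_i$ is a feasible solution to RSND on $G^h_i=G[R^h_i]$ with demands $$\Bigl\{(X,Y,d): X\subseteq V^h_{(i,\ell)},\ Y\subseteq V^h_{(i,r)},\ (X,Y)\ne (V^h_{(i,\ell)},V^h_{(i,r)}),\ d=\max\bigl(0,\,k+|S_X|+|S_Y|-|S^h_{i-1}|-|S^h_i|\bigr)\Bigr\}.$$ 2. $H^h_i$ is a feasible solution to RSND on $G^h_i$ with demand $(V^h_{(i,\ell)},V^h_{(i,r)},h+1)$. 3. $H^h_i$ is a feasible solution to RSND on $G^h_i$ with demand $(V^h_{(i,\ell)},V^h_{(i,r)},k-1)$.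
   Context: Graphs are finite, undirected, and may have parallel edges; $G[R]$, $H[R]$ denote induced subgraphs. SD-$k$-RSND: a subgraph $H$ of $G$ is feasible for demand $(s,t,k)$ if for every $F\subseteq E$ with $|F|<k$, an $st$-path in $G\setminus F$ implies an $st$-path in $H\setminus F$. For vertex sets $X,Y$ of a graph $\Gamma$ and an integer $d\ge 0$, a subgraph $\Gamma'$ of $\Gamma$ satisfies (is feasible for) the RSND demand $(X,Y,d)$ on $\Gamma$ if for every edge set $F$ of size at most $d-1$: if $\Gamma\setminus F$ has a path from at least one vertex of $X$ to at least one vertex of $Y$, then so does $\Gamma'\setminus F$ (a demand with $d=0$ is always satisfied). Important separators. An $(X,Y)$-separator of a graph is an edge set $S$ such that after deleting $S$ there is no path between a vertex of $X$ and a vertex of $Y$; it is minimal if no proper subset is an $(X,Y)$-separator. Let $R$ be the set of vertices reachable from $X$ after deleting $S$. $S$ is important if it is minimal and there is no $(X,Y)$-separator $S'$ with $|S'|\le|S|$ and $R'\subsetneq R$, where $R'$ is the set of vertices reachable from $X$ after deleting $S'$. $(X,Y)$ $h$-chain of a graph $\Gamma$. If $\Gamma$ has no important $(X,Y)$-separator of size $h$, the chain is the single component $V(\Gamma)$ with no separators. Otherwise choose an important $(X,Y)$-separator $S_0$ of size $h$, let $R_0$ be the vertices reachable from $X$ in $\Gamma\setminus S_0$, let $V_{(0,r)}$ be the vertices in $R_0$ incident on $S_0$ and $V_{(1,\ell)}$ the vertices outside $R_0$ incident on $S_0$. Inductively, given $V_{(i,\ell)}$, if $\Gamma\setminus\bigcup_{j<i}R_j$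 has no important $(V_{(i,\ell)},Y)$-separator of size $h$ then stop, with last component $R_i$ consisting of all remaining vertices; otherwise choose such a separator $S_i$, let $R_i$ be the vertices reachable from $V_{(i,\ell)}$ in $(\Gamma\setminus\bigcup_{j<i}R_j)\setminus S_i$, let $V_{(i,r)}$ be the vertices of $R_i$ incident on $S_i$, and $V_{(i+1,\ell)}$ the vertices outside $\bigcup_{j\le i}R_j$ incident on $S_i$. The first component has left set $X$ and the last component has right set $Y$. Hierarchical $k$-chain decomposition. The only $1$-component is $V$ (the graph $G$), with left set $\{s\}$ and right set $\{t\}$. For $h=1,\dots,k-2$, each $h$-component $R$ with left set $V_\ell$ and right set $V_r$ is refined by constructing the $(V_\ell,V_r)$ $(h+1)$-chain of $G[R]$; its components are $(h+1)$-components, with parent $R$. For each $h\in\{1,\dots,k-1\}$ all $h$-components are ordered from the one containing $s$ to the one containing $t$ as $R^h_0,R^h_1,\dots$; $S^h_i$ is the (already chosen) separator consisting of the edges between $R^h_i$ and $R^h_{i+1}$, and $V^h_{(i,\ell)}$, $V^h_{(i,r)}$ are the vertices of $R^h_i$ incident on $S^h_{i-1}$, $S^h_i$ respectively. For the first component $V^h_{(i,\ell)}=\{s\}$ and $S^h_{i-1}=\emptyset$; for the last, $V^h_{(i,r)}=\{t\}$ and $S^h_i=\emptyset$. For $X\subseteq V^h_{(i,\ell)}$, $S_X$ is the set of edges of $S^h_{i-1}$ incident on vertices of $X$; for $Y\subseteq V^h_{(i,r)}$, $S_Y$ is the set of edges of $S^h_i$ incident on vertices of $Y$. -}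

module Defs where

open import Data.Fin using (Fin)
open import Data.Fin.Properties using (_≟_; any?)
open import Data.Fin.Subset using (Subset; inside; _∈_; _⊆_; _⊂_; _∩_; _─_; ∁; ∣_∣; ⁅_⁆; ⊤; ⊥)
open import Data.Fin.Subset.Properties using (_∈?_; ∈⊤; x∈p∩q⁺; x∈p∩q⁻; p─q⊆p)
open import Data.List using (List; []; _∷_)
open import Data.List.Relation.Unary.Any using (Any)
open import Data.Nat using (ℕ; suc; _+_; _≤_; _<_)
open import Data.Product using (_×_; _,_; proj₁; proj₂; ∃; ∃₂)
open import Data.Sum using (_⊎_; inj₁; inj₂)
open import Data.Vec using (tabulate)
open import Data.Vec.Properties using (lookup∘tabulate; []=⇒lookup)
open import Function using (_⇔_)
open import Level using (Level)
open import Relation.Binary.Construct.Closure.ReflexiveTransitive using (Star)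
open import Relation.Binary.PropositionalEquality using (_≡_; _≢_; refl; sym; trans)
open import Relation.Nullary using (¬_; Dec; does; yes; no)
open import Relation.Nullary.Decidable using (_×-dec_; _⊎-dec_)
open import Relation.Unary using (Pred; Decidable)

private
  variable
    ℓ : Level
    r : ℕ

⟪_⟫ : {P : Pred (Fin r) ℓ} → Decidable P → Subset r
⟪ P? ⟫ = tabulate (λ i → does (P? i))

∈⟪⟫⁻ : {P : Pred (Fin r) ℓ} (P? : Decidable P) {i : Fin r} → i ∈ ⟪ P? ⟫ → P i
∈⟪⟫⁻ {P = P} P? {i} i∈ =
  holds (P? i) (trans (sym (lookup∘tabulate (λ j → does (P? j)) i)) ([]=⇒lookup i∈))
  where
  holds : (d : Dec (P i)) → does d ≡ inside → P i
  holds (yes p) _ = p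
  holds (no _) ()

-- Parallel edges are distinct elements of Fin #E with the same ends.  The
-- order of the two ends of an edge carries no meaning.
record Graph : Set where
  field
    #V #E    : ℕ
    ends     : Fin #E → Fin #V × Fin #V
    loopless : ∀ e → proj₁ (ends e) ≢ proj₂ (ends e)

module _ (G : Graph) where
  open Graph G

  Vertex = Fin #V
  Edge = Fin #E
  Vertices = Subset #V
  Edges = Subset #E

  Incident : Vertex → Edge → Set
  Incident v e = v ≡ proj₁ (ends e) ⊎ v ≡ proj₂ (ends e)

  incident? : ∀ v e → Dec (Incident v e)
  incident? v e = (v ≟ proj₁ (ends e)) ⊎-dec (v ≟ proj₂ (ends e))

  -- The vertices incident on some edge of S.
  touching : Edges → Vertices
  touching S = ⟪ (λ v → any? (λ e → (e ∈? S) ×-dec incident? v e)) ⟫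

  -- The edges of S incident on some vertex of X (written S_X for S a separator).
  edgesAt : Edges → Vertices → Edges
  edgesAt S X = S ∩ ⟪ (λ e → any? (λ v → (v ∈? X) ×-dec incident? v e)) ⟫

  -- All graphs derived from G (induced subgraphs, edge deletions, solutions)
  -- are represented as subgraphs of G.
  record Subgraph : Set where
    field
      V      : Vertices
      E      : Edges
      closed : ∀ {e v} → e ∈ E → Incident v e → v ∈ V
  open Subgraph

  whole : Subgraph
  whole = record { V = ⊤ ; E = ⊤ ; closed = λ _ _ → ∈⊤ }

  infixl 7 _∖_

  _∖_ : Subgraph → Edges → Subgraph
  Γ ∖ F = record
    { V = V Γ ; E = E Γ ─ F ; closed = λ e∈ → closed Γ (p─q⊆p (E Γ) F e∈) }

  induced : Subgraph → Vertices → Subgraph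
  induced Γ R = record { V = V Γ ∩ R ; E = E Γ ∩ within ; closed = closed′ }
    where
    within? : Decidable (λ e → proj₁ (ends e) ∈ R × proj₂ (ends e) ∈ R)
    within? e = (proj₁ (ends e) ∈? R) ×-dec (proj₂ (ends e) ∈? R)

    within : Edges
    within = ⟪ within? ⟫

    end∈R : ∀ {e v} → proj₁ (ends e) ∈ R × proj₂ (ends e) ∈ R → Incident v e → v ∈ R
    end∈R (p , _) (inj₁ refl) = p
    end∈R (_ , q) (inj₂ refl) = q

    closed′ : ∀ {e v} → e ∈ E Γ ∩ within → Incident v e → v ∈ V Γ ∩ R
    closed′ e∈ v~e with x∈p∩q⁻ (E Γ) within e∈
    ... | e∈Γ , e∈within =
      x∈p∩q⁺ (closed Γ e∈Γ v~e , end∈R (∈⟪⟫⁻ within? e∈within) v~e)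

  Adjacent : Subgraph → Vertex → Vertex → Set
  Adjacent Γ u v = ∃ λ e → e ∈ E Γ × (ends e ≡ (u , v) ⊎ ends e ≡ (v , u))

  -- Membership of the start vertex matters only for paths of length 0.
  Path : Subgraph → Vertex → Vertex → Set
  Path Γ u v = u ∈ V Γ × Star (Adjacent Γ) u v

  Linked : Subgraph → Vertices → Vertices → Set
  Linked Γ X Y = ∃₂ λ x y → x ∈ X × y ∈ Y × Path Γ x y

  Connected : Subgraph → Set
  Connected Γ = ∀ u v → u ∈ V Γ → v ∈ V Γ → Path Γ u v

  TwoEdgeConnected : Set
  TwoEdgeConnected = ∀ F → ∣ F ∣ < 2 → Connected (whole ∖ F)

  SD-RSND : Vertex → Vertex → ℕ → Subgraph → Set
  SD-RSND s t k H = ∀ F → ∣ F ∣ < k → Path (whole ∖ F) s t → Path (H ∖ F) s t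

  -- Γ′ satisfies the demand (X , Y , d) on Γ; for d = 0 there is no such F.
  RSND : (Γ Γ′ : Subgraph) → Vertices → Vertices → ℕ → Set
  RSND Γ Γ′ X Y d =
    ∀ F → F ⊆ E Γ → ∣ F ∣ < d → Linked (Γ ∖ F) X Y → Linked (Γ′ ∖ F) X Y

  Separator : Subgraph → Vertices → Vertices → Edges → Set
  Separator Γ X Y S = S ⊆ E Γ × ¬ Linked (Γ ∖ S) X Y

  MinimalSeparator : Subgraph → Vertices → Vertices → Edges → Set
  MinimalSeparator Γ X Y S =
    Separator Γ X Y S × (∀ S′ → S′ ⊂ S → ¬ Separator Γ X Y S′)

  -- R is the set of vertices reachable from X in Γ.
  ReachSet : Subgraph → Vertices → Vertices → Set
  ReachSet Γ X R = ∀ v → v ∈ R ⇔ (∃ λ x → x ∈ X × Path Γ x v)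

  Important : Subgraph → Vertices → Vertices → Edges → Set
  Important Γ X Y S =
    MinimalSeparator Γ X Y S ×
    (∀ R → ReachSet (Γ ∖ S) X R →
      ¬ (∃₂ λ S′ R′ → Separator Γ X Y S′ × ∣ S′ ∣ ≤ ∣ S ∣
                     × ReachSet (Γ ∖ S′) X R′ × R′ ⊂ R))

  -- Components in order, with the separator between consecutive ones.
  infixr 5 _—⟨_⟩—_

  data Sequence : Set where
    single  : Vertices → Sequence
    _—⟨_⟩—_ : Vertices → Edges → Sequence → Sequence

  first : Sequence → Vertices
  first (single R)    = R
  first (R —⟨ _ ⟩— _) = R

  separators : Sequence → List Edges
  separators (single _)    = []
  separators (_ —⟨ S ⟩— q) = S ∷ separators q

  join : Sequence → Edges → Sequence → Sequence
  join (single R)     S q′ = R —⟨ S ⟩— q′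
  join (R —⟨ S₀ ⟩— q) S q′ = R —⟨ S₀ ⟩— join q S q′

  -- Chain h Γ X Y q: q is an (X , Y) h-chain of Γ, for some choice of the
  -- separators.  The graph shrinks along the chain: in `cut`, R is deleted and
  -- the construction continues from the vertices outside R incident on S.
  data Chain (h : ℕ) (Γ : Subgraph) (X Y : Vertices) : Sequence → Set where
    stop : ¬ (∃ λ S → Important Γ X Y S × ∣ S ∣ ≡ h) →
           Chain h Γ X Y (single (V Γ))
    cut  : ∀ {S R q} →
           Important Γ X Y S → ∣ S ∣ ≡ h → ReachSet (Γ ∖ S) X R →
           (let Γ′ = induced Γ (∁ R)) →
           Chain h Γ′ (V Γ′ ∩ touching S) Y q →
           Chain h Γ X Y (R —⟨ S ⟩— q)

  -- Refinement h t L q q′: replacing every component of q by an (h+1)-chain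
  -- yields q′, where L is the left set of the first component of q and ⁅ t ⁆
  -- the right set of the last one.
  data Refinement (h : ℕ) (t : Vertex) (L : Vertices) : Sequence → Sequence → Set where
    last : ∀ {R c} →
           Chain (suc h) (induced whole R) L ⁅ t ⁆ c →
           Refinement h t L (single R) c
    step : ∀ {R S q c q′} →
           Chain (suc h) (induced whole R) L (R ∩ touching S) c →
           Refinement h t (first q ∩ touching S) q q′ →
           Refinement h t L (R —⟨ S ⟩— q) (join c S q′)

  -- level h lists the h-components; only the values for 1 ≤ h ≤ k − 1 are
  -- constrained or used.
  record Hierarchy (s t : Vertex) (k : ℕ) : Set where
    field
      level   : ℕ → Sequence
      level-1 : level 1 ≡ single ⊤
      refine  : ∀ h → 1 ≤ h → h + 2 ≤ k →
                Refinement h t ⁅ s ⁆ (level h) (level (suc h))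

  InSeparators : ∀ {s t k} → Hierarchy s t k → Edge → Set
  InSeparators {k = k} D e =
    ∃ λ h → 1 ≤ h × h < k × Any (e ∈_) (separators (Hierarchy.level D h))

  -- A component together with the separators before and after it and its left
  -- and right vertex sets.
  record Component : Set where
    constructor component
    field
      sepˡ  : Edges
      left  : Vertices
      verts : Vertices
      right : Vertices
      sepʳ  : Edges

  componentsFrom : Edges → Vertices → Vertex → Sequence → List Component
  componentsFrom S⁻ L t (single R) = component S⁻ L R ⁅ t ⁆ ⊥ ∷ []
  componentsFrom S⁻ L t (R —⟨ S ⟩— q) =
    component S⁻ L R (R ∩ touching S) S ∷ componentsFrom S (first q ∩ touching S) t q

  components : ∀ {s t k} → Hierarchy s t k → ℕ → List Component
  components {s} {t} D h = componentsFrom ⊥ ⁅ s ⁆ t (Hierarchy.level D h)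

module Submission where

-- For a component R let P and Q be the sets of vertices before and after it. Condition 1 together
-- with the demand (Vˡ , Vʳ , k) amounts to the demand (P , Q , k): a deleted edge of S⁻ or S⁺
-- counts against k, and the remaining ones are attached at X and Y. Since P is connected to s and
-- Q to t, the demand (s , t , k) implies all of these.
--
-- Conversely, the demand (Vˡ , Vʳ , k) holds at the last level by condition 2, and it passes from
-- the components of the chain of R to R by gluing along the separators, each the boundary of a
-- set B. They are minimum cuts of H[R], by condition 2 for R. Suppose a set A with fewer than k
-- boundary edges in H violates the demand (P , Q , k), and let uv be an edge missing from H that
-- crosses A, say with both ends outside B. Let N be the connected piece of u in A ─ B and Z that
-- of v in ∁ A ─ B. By uncrossing, B ∪ N and B ∪ Z also have fewer than k boundary edges, and since
-- B is a minimum cut, outside B there is a walk to Q from v that avoids N or from u that avoids Z.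
-- So the edge uv violates the demand (B , Q , k).

open import Defs
open import Data.Bool using (true; false)
open import Data.Bool.Properties as Bool using ()
open import Data.Empty as Empty using (⊥-elim)
open import Data.Fin using (Fin)
open import Data.Fin.Properties using (_≟_; any?)
open import Data.Fin.Subset using (Subset; _∈_; _∉_; _⊆_; _⊂_; _∩_; _∪_; _─_; _-_; ∁; ∣_∣; ⁅_⁆; ⊤; ⊥)
open import Data.Fin.Subset.Properties
open import Data.List.Relation.Unary.Any using (Any; here; there)
open import Data.List.Membership.Propositional renaming (_∈_ to _∈ₗ_) using ()
open import Data.Nat using (ℕ; zero; suc; _+_; _∸_; _≤_; _<_; z≤n; s≤s)
open import Data.Nat.Properties as ℕ using ()
open import Data.Nat.Solver using (module +-*-Solver)
open import Data.Product using (_×_; _,_; proj₁; proj₂; ∃; ∃₂)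
open import Data.Product.Properties using () renaming (≡-dec to ×-≡-dec)
open import Data.Sum using (_⊎_; inj₁; inj₂; [_,_]′)
open import Data.Vec using ([]; _∷_; there)
open import Data.Vec.Properties using (lookup∘tabulate; lookup⇒[]=) renaming (≡-dec to Vec-≡-dec)
open import Function using (_⇔_; _∘_; id; Equivalence; mk⇔)
open import Level using (Level)
open import Relation.Binary using (Rel)
open import Relation.Binary.Construct.Closure.ReflexiveTransitive as Star using (Star; ε; _◅_; _◅◅_)
open import Relation.Binary.PropositionalEquality using (_≡_; _≢_; refl; sym; trans; cong; subst)
open import Relation.Nullary using (¬_; Dec; yes; no; does)
open import Relation.Nullary.Decidable using (_×-dec_; decidable-stable; dec-true)
open import Relation.Unary using (Pred; Decidable)

-- A walk that witnesses a connection in G may cross the same separator many times, so it cannot be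
-- divided among the components. The arguments therefore run over cuts: a connection follows once no
-- closed set separates the two sides, and a walk is examined only where it leaves a given set. For
-- the same reason gluing restores the missing edges one at a time. If only uv is put back, a
-- violated demand yields a set A which, after the deletions, is left by uv alone, with u reached
-- from P and v from Q; both of these walks are needed to show that N and Z touch B.
--
-- The constants fit because of what important separators leave behind. Between the two ends of an
-- n-component every cut has at least n + 1 edges. For n = 1 this is 2-edge-connectivity; and an
-- important separator of size n + 1 has no other cut of that size or less on its near side, since
-- such a cut would be closer to the left end. Condition 2 carries the bound n + 1 over to H[R], so
-- there the separators of the (n+1)-chain of R are minimum cuts.

private
  variable
    ℓ : Level
    r : ℕ

-- Cardinalities of finite sets and the arithmetic of the demands.

∈⟪⟫⁺ : {P : Pred (Fin r) ℓ} (P? : Decidable P) {i : Fin r} → P i → i ∈ ⟪ P? ⟫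
∈⟪⟫⁺ P? {i} p =
  lookup⇒[]= i ⟪ P? ⟫ (trans (lookup∘tabulate (does ∘ P?) i) (dec-true (P? i) p))

x∈p─q⁻ : (p q : Subset r) {x : Fin r} → x ∈ p ─ q → x ∈ p × x ∉ q
x∈p─q⁻ p q x∈ = p─q⊆p p q x∈ , x∉q p q x∈
  where
  x∉q : ∀ {r} (p q : Subset r) {x} → x ∈ p ─ q → x ∉ q
  x∉q (_ ∷ p) (true ∷ q) (there x∈) (there x∈q) = x∉q p q x∈ x∈q
  x∉q (_ ∷ p) (false ∷ q) (there x∈) (there x∈q) = x∉q p q x∈ x∈q

∩-monoʳ : (p : Subset r) {q q′ : Subset r} → q ⊆ q′ → p ∩ q ⊆ p ∩ q′
∩-monoʳ p {q} q⊆ x∈ with x∈p , x∈q ← x∈p∩q⁻ p q x∈ = x∈p∩q⁺ (x∈p , q⊆ x∈q)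

─-monoˡ : {p p′ : Subset r} (q : Subset r) → p ⊆ p′ → p ─ q ⊆ p′ ─ q
─-monoˡ {p = p} q p⊆ x∈ with x∈p , x∉q ← x∈p─q⁻ p q x∈ = x∈p∧x∉q⇒x∈p─q (p⊆ x∈p) x∉q

-- Containment as multisets: each element occurs on the left at most as often as on the right. The
-- next estimates and the uncrossing inequality are obtained by such counting, with `⊥` as a dummy
-- where only one set is present.
∪∩-mono : (p q p′ q′ : Subset r) →
          p ∪ q ⊆ p′ ∪ q′ → p ∩ q ⊆ p′ ∩ q′ → ∣ p ∣ + ∣ q ∣ ≤ ∣ p′ ∣ + ∣ q′ ∣
∪∩-mono p q p′ q′ ∪⊆ ∩⊆ = begin
  ∣ p ∣ + ∣ q ∣             ≡⟨ ∣p∪q∣+∣p∩q∣ p q ⟨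
  ∣ p ∪ q ∣ + ∣ p ∩ q ∣     ≤⟨ ℕ.+-mono-≤ (p⊆q⇒∣p∣≤∣q∣ ∪⊆) (p⊆q⇒∣p∣≤∣q∣ ∩⊆) ⟩
  ∣ p′ ∪ q′ ∣ + ∣ p′ ∩ q′ ∣ ≡⟨ ∣p∪q∣+∣p∩q∣ p′ q′ ⟩
  ∣ p′ ∣ + ∣ q′ ∣           ∎
  where
  open ℕ.≤-Reasoning
  ∣p∪q∣+∣p∩q∣ : ∀ {r} (p q : Subset r) → ∣ p ∪ q ∣ + ∣ p ∩ q ∣ ≡ ∣ p ∣ + ∣ q ∣
  ∣p∪q∣+∣p∩q∣ [] [] = refl
  ∣p∪q∣+∣p∩q∣ (true ∷ p) (true ∷ q) =
    cong suc (trans (ℕ.+-suc _ _) (trans (cong suc (∣p∪q∣+∣p∩q∣ p q)) (sym (ℕ.+-suc _ _))))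
  ∣p∪q∣+∣p∩q∣ (true ∷ p) (false ∷ q) = cong suc (∣p∪q∣+∣p∩q∣ p q)
  ∣p∪q∣+∣p∩q∣ (false ∷ p) (true ∷ q) =
    trans (cong suc (∣p∪q∣+∣p∩q∣ p q)) (sym (ℕ.+-suc _ _))
  ∣p∪q∣+∣p∩q∣ (false ∷ p) (false ∷ q) = ∣p∪q∣+∣p∩q∣ p q

∣p∣≤∣q∣+∣p─q∣ : (p q : Subset r) → ∣ p ∣ ≤ ∣ q ∣ + ∣ p ─ q ∣
∣p∣≤∣q∣+∣p─q∣ {r} p q = begin
  ∣ p ∣             ≤⟨ ℕ.m≤m+n ∣ p ∣ ∣ ⊥ {r} ∣ ⟩
  ∣ p ∣ + ∣ ⊥ {r} ∣ ≤⟨ ∪∩-mono p ⊥ q (p ─ q)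
                         ([ split , ⊥-elim ∘ ∉⊥ ]′ ∘ x∈p∪q⁻ p ⊥) (⊥-elim ∘ ∉⊥ ∘ p∩q⊆q p ⊥) ⟩
  ∣ q ∣ + ∣ p ─ q ∣ ∎
  where
  open ℕ.≤-Reasoning
  split : p ⊆ q ∪ (p ─ q)
  split {x} x∈p with x ∈? q
  ... | yes x∈q = p⊆p∪q (p ─ q) x∈q
  ... | no x∉q = q⊆p∪q q (p ─ q) (x∈p∧x∉q⇒x∈p─q x∈p x∉q)

∣p∣+∣q∣≤∣r∣ : (p q s : Subset r) → p ⊆ s → q ⊆ s → (∀ {x} → x ∈ p → x ∉ q) →
              ∣ p ∣ + ∣ q ∣ ≤ ∣ s ∣
∣p∣+∣q∣≤∣r∣ {r} p q s p⊆s q⊆s p#q = begin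
  ∣ p ∣ + ∣ q ∣     ≤⟨ ∪∩-mono p q s ⊥
                         ([ p⊆p∪q ⊥ ∘ p⊆s , p⊆p∪q ⊥ ∘ q⊆s ]′ ∘ x∈p∪q⁻ p q)
                         (λ x∈ → let x∈p , x∈q = x∈p∩q⁻ p q x∈ in ⊥-elim (p#q x∈p x∈q)) ⟩
  ∣ s ∣ + ∣ ⊥ {r} ∣ ≡⟨ cong (∣ s ∣ +_) (∣⊥∣≡0 r) ⟩
  ∣ s ∣ + 0         ≡⟨ ℕ.+-identityʳ ∣ s ∣ ⟩
  ∣ s ∣             ∎
  where open ℕ.≤-Reasoning

∣p∪q∣≤∣p∣+∣q∣ : (p q : Subset r) → ∣ p ∪ q ∣ ≤ ∣ p ∣ + ∣ q ∣
∣p∪q∣≤∣p∣+∣q∣ {r} p q = ℕ.≤-trans (ℕ.m≤m+n ∣ p ∪ q ∣ ∣ ⊥ {r} ∣)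
  (∪∩-mono (p ∪ q) ⊥ p q ([ id , ⊥-elim ∘ ∉⊥ ]′ ∘ x∈p∪q⁻ (p ∪ q) ⊥)
    (⊥-elim ∘ ∉⊥ ∘ p∩q⊆q (p ∪ q) ⊥))

∣q∣+∣p─q∣≤∣p∣ : (p q : Subset r) → q ⊆ p → ∣ q ∣ + ∣ p ─ q ∣ ≤ ∣ p ∣
∣q∣+∣p─q∣≤∣p∣ p q q⊆p =
  ∣p∣+∣q∣≤∣r∣ q (p ─ q) p q⊆p (p─q⊆p p q) λ x∈q x∈─ → proj₂ (x∈p─q⁻ p q x∈─) x∈q

-- Here `a`, `b` stand for the sizes of S_X and S_Y, `s`, `t` for those of S⁻ and S⁺, `x`, `y` for
-- the numbers of separator edges outside S_X and S_Y, and `f` for the number of deletions inside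
-- the component.
below-demand : ∀ {f x y k a b s t} → f + (x + y) < k → s ≤ a + x → t ≤ b + y →
               f < (k + a + b) ∸ (s + t)
below-demand {f} {x} {y} {k} {a} {b} {s} {t} f< s≤ t≤ = ℕ.m+n≤o⇒m≤o∸n (suc f) (begin
  suc f + (s + t)             ≤⟨ ℕ.+-monoʳ-≤ (suc f) (ℕ.+-mono-≤ s≤ t≤) ⟩
  suc f + ((a + x) + (b + y)) ≡⟨ solve 5 (λ f a b x y →
                                   con 1 :+ f :+ ((a :+ x) :+ (b :+ y)) :=
                                   (con 1 :+ (f :+ (x :+ y))) :+ a :+ b) refl f a b x y ⟩
  suc (f + (x + y)) + a + b   ≤⟨ ℕ.+-monoˡ-≤ b (ℕ.+-monoˡ-≤ a f<) ⟩
  k + a + b                   ∎)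
  where
  open ℕ.≤-Reasoning
  open +-*-Solver

above-demand : ∀ {f x y k a b s t} → f < (k + a + b) ∸ (s + t) → a + x ≤ s → b + y ≤ t →
               f + (x + y) < k
above-demand {f} {x} {y} {k} {a} {b} {s} {t} f< ≤s ≤t = ℕ.+-cancelʳ-< (a + b) _ _ (begin-strict
  f + (x + y) + (a + b)   ≡⟨ solve 5 (λ f a b x y →
                               f :+ (x :+ y) :+ (a :+ b) :=
                               f :+ ((a :+ x) :+ (b :+ y))) refl f a b x y ⟩
  f + ((a + x) + (b + y)) ≤⟨ ℕ.+-monoʳ-≤ f (ℕ.+-mono-≤ ≤s ≤t) ⟩
  f + (s + t)             <⟨ ℕ.≰⇒> (λ ≤f → ℕ.<⇒≱ f< (ℕ.m≤n+o⇒m∸n≤o (k + a + b) (s + t)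
                               (subst (k + a + b ≤_) (ℕ.+-comm f (s + t)) ≤f))) ⟩
  k + a + b               ≡⟨ ℕ.+-assoc k a b ⟩
  k + (a + b)             ∎)
  where
  open ℕ.≤-Reasoning
  open +-*-Solver

Star-exit : {A : Set} {R : Rel A ℓ} (p : A → Set) → (∀ x → Dec (p x)) → ∀ {x y} →
            Star R x y → p x → ¬ p y → ∃₂ λ a b → R a b × p a × ¬ p b
Star-exit p p? ε px ¬py = ⊥-elim (¬py px)
Star-exit p p? (_◅_ {_} {z} r rs) px ¬py with p? z
... | yes pz = Star-exit p p? rs pz ¬py
... | no ¬pz = _ , _ , r , px , ¬pz

-- Walks, closed sets and reachability.

module Walks (G : Graph) where
  open Graph G

  Joins : Edge G → Vertex G → Vertex G → Set
  Joins e u v = ends e ≡ (u , v) ⊎ ends e ≡ (v , u)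

  Adj : Edges G → Rel (Vertex G) _
  Adj E u v = ∃ λ e → e ∈ E × Joins e u v

  Conn : Edges G → Vertices G → Vertices G → Set
  Conn E X Y = ∃₂ λ x y → x ∈ X × y ∈ Y × Star (Adj E) x y

  Closed : Edges G → Vertices G → Set
  Closed E U = ∀ {u v} → Adj E u v → u ∈ U → v ∈ U

  Disjoint : Vertices G → Vertices G → Set
  Disjoint X Y = ∀ {v} → v ∈ X → v ∉ Y

  -- RSND on bare edge sets, the subgraph E of E′: unlike for Linked, a walk of length 0 needs no
  -- vertex membership.
  Feasible : (E′ E : Edges G) → Vertices G → Vertices G → ℕ → Set
  Feasible E′ E P Q k = ∀ F → ∣ F ∣ < k → Conn (E′ ─ F) P Q → Conn (E ─ F) P Q

  private
    variable
      e               : Edge G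
      u v w           : Vertex G
      k n             : ℕ
      E E′ E″ F       : Edges G
      A B N P Q U X Y : Vertices G

  joins-sym : Joins e u v → Joins e v u
  joins-sym (inj₁ p) = inj₂ p
  joins-sym (inj₂ p) = inj₁ p

  joins-ends : ∀ e → Joins e (proj₁ (ends e)) (proj₂ (ends e))
  joins-ends e = inj₁ refl

  joins⇒incidentˡ : Joins e u v → Incident G u e
  joins⇒incidentˡ (inj₁ p) = inj₁ (sym (cong proj₁ p))
  joins⇒incidentˡ (inj₂ p) = inj₂ (sym (cong proj₂ p))

  incident⇒either : Joins e u v → Incident G w e → w ≡ u ⊎ w ≡ v
  incident⇒either (inj₁ p) (inj₁ q) = inj₁ (trans q (cong proj₁ p))
  incident⇒either (inj₁ p) (inj₂ q) = inj₂ (trans q (cong proj₂ p))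
  incident⇒either (inj₂ p) (inj₁ q) = inj₂ (trans q (cong proj₁ p))
  incident⇒either (inj₂ p) (inj₂ q) = inj₁ (trans q (cong proj₂ p))

  joins⇒either : ∀ {u′ v′} → Joins e u v → Joins e u′ v′ → (u ≡ u′ × v ≡ v′) ⊎ (u ≡ v′ × v ≡ u′)
  joins⇒either (inj₁ p) (inj₁ q) with refl ← trans (sym p) q = inj₁ (refl , refl)
  joins⇒either (inj₁ p) (inj₂ q) with refl ← trans (sym p) q = inj₂ (refl , refl)
  joins⇒either (inj₂ p) (inj₁ q) with refl ← trans (sym p) q = inj₂ (refl , refl)
  joins⇒either (inj₂ p) (inj₂ q) with refl ← trans (sym p) q = inj₁ (refl , refl)

  ∈touching⁺ : ∀ {S} → e ∈ S → Incident G v e → v ∈ touching G S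
  ∈touching⁺ {S = S} e∈S v~e =
    ∈⟪⟫⁺ (λ v → any? (λ e → (e ∈? S) ×-dec incident? G v e)) (_ , e∈S , v~e)

  ∈touching⁻ : ∀ {S} → v ∈ touching G S → ∃ λ e → e ∈ S × Incident G v e
  ∈touching⁻ {S = S} = ∈⟪⟫⁻ (λ v → any? (λ e → (e ∈? S) ×-dec incident? G v e))

  ∈edgesAt⁺ : ∀ {S} → e ∈ S → v ∈ X → Incident G v e → e ∈ edgesAt G S X
  ∈edgesAt⁺ {X = X} e∈S v∈X v~e =
    x∈p∩q⁺ (e∈S , ∈⟪⟫⁺ (λ e → any? (λ v → (v ∈? X) ×-dec incident? G v e)) (_ , v∈X , v~e))

  ∈edgesAt⁻ : ∀ S X → e ∈ edgesAt G S X → e ∈ S × (∃ λ v → v ∈ X × Incident G v e)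
  ∈edgesAt⁻ S X e∈ with x∈p∩q⁻ S _ e∈
  ... | e∈S , q = e∈S , ∈⟪⟫⁻ (λ e → any? (λ v → (v ∈? X) ×-dec incident? G v e)) q

  Crosses : Vertices G → Edge G → Set
  Crosses U e = ∃₂ λ u v → Joins e u v × u ∈ U × v ∉ U

  crosses? : ∀ U → Decidable (Crosses U)
  crosses? U e with proj₁ (ends e) ∈? U | proj₂ (ends e) ∈? U
  ... | yes p | no q = yes (_ , _ , joins-ends e , p , q)
  ... | no p | yes q = yes (_ , _ , joins-sym (joins-ends e) , q , p)
  ... | yes p | yes q = no λ where
    (_ , _ , inj₁ refl , _ , v∉) → v∉ q
    (_ , _ , inj₂ refl , _ , v∉) → v∉ p
  ... | no p | no q = no λ where
    (_ , _ , inj₁ refl , u∈ , _) → p u∈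
    (_ , _ , inj₂ refl , u∈ , _) → q u∈

  abstract
    boundary : Vertices G → Edges G
    boundary U = ⟪ crosses? U ⟫

    ∈boundary⁺ : Joins e u v → u ∈ U → v ∉ U → e ∈ boundary U
    ∈boundary⁺ {U = U} j u∈ v∉ = ∈⟪⟫⁺ (crosses? U) (_ , _ , j , u∈ , v∉)

    ∈boundary⁻ : ∀ U → e ∈ boundary U → Crosses U e
    ∈boundary⁻ U = ∈⟪⟫⁻ (crosses? U)

  within? : ∀ R → Decidable (λ e → proj₁ (ends e) ∈ R × proj₂ (ends e) ∈ R)
  within? R e = (proj₁ (ends e) ∈? R) ×-dec (proj₂ (ends e) ∈? R)

  abstract
    within : Vertices G → Edges G
    within R = ⟪ within? R ⟫

    ∈within⁺ : ∀ {R} → Joins e u v → u ∈ R → v ∈ R → e ∈ within R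
    ∈within⁺ {R = R} (inj₁ refl) p q = ∈⟪⟫⁺ (within? R) (p , q)
    ∈within⁺ {R = R} (inj₂ refl) p q = ∈⟪⟫⁺ (within? R) (q , p)

    ∈within⁻ : ∀ R → Joins e u v → e ∈ within R → u ∈ R × v ∈ R
    ∈within⁻ R (inj₁ refl) e∈ = ∈⟪⟫⁻ (within? R) e∈
    ∈within⁻ R (inj₂ refl) e∈ with p , q ← ∈⟪⟫⁻ (within? R) e∈ = q , p

  adj-sym : Adj E u v → Adj E v u
  adj-sym (e , e∈ , j) = e , e∈ , joins-sym j

  adj-mono : E ⊆ E′ → Adj E u v → Adj E′ u v
  adj-mono E⊆ (e , e∈ , j) = e , E⊆ e∈ , j

  walk-sym : Star (Adj E) u v → Star (Adj E) v u
  walk-sym = Star.reverse adj-sym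

  walk-mono : E ⊆ E′ → Star (Adj E) u v → Star (Adj E′) u v
  walk-mono E⊆ = Star.map (adj-mono E⊆)

  conn-sym : Conn E X Y → Conn E Y X
  conn-sym (x , y , x∈ , y∈ , p) = y , x , y∈ , x∈ , walk-sym p

  exit : ∀ U → Star (Adj E) u v → u ∈ U → v ∉ U → ∃₂ λ a b → Adj E a b × a ∈ U × b ∉ U
  exit U = Star-exit (_∈ U) (_∈? U)

  closed-walk : Closed E U → Star (Adj E) u v → u ∈ U → v ∈ U
  closed-walk c ε u∈ = u∈
  closed-walk c (a ◅ p) u∈ = closed-walk c p (c a u∈)

  closed-∁ : Closed E U → Closed E (∁ U)
  closed-∁ {U = U} c a u∈ = x∉p⇒x∈∁p (λ v∈ → x∈∁p⇒x∉p u∈ (c (adj-sym a) v∈))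

  conn-mono : E ⊆ E′ → Conn E X Y → Conn E′ X Y
  conn-mono E⊆ (x , y , x∈ , y∈ , p) = x , y , x∈ , y∈ , walk-mono E⊆ p

  closed⇒¬conn : Closed E U → X ⊆ U → Disjoint Y U → ¬ Conn E X Y
  closed⇒¬conn c X⊆ Y# (x , y , x∈ , y∈ , p) = Y# y∈ (closed-walk c p (X⊆ x∈))

  boundary⊆⇒closed : E ∩ boundary U ⊆ F → Closed (E ─ F) U
  boundary⊆⇒closed {E} {U} {F} b⊆F {u} {v} (e , e∈ , j) u∈ =
    let e∈E , e∉F = x∈p─q⁻ E F e∈
    in decidable-stable (v ∈? U) λ v∉ → e∉F (b⊆F (x∈p∩q⁺ (e∈E , ∈boundary⁺ j u∈ v∉)))

  private
    -- `n` exceeds the number of vertices outside `S`; each round adds the far end of an edge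
    -- leaving `S`.
    grow : ∀ n E S → ∣ ∁ S ∣ < n →
           ∃ λ U → S ⊆ U × Closed E U × (∀ {v} → v ∈ U → ∃ λ x → x ∈ S × Star (Adj E) x v)
    grow (suc n) E S (s≤s ≤n) with any? (λ e → (e ∈? E) ×-dec crosses? S e)
    ... | no none = S , id , closed , λ v∈ → _ , v∈ , ε
      where
      closed : Closed E S
      closed {v = v} (e , e∈ , j) u∈ =
        decidable-stable (v ∈? S) λ v∉ → none (e , e∈ , _ , _ , j , u∈ , v∉)
    ... | yes (e , e∈ , u , v , j , u∈ , v∉) with grow n E (S ∪ ⁅ v ⁆) (ℕ.<-≤-trans fewer ≤n)
      where
      fewer : ∣ ∁ (S ∪ ⁅ v ⁆) ∣ < ∣ ∁ S ∣
      fewer = p⊂q⇒∣p∣<∣q∣ (p⊂q⇒∁p⊃∁q (p⊆p∪q ⁅ v ⁆ , v , q⊆p∪q S ⁅ v ⁆ (x∈⁅x⁆ v) , v∉))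
    ...   | U , S⊆ , closed , walks =
      U , S⊆ ∘ p⊆p∪q ⁅ v ⁆ , closed , λ w∈ → back (walks w∈)
      where
      back : ∀ {w} → (∃ λ x → x ∈ S ∪ ⁅ v ⁆ × Star (Adj E) x w) → ∃ λ x → x ∈ S × Star (Adj E) x w
      back (x , x∈ , p) with x∈p∪q⁻ S ⁅ v ⁆ x∈
      ... | inj₁ x∈S = x , x∈S , p
      ... | inj₂ x∈v with refl ← x∈⁅y⁆⇒x≡y v x∈v = u , u∈ , (e , e∈ , j) ◅ p

    abstract
      grown : ∀ E X → ∃ λ U → X ⊆ U × Closed E U × (∀ {v} → v ∈ U → ∃ λ x → x ∈ X × Star (Adj E) x v)
      grown E X = grow (suc ∣ ∁ X ∣) E X ℕ.≤-refl

  reach : Edges G → Vertices G → Vertices G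
  reach E X = proj₁ (grown E X)

  reach-⊇ : ∀ E X → X ⊆ reach E X
  reach-⊇ E X = proj₁ (proj₂ (grown E X))

  reach-closed : ∀ E X → Closed E (reach E X)
  reach-closed E X = proj₁ (proj₂ (proj₂ (grown E X)))

  reach-walk : ∀ E X → v ∈ reach E X → ∃ λ x → x ∈ X × Star (Adj E) x v
  reach-walk E X = proj₂ (proj₂ (proj₂ (grown E X)))

  reach-least : Closed E U → X ⊆ U → reach E X ⊆ U
  reach-least {E} {U} {X} c X⊆ v∈ with x , x∈ , p ← reach-walk E X v∈ = closed-walk c p (X⊆ x∈)

  separated? : ∀ E X Y → Conn E X Y ⊎ Disjoint Y (reach E X)
  separated? E X Y with any? (λ y → (y ∈? Y) ×-dec (y ∈? reach E X))
  ... | yes (y , y∈ , y∈r) with x , x∈ , p ← reach-walk E X y∈r = inj₁ (x , y , x∈ , y∈ , p)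
  ... | no none = inj₂ λ y∈ y∈r → none (_ , y∈ , y∈r)

  -- The set reached from `X` is itself a candidate cut, so refuting all cuts produces a walk.
  conn-by-cuts : ∀ E X Y → (∀ U → Closed E U → X ⊆ U → ¬ Disjoint Y U) → Conn E X Y
  conn-by-cuts E X Y no-cut with separated? E X Y
  ... | inj₁ c = c
  ... | inj₂ d = ⊥-elim (no-cut (reach E X) (reach-closed E X) (reach-⊇ E X) d)

  boundary-∁ : ∀ U → boundary (∁ U) ⊆ boundary U
  boundary-∁ U e∈ with u , v , j , u∈ , v∉ ← ∈boundary⁻ (∁ U) e∈ =
    ∈boundary⁺ (joins-sym j) (x∉∁p⇒x∈p v∉) (x∈∁p⇒x∉p u∈)

  walk-inside : Closed E U → Star (Adj E) u v → u ∈ U → Star (Adj (E ∩ within U)) u v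
  walk-inside c ε u∈ = ε
  walk-inside c ((e , e∈ , j) ◅ p) u∈ =
    let v∈ = c (e , e∈ , j) u∈
    in (e , x∈p∩q⁺ (e∈ , ∈within⁺ j u∈ v∈) , j) ◅ walk-inside c p v∈

  -- Minimum cuts, uncrossing and gluing.

  MinCut : Edges G → Vertices G → Vertices G → ℕ → Set
  MinCut E P Q h = ∀ U → P ⊆ U → Disjoint Q U → h ≤ ∣ E ∩ boundary U ∣

  minCut-sym : MinCut E P Q k → MinCut E Q P k
  minCut-sym {E} mc U Q⊆ P# =
    ℕ.≤-trans (mc (∁ U) (λ p∈ → x∉p⇒x∈∁p (P# p∈)) (λ q∈ q∈∁ → x∈∁p⇒x∉p q∈∁ (Q⊆ q∈)))
              (p⊆q⇒∣p∣≤∣q∣ (∩-monoʳ E (boundary-∁ U)))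

  feasible-sym : Feasible E′ E P Q k → Feasible E′ E Q P k
  feasible-sym f F F< c = conn-sym (f F F< (conn-sym c))

  -- For `N = A ─ B` this is submodularity of the boundary for the union and the intersection of `A`
  -- and `B`. A part `N` of `A ─ B` serves as well, provided that no edge joins it to the rest of
  -- `A ─ B`.
  uncrossing : ∀ E A B N → N ⊆ A → Disjoint N B →
               (∀ {u v} → Adj E u v → u ∈ N → v ∈ A → v ∉ B → v ∈ N) →
               ∣ E ∩ boundary (B ∪ N) ∣ + ∣ E ∩ boundary (A ─ N) ∣
                 ≤ ∣ E ∩ boundary B ∣ + ∣ E ∩ boundary A ∣
  uncrossing E A B N N⊆A N#B isolated =
    ∪∩-mono (E ∩ boundary (B ∪ N)) (E ∩ boundary (A ─ N)) (E ∩ boundary B) (E ∩ boundary A)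
      ∪⊆ ∩⊆
    where
    split : e ∈ E → e ∈ boundary B ⊎ e ∈ boundary A → e ∈ (E ∩ boundary B) ∪ (E ∩ boundary A)
    split e∈E (inj₁ b) = x∈p∪q⁺ (inj₁ (x∈p∩q⁺ (e∈E , b)))
    split e∈E (inj₂ a) = x∈p∪q⁺ (inj₂ (x∈p∩q⁺ (e∈E , a)))

    one : e ∈ E → Crosses (B ∪ N) e → e ∈ boundary B ⊎ e ∈ boundary A
    one e∈E (u , v , j , u∈ , v∉) with x∈p∪q⁻ B N u∈
    ... | inj₁ u∈B = inj₁ (∈boundary⁺ j u∈B (v∉ ∘ p⊆p∪q N))
    ... | inj₂ u∈N = inj₂ (∈boundary⁺ j (N⊆A u∈N) λ v∈A →
      v∉ (q⊆p∪q B N (isolated (_ , e∈E , j) u∈N v∈A (v∉ ∘ p⊆p∪q N))))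

    two : e ∈ E → Crosses (A ─ N) e → e ∈ boundary B ⊎ e ∈ boundary A
    two e∈E (u , v , j , u∈ , v∉) with x∈p─q⁻ A N u∈ | v ∈? A | u ∈? B
    ... | u∈A , u∉N | no v∉A | _ = inj₂ (∈boundary⁺ j u∈A v∉A)
    ... | u∈A , u∉N | yes v∈A | yes u∈B = inj₁ (∈boundary⁺ j u∈B (N#B v∈N))
      where v∈N = decidable-stable (v ∈? N) λ v∉N → v∉ (x∈p∧x∉q⇒x∈p─q v∈A v∉N)
    ... | u∈A , u∉N | yes v∈A | no u∉B =
      ⊥-elim (v∉ (x∈p∧x∉q⇒x∈p─q v∈A λ v∈N →
        u∉N (isolated (_ , e∈E , joins-sym j) v∈N u∈A u∉B)))

    both : e ∈ E → Crosses (B ∪ N) e → Crosses (A ─ N) e → e ∈ boundary B × e ∈ boundary A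
    both e∈E (u , v , j , u∈ , v∉) (u′ , v′ , j′ , u′∈ , v′∉)
      with x∈p─q⁻ A N u′∈ | x∈p∪q⁻ B N u∈ | joins⇒either j j′
    ... | u∈A , u∉N | inj₁ u∈B | inj₁ (refl , refl) =
      ∈boundary⁺ j u∈B (v∉ ∘ p⊆p∪q N) ,
      ∈boundary⁺ j u∈A λ v∈A → v′∉ (x∈p∧x∉q⇒x∈p─q v∈A (v∉ ∘ q⊆p∪q B N))
    ... | u∈A , u∉N | inj₂ u∈N | inj₁ (refl , refl) = ⊥-elim (u∉N u∈N)
    ... | v∈A , v∉N | inj₁ u∈B | inj₂ (refl , refl) =
      ∈boundary⁺ j u∈B (v∉ ∘ p⊆p∪q N) ,
      ∈boundary⁺ (joins-sym j) v∈A λ u∈A →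
        v′∉ (x∈p∧x∉q⇒x∈p─q u∈A λ u∈N → N#B u∈N u∈B)
    ... | v∈A , v∉N | inj₂ u∈N | inj₂ (refl , refl) =
      ⊥-elim (v∉N (isolated (_ , e∈E , j) u∈N v∈A (v∉ ∘ p⊆p∪q N)))

    ∪⊆ : (E ∩ boundary (B ∪ N)) ∪ (E ∩ boundary (A ─ N)) ⊆ (E ∩ boundary B) ∪ (E ∩ boundary A)
    ∪⊆ e∈ with x∈p∪q⁻ (E ∩ boundary (B ∪ N)) _ e∈
    ... | inj₁ l with e∈E , c ← x∈p∩q⁻ E _ l = split e∈E (one e∈E (∈boundary⁻ (B ∪ N) c))
    ... | inj₂ l with e∈E , c ← x∈p∩q⁻ E _ l = split e∈E (two e∈E (∈boundary⁻ (A ─ N) c))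

    ∩⊆ : (E ∩ boundary (B ∪ N)) ∩ (E ∩ boundary (A ─ N)) ⊆ (E ∩ boundary B) ∩ (E ∩ boundary A)
    ∩⊆ e∈ with l , l′ ← x∈p∩q⁻ (E ∩ boundary (B ∪ N)) _ e∈
      with e∈E , c ← x∈p∩q⁻ E _ l
      with b , a ← both e∈E (∈boundary⁻ (B ∪ N) c) (∈boundary⁻ (A ─ N) (proj₂ (x∈p∩q⁻ E _ l′)))
      = x∈p∩q⁺ (x∈p∩q⁺ (e∈E , b) , x∈p∩q⁺ (e∈E , a))

  piece : Edges G → Vertices G → Vertices G → Vertex G → Vertices G
  piece E A B u = reach (E ∩ within (A ─ B)) ⁅ u ⁆

  module _ {E : Edges G} {A B : Vertices G} {u : Vertex G} (u∈A : u ∈ A) (u∉B : u ∉ B) where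

    private
      C = piece E A B u

    ∈piece : u ∈ C
    ∈piece = reach-⊇ (E ∩ within (A ─ B)) ⁅ u ⁆ (x∈⁅x⁆ u)

    piece⊆ : C ⊆ A ─ B
    piece⊆ = reach-least (λ (e , e∈ , j) _ → proj₂ (∈within⁻ (A ─ B) j (proj₂ (x∈p∩q⁻ E _ e∈))))
      λ x∈ → subst (_∈ A ─ B) (sym (x∈⁅y⁆⇒x≡y u x∈)) (x∈p∧x∉q⇒x∈p─q u∈A u∉B)

    piece⊆A : C ⊆ A
    piece⊆A = proj₁ ∘ x∈p─q⁻ A B ∘ piece⊆

    piece#B : Disjoint C B
    piece#B = proj₂ ∘ x∈p─q⁻ A B ∘ piece⊆

    piece-isolated : ∀ {v w} → Adj E v w → v ∈ C → w ∈ A → w ∉ B → w ∈ C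
    piece-isolated (e , e∈ , j) v∈ w∈A w∉B =
      reach-closed (E ∩ within (A ─ B)) ⁅ u ⁆
        (e , x∈p∩q⁺ (e∈ , ∈within⁺ j (piece⊆ v∈) (x∈p∧x∉q⇒x∈p─q w∈A w∉B)) , j) v∈

    piece-walk : v ∈ C → Star (Adj (E ∩ within C)) u v
    piece-walk v∈ with x , x∈ , p ← reach-walk (E ∩ within (A ─ B)) ⁅ u ⁆ v∈
      with refl ← x∈⁅y⁆⇒x≡y u x∈ =
      walk-mono (λ e∈ → let l , e∈C = x∈p∩q⁻ _ (within C) e∈
                        in x∈p∩q⁺ (proj₁ (x∈p∩q⁻ E _ l) , e∈C))
        (walk-inside (reach-closed (E ∩ within (A ─ B)) ⁅ u ⁆) p ∈piece)

    -- `A` is closed in `E ─ F`, so the walk stays in `A` and can leave the piece only into `B`.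
    piece-touches : Closed (E ─ F) A → Star (Adj (E ─ F)) u v → v ∉ C →
                    ∃₂ λ b c → Adj E b c × b ∈ B × c ∈ C
    piece-touches {F = F} closed p v∉ with exit C p ∈piece v∉
    ... | c , b , a@(e , e∈ , j) , c∈ , b∉ =
      b , c , adj-sym a′ ,
      decidable-stable (b ∈? B)
        (λ b∉B → b∉ (piece-isolated a′ c∈ (closed a (piece⊆A c∈)) b∉B)) ,
      c∈
      where
      a′ : Adj E c b
      a′ = e , proj₁ (x∈p─q⁻ E F e∈) , j

    -- `A ─ C` keeps at least `h` boundary edges, as many as `B` has at most; so by uncrossing,
    -- moving `C` from `A` to `B` makes the boundary of `B ∪ C` no larger than that of `A`.
    piece-boundary : ∀ {h k} → ∣ E ∩ boundary B ∣ ≤ h → ∣ E ∩ boundary A ∣ < k →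
                     h ≤ ∣ E ∩ boundary (A ─ C) ∣ → ∣ E ∩ boundary (B ∪ C) ∣ < k
    piece-boundary {h} {k} B≤ A< ≤A─C = ℕ.+-cancelʳ-< h _ _ (begin-strict
      ∣ E ∩ boundary (B ∪ C) ∣ + h
        ≤⟨ ℕ.+-monoʳ-≤ _ ≤A─C ⟩
      ∣ E ∩ boundary (B ∪ C) ∣ + ∣ E ∩ boundary (A ─ C) ∣
        ≤⟨ uncrossing E A B C piece⊆A piece#B piece-isolated ⟩
      ∣ E ∩ boundary B ∣ + ∣ E ∩ boundary A ∣
        <⟨ ℕ.+-mono-≤-< B≤ A< ⟩
      h + k
        ≡⟨ ℕ.+-comm h k ⟩
      k + h ∎)
      where open ℕ.≤-Reasoning

  within-mono : ∀ {R R′} → R ⊆ R′ → within R ⊆ within R′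
  within-mono {R} R⊆ {e} e∈ with u∈ , v∈ ← ∈within⁻ R (joins-ends e) e∈ =
    ∈within⁺ (joins-ends e) (R⊆ u∈) (R⊆ v∈)

  within⇒∉boundary : ∀ U → e ∈ within U → e ∉ boundary U
  within⇒∉boundary U e∈ b with u , v , j , u∈ , v∉ ← ∈boundary⁻ U b =
    v∉ (proj₂ (∈within⁻ U j e∈))

  within-∁⇒∉boundary : ∀ U → e ∈ within (∁ U) → e ∉ boundary U
  within-∁⇒∉boundary U e∈ b with u , v , j , u∈ , v∉ ← ∈boundary⁻ U b =
    x∈∁p⇒x∉p (proj₁ (∈within⁻ (∁ U) j e∈)) u∈

  -- Delete the boundary of `B ∪ N` in `E`. This cuts `B` off from `Q` in `E`, while in `E′` the
  -- route from `b` to `c`, through `N` to `u`, over the missing edge and on to `q` meets no deleted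
  -- edge. Fewer than `k` edges are deleted, contrary to the demand (B, Q, k).
  no-bridge : ∀ {b c q} → E ⊆ E′ → Feasible E′ E B Q k → Disjoint Q (B ∪ N) →
              ∣ E ∩ boundary (B ∪ N) ∣ < k →
              b ∈ B → Adj E b c → c ∈ N → Star (Adj (E ∩ within N)) u c →
              e ∈ E′ → e ∉ E → Joins e u v →
              q ∈ Q → ¬ Star (Adj (E ∩ within (∁ (B ∪ N)))) v q
  no-bridge {E} {E′} {B} {Q} {N = N} {e = e} E⊆ f Q# D<k b∈ (e′ , e′∈ , j′) c∈ u→c e∈ e∉ j q∈ v→q =
    closed⇒¬conn (boundary⊆⇒closed id) (p⊆p∪q N) Q# (f D D<k conn)
    where
    D = E ∩ boundary (B ∪ N)

    spared : ∀ {x} → x ∈ E → x ∉ boundary (B ∪ N) → x ∈ E′ ─ D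
    spared x∈E x∉ = x∈p∧x∉q⇒x∈p─q (E⊆ x∈E) (x∉ ∘ proj₂ ∘ x∈p∩q⁻ E _)

    conn : Conn (E′ ─ D) B Q
    conn = _ , _ , b∈ , q∈ ,
      ((e′ , spared e′∈ (within⇒∉boundary (B ∪ N)
                          (∈within⁺ j′ (p⊆p∪q N b∈) (q⊆p∪q B N c∈))) , j′)
       ◅ walk-mono (λ x∈ → let x∈E , x∈N = x∈p∩q⁻ E _ x∈
                           in spared x∈E (within⇒∉boundary (B ∪ N) (within-mono (q⊆p∪q B N) x∈N)))
                   (walk-sym u→c))
      ◅◅ (e , x∈p∧x∉q⇒x∈p─q e∈ (e∉ ∘ proj₁ ∘ x∈p∩q⁻ E _) , j)
      ◅ walk-mono (λ x∈ → let x∈E , x∈∁ = x∈p∩q⁻ E _ x∈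
                          in spared x∈E (within-∁⇒∉boundary (B ∪ N) x∈∁)) v→q

  -- The two sides are not symmetric. `A ─ Nᵤ` always contains `P` and misses `Q`, so the minimum
  -- cut bound applies to it. `∁ A ─ Zᵥ` contains `Q` only if `Zᵥ` misses `Q`, and this is known
  -- only after the search from `v` outside `B ∪ Nᵤ` has failed to reach `Q`. Hence the order of the
  -- cases in `conclude`.
  no-missing-edge-beyond : ∀ {h p q} → E ⊆ E′ → P ⊆ B → Disjoint Q B →
    ∣ E ∩ boundary B ∣ ≤ h → MinCut E P Q h → Feasible E′ E B Q k →
    Closed (E ─ F) A → P ⊆ A → Disjoint Q A → ∣ E ∩ boundary A ∣ < k →
    p ∈ P → Star (Adj (E ─ F)) u p → q ∈ Q → Star (Adj (E ─ F)) v q →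
    e ∈ E′ → e ∉ E → Joins e u v → u ∈ A → v ∉ A → u ∉ B → ¬ (v ∉ B)
  no-missing-edge-beyond {E} {E′} {P} {B} {Q} {k} {F} {A} {u} {v} {e} {h}
    E⊆ P⊆B Q#B B≤h mc f closed P⊆A Q#A A<k p∈ u→p q∈ v→q e∈ e∉ j u∈A v∉A u∉B v∉B =
    conclude (separated? E₁ ⁅ v ⁆ Q) (separated? E₂ ⁅ u ⁆ Q)
    where
    v∈∁A : v ∈ ∁ A
    v∈∁A = x∉p⇒x∈∁p v∉A

    Nᵤ Zᵥ : Vertices G
    Nᵤ = piece E A B u
    Zᵥ = piece E (∁ A) B v

    E₁ E₂ : Edges G
    E₁ = E ∩ within (∁ (B ∪ Nᵤ))
    E₂ = E ∩ within (∁ (B ∪ Zᵥ))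

    Nᵤ#Zᵥ : Disjoint Nᵤ Zᵥ
    Nᵤ#Zᵥ n∈ z∈ = x∈∁p⇒x∉p (piece⊆A v∈∁A v∉B z∈) (piece⊆A u∈A u∉B n∈)

    Nᵤ⊆∁BZ : Nᵤ ⊆ ∁ (B ∪ Zᵥ)
    Nᵤ⊆∁BZ n∈ = x∉p⇒x∈∁p λ n∈∪ → [ piece#B u∈A u∉B n∈ , Nᵤ#Zᵥ n∈ ]′ (x∈p∪q⁻ B Zᵥ n∈∪)

    Zᵥ⊆∁BN : Zᵥ ⊆ ∁ (B ∪ Nᵤ)
    Zᵥ⊆∁BN z∈ = x∉p⇒x∈∁p λ z∈∪ → [ piece#B v∈∁A v∉B z∈ , (λ n∈ → Nᵤ#Zᵥ n∈ z∈) ]′ (x∈p∪q⁻ B Nᵤ z∈∪)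

    Nᵤ⊆U₂ : Nᵤ ⊆ reach E₂ ⁅ u ⁆
    Nᵤ⊆U₂ n∈ = closed-walk (reach-closed E₂ ⁅ u ⁆)
      (walk-mono (∩-monoʳ E (within-mono Nᵤ⊆∁BZ)) (piece-walk u∈A u∉B n∈))
      (reach-⊇ E₂ ⁅ u ⁆ (x∈⁅x⁆ u))

    Zᵥ⊆U₁ : Zᵥ ⊆ reach E₁ ⁅ v ⁆
    Zᵥ⊆U₁ z∈ = closed-walk (reach-closed E₁ ⁅ v ⁆)
      (walk-mono (∩-monoʳ E (within-mono Zᵥ⊆∁BN)) (piece-walk v∈∁A v∉B z∈))
      (reach-⊇ E₁ ⁅ v ⁆ (x∈⁅x⁆ v))

    Nᵤ-touches : ∃₂ λ b c → Adj E b c × b ∈ B × c ∈ Nᵤ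
    Nᵤ-touches = piece-touches u∈A u∉B closed u→p λ p∈Nᵤ → piece#B u∈A u∉B p∈Nᵤ (P⊆B p∈)

    via-N : ∀ {q′} → q′ ∈ Q → ¬ Star (Adj E₁) v q′
    via-N q′∈ v→q′ with b , c , bc , b∈ , c∈ ← Nᵤ-touches =
      no-bridge E⊆ f
        (λ q∈ q∈∪ → [ Q#B q∈ , Q#A q∈ ∘ piece⊆A u∈A u∉B ]′ (x∈p∪q⁻ B Nᵤ q∈∪))
        (piece-boundary {E = E} u∈A u∉B B≤h A<k
          (mc (A ─ Nᵤ)
            (λ p∈ → x∈p∧x∉q⇒x∈p─q (P⊆A p∈) λ p∈Nᵤ → piece#B u∈A u∉B p∈Nᵤ (P⊆B p∈))
            (λ q∈ → Q#A q∈ ∘ p─q⊆p A Nᵤ)))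
        b∈ bc c∈ (piece-walk u∈A u∉B c∈) e∈ e∉ j q′∈ v→q′

    ∁A<k : ∣ E ∩ boundary (∁ A) ∣ < k
    ∁A<k = ℕ.≤-<-trans (p⊆q⇒∣p∣≤∣q∣ (∩-monoʳ E (boundary-∁ A))) A<k

    h≤∁A─Z : Disjoint Q (reach E₁ ⁅ v ⁆) → h ≤ ∣ E ∩ boundary (∁ A ─ Zᵥ) ∣
    h≤∁A─Z Q#U₁ = minCut-sym {E = E} mc (∁ A ─ Zᵥ)
      (λ q∈ → x∈p∧x∉q⇒x∈p─q (x∉p⇒x∈∁p (Q#A q∈)) (Q#U₁ q∈ ∘ Zᵥ⊆U₁))
      (λ p∈ p∈∁A─Z → x∈∁p⇒x∉p (p─q⊆p (∁ A) Zᵥ p∈∁A─Z) (P⊆A p∈))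

    Z-touches : Disjoint Q (reach E₁ ⁅ v ⁆) → ∃₂ λ b c → Adj E b c × b ∈ B × c ∈ Zᵥ
    Z-touches Q#U₁ = piece-touches v∈∁A v∉B (closed-∁ closed) v→q (Q#U₁ q∈ ∘ Zᵥ⊆U₁)

    via-Z : Disjoint Q (reach E₁ ⁅ v ⁆) → ∀ {q′} → q′ ∈ Q → ¬ Star (Adj E₂) u q′
    via-Z Q#U₁ q′∈ u→q′ with b , c , bc , b∈ , c∈ ← Z-touches Q#U₁ =
      no-bridge {N = Zᵥ} E⊆ f
        (λ q∈ q∈∪ → [ Q#B q∈ , Q#U₁ q∈ ∘ Zᵥ⊆U₁ ]′ (x∈p∪q⁻ B Zᵥ q∈∪))
        (piece-boundary {E = E} {A = ∁ A} v∈∁A v∉B B≤h ∁A<k (h≤∁A─Z Q#U₁))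
        b∈ bc c∈ (piece-walk {A = ∁ A} v∈∁A v∉B c∈) e∈ e∉ (joins-sym j) q′∈ u→q′

    -- Otherwise everything reachable outside B misses Q, and adding it to B gives a smaller cut.
    no-escape : Disjoint Q (reach E₁ ⁅ v ⁆) → ¬ Disjoint Q (reach E₂ ⁅ u ⁆)
    no-escape Q#U₁ Q#U₂ with b , c , (e′ , e′∈ , j′) , b∈ , c∈ ← Nᵤ-touches =
      ℕ.<⇒≱ (ℕ.<-≤-trans (p⊂q⇒∣p∣<∣q∣ (smaller , e′ , e′∈∂B , e′∉∂U₀)) B≤h)
        (mc U₀ (p⊆p∪q _ ∘ P⊆B)
          λ q∈ q∈U₀ → [ Q#B q∈ , [ Q#U₁ q∈ , Q#U₂ q∈ ]′ ∘ x∈p∪q⁻ U₁ U₂ ]′ (x∈p∪q⁻ B _ q∈U₀))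
      where
      U₁ U₂ U₀ : Vertices G
      U₁ = reach E₁ ⁅ v ⁆
      U₂ = reach E₂ ⁅ u ⁆
      U₀ = B ∪ (U₁ ∪ U₂)

      U₁⊆ : U₁ ⊆ U₀
      U₁⊆ = q⊆p∪q B _ ∘ p⊆p∪q U₂
      U₂⊆ : U₂ ⊆ U₀
      U₂⊆ = q⊆p∪q B _ ∘ q⊆p∪q U₁ U₂

      e′∈∂B : e′ ∈ E ∩ boundary B
      e′∈∂B = x∈p∩q⁺ (e′∈ , ∈boundary⁺ j′ b∈ (piece#B u∈A u∉B c∈))

      e′∉∂U₀ : e′ ∉ E ∩ boundary U₀
      e′∉∂U₀ = within⇒∉boundary U₀ (∈within⁺ j′ (p⊆p∪q _ b∈) (U₂⊆ (Nᵤ⊆U₂ c∈)))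
              ∘ proj₂ ∘ x∈p∩q⁻ E _

      outside-∪ : ∀ {x} C → x ∉ B → x ∉ C → x ∈ ∁ (B ∪ C)
      outside-∪ C x∉B x∉C = x∉p⇒x∈∁p ([ x∉B , x∉C ]′ ∘ x∈p∪q⁻ B C)

      smaller : E ∩ boundary U₀ ⊆ E ∩ boundary B
      smaller {x} x∈ with x∈E , x∈∂ ← x∈p∩q⁻ E _ x∈ with a , w , i , a∈ , w∉ ← ∈boundary⁻ U₀ x∈∂
        with a ∈? B
      ... | yes a∈B = x∈p∩q⁺ (x∈E , ∈boundary⁺ i a∈B (w∉ ∘ p⊆p∪q _))
      ... | no a∉B = ⊥-elim
        ([ from-U₁ , from-U₂ ]′ (x∈p∪q⁻ U₁ U₂ ([ ⊥-elim ∘ a∉B , id ]′ (x∈p∪q⁻ B _ a∈))))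
        where
        w∉B : w ∉ B
        w∉B = w∉ ∘ p⊆p∪q _

        -- An edge leaving `U₀` from a vertex `a` outside `B` would survive in `E₁` or in `E₂`,
        -- because `a` lies in at most one of the disjoint pieces `Nᵤ`, `Zᵥ` and belongs to the
        -- reach set of the other search if it lies in one.
        from-U₁∖Nᵤ : a ∈ U₁ → ¬ a ∉ Nᵤ
        from-U₁∖Nᵤ a∈U₁ a∉Nᵤ = w∉ (U₁⊆ (reach-closed E₁ ⁅ v ⁆
          (x , x∈p∩q⁺ (x∈E , ∈within⁺ i (outside-∪ Nᵤ a∉B a∉Nᵤ)
                                        (outside-∪ Nᵤ w∉B (w∉ ∘ U₂⊆ ∘ Nᵤ⊆U₂))) , i) a∈U₁))

        from-U₂∖Zᵥ : a ∈ U₂ → ¬ a ∉ Zᵥ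
        from-U₂∖Zᵥ a∈U₂ a∉Zᵥ = w∉ (U₂⊆ (reach-closed E₂ ⁅ u ⁆
          (x , x∈p∩q⁺ (x∈E , ∈within⁺ i (outside-∪ Zᵥ a∉B a∉Zᵥ)
                                        (outside-∪ Zᵥ w∉B (w∉ ∘ U₁⊆ ∘ Zᵥ⊆U₁))) , i) a∈U₂))

        from-U₁ : ¬ a ∈ U₁
        from-U₁ a∈U₁ = from-U₁∖Nᵤ a∈U₁ λ a∈Nᵤ → from-U₂∖Zᵥ (Nᵤ⊆U₂ a∈Nᵤ) (Nᵤ#Zᵥ a∈Nᵤ)

        from-U₂ : ¬ a ∈ U₂
        from-U₂ a∈U₂ = from-U₂∖Zᵥ a∈U₂ λ a∈Zᵥ → from-U₁∖Nᵤ (Zᵥ⊆U₁ a∈Zᵥ) λ a∈Nᵤ → Nᵤ#Zᵥ a∈Nᵤ a∈Zᵥ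

    conclude : Conn E₁ ⁅ v ⁆ Q ⊎ Disjoint Q (reach E₁ ⁅ v ⁆) →
               Conn E₂ ⁅ u ⁆ Q ⊎ Disjoint Q (reach E₂ ⁅ u ⁆) → Empty.⊥
    conclude (inj₁ (_ , _ , v′∈ , q′∈ , v→q′)) _ with refl ← x∈⁅y⁆⇒x≡y v v′∈ = via-N q′∈ v→q′
    conclude (inj₂ Q#U₁) (inj₁ (_ , _ , u′∈ , q′∈ , u→q′)) with refl ← x∈⁅y⁆⇒x≡y u u′∈ =
      via-Z Q#U₁ q′∈ u→q′
    conclude (inj₂ Q#U₁) (inj₂ Q#U₂) = no-escape Q#U₁ Q#U₂

  closed⇒boundary⊆ : Closed (E ─ F) U → E ∩ boundary U ⊆ F
  closed⇒boundary⊆ {E} {F} {U} closed {e} e∈ with e∈E , e∈∂ ← x∈p∩q⁻ E _ e∈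
    with u , v , j , u∈ , v∉ ← ∈boundary⁻ U e∈∂ =
    decidable-stable (e ∈? F) λ e∉F → v∉ (closed (e , x∈p∧x∉q⇒x∈p─q e∈E e∉F , j) u∈)

  ∣boundary-∁∣ : ∀ E U → ∣ E ∩ boundary (∁ U) ∣ ≤ ∣ E ∩ boundary U ∣
  ∣boundary-∁∣ E U = p⊆q⇒∣p∣≤∣q∣ (∩-monoʳ E (boundary-∁ U))

  -- By uncrossing, a cut violating the demand (P , Q) can be replaced by one violating
  -- (P , ∁ B) or (B , Q): one missing edge is treated at a time, on its side of B.
  module _ {E′ E : Edges G} {P Q B : Vertices G} {h k : ℕ}
    (P⊆B : P ⊆ B) (Q#B : Disjoint Q B) (E⊆ : E ⊆ E′)
    (B≤h : ∣ E ∩ boundary B ∣ ≤ h) (∂B⊆E : E′ ∩ boundary B ⊆ E) (mc : MinCut E P Q h)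
    (fˡ : Feasible E′ E P (∁ B) k) (fʳ : Feasible E′ E B Q k) where

    no-missing-edge : ∀ {F A p q a b e} → Closed (E ─ F) A → P ⊆ A → Disjoint Q A → ∣ F ∣ < k →
      p ∈ P → Star (Adj (E ─ F)) a p → q ∈ Q → Star (Adj (E ─ F)) b q →
      e ∈ E′ → Joins e a b → a ∈ A → b ∉ A → e ∈ E
    no-missing-edge {F} {A} {a = a} {b} {e} closed P⊆A Q#A F<k p∈ a→p q∈ b→q e∈ j a∈ b∉
      with e ∈? E
    ... | yes e∈E = e∈E
    ... | no e∉E with a ∈? B | b ∈? B
    ...   | yes a∈B | no b∉B = ∂B⊆E (x∈p∩q⁺ (e∈ , ∈boundary⁺ j a∈B b∉B))
    ...   | no a∉B | yes b∈B = ∂B⊆E (x∈p∩q⁺ (e∈ , ∈boundary⁺ (joins-sym j) b∈B a∉B))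
    ...   | no a∉B | no b∉B = ⊥-elim
      (no-missing-edge-beyond E⊆ P⊆B Q#B B≤h mc fʳ closed P⊆A Q#A
        (ℕ.≤-<-trans (p⊆q⇒∣p∣≤∣q∣ (closed⇒boundary⊆ closed)) F<k)
        p∈ a→p q∈ b→q e∈ e∉E j a∈ b∉ a∉B b∉B)
    -- Both ends inside `B`: the mirror image, with `P` and `Q` exchanged and `A` and `B`
    -- complemented.
    ...   | yes a∈B | yes b∈B = ⊥-elim
      (no-missing-edge-beyond E⊆ (x∉p⇒x∈∁p ∘ Q#B) (λ p∈ → x∈p⇒x∉∁p (P⊆B p∈))
        (ℕ.≤-trans (∣boundary-∁∣ E B) B≤h) (minCut-sym {E = E} mc) (feasible-sym fˡ)
        (closed-∁ closed) (x∉p⇒x∈∁p ∘ Q#A) (λ p∈ → x∈p⇒x∉∁p (P⊆A p∈))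
        (ℕ.≤-<-trans (∣boundary-∁∣ E A) (ℕ.≤-<-trans (p⊆q⇒∣p∣≤∣q∣ (closed⇒boundary⊆ closed)) F<k))
        q∈ b→q p∈ a→p e∈ e∉E (joins-sym j)
        (x∉p⇒x∈∁p b∉) (x∈p⇒x∉∁p a∈) (x∈p⇒x∉∁p b∈B) (x∈p⇒x∉∁p a∈B))

    only-new : ∀ {F A a b e₀} → Closed (E ─ F) A → Adj ((E ∪ ⁅ e₀ ⁆) ─ F) a b → a ∈ A → b ∉ A →
               Joins e₀ a b
    only-new {F} {e₀ = e₀} closed (e , e∈ , j) a∈ b∉ with e∈∪ , e∉F ← x∈p─q⁻ (E ∪ ⁅ e₀ ⁆) F e∈
      with x∈p∪q⁻ E ⁅ e₀ ⁆ e∈∪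
    ... | inj₁ e∈E = ⊥-elim (b∉ (closed (e , x∈p∧x∉q⇒x∈p─q e∈E e∉F , j) a∈))
    ... | inj₂ e∈⁅⁆ with refl ← x∈⁅y⁆⇒x≡y e₀ e∈⁅⁆ = j

    -- The given walk must leave both the set reached from `P` and the set reached from `Q` in
    -- `E ─ F`, and `e₀` is the only edge that can do so. If it leaves both at the same end, that
    -- end already connects `P` with `Q`. Otherwise one end is reached from `P` and the other from
    -- `Q`, which is the situation of `no-missing-edge`.
    remove-edge : ∀ {e₀} → e₀ ∈ E′ → e₀ ∉ E → ∀ F → ∣ F ∣ < k →
                  Conn ((E ∪ ⁅ e₀ ⁆) ─ F) P Q → Conn (E ─ F) P Q
    remove-edge {e₀} e₀∈ e₀∉ F F<k (p , q , p∈ , q∈ , walk)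
      with separated? (E ─ F) P Q | separated? (E ─ F) Q P
    ... | inj₁ c | _ = c
    ... | _ | inj₁ c = conn-sym c
    ... | inj₂ Q#A | inj₂ P#A′
      with a , b , ab , a∈ , b∉ ← exit (reach (E ─ F) P) walk (reach-⊇ (E ─ F) P p∈) (Q#A q∈)
      with b′ , a′ , b′a′ , b′∈ , a′∉ ←
        exit (reach (E ─ F) Q) (walk-sym walk) (reach-⊇ (E ─ F) Q q∈) (P#A′ p∈)
      with j ← only-new (reach-closed (E ─ F) P) ab a∈ b∉
      with p′ , p′∈ , p→a ← reach-walk (E ─ F) P a∈
      with q′ , q′∈ , q→b′ ← reach-walk (E ─ F) Q b′∈
      with joins⇒either j (only-new (reach-closed (E ─ F) Q) b′a′ b′∈ a′∉)
    ...   | inj₁ (refl , refl) = p′ , q′ , p′∈ , q′∈ , p→a ◅◅ walk-sym q→b′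
    ...   | inj₂ (refl , refl) = ⊥-elim (e₀∉
      (no-missing-edge (reach-closed (E ─ F) P) (reach-⊇ (E ─ F) P) Q#A F<k
        p′∈ (walk-sym p→a) q′∈ (walk-sym q→b′) e₀∈ j a∈ b∉))

  feasible-mono : E ⊆ E″ → Feasible E′ E P Q k → Feasible E′ E″ P Q k
  feasible-mono E⊆ f F F<k c = conn-mono (─-monoˡ F E⊆) (f F F<k c)

  minCut-mono : E ⊆ E′ → MinCut E P Q k → MinCut E′ P Q k
  minCut-mono {E} {E′} E⊆ mc U P⊆ Q# =
    ℕ.≤-trans (mc U P⊆ Q#) (p⊆q⇒∣p∣≤∣q∣ λ e∈ →
      let e∈E , e∈∂ = x∈p∩q⁻ E (boundary U) e∈ in x∈p∩q⁺ (E⊆ e∈E , e∈∂))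

  -- Induction on the number of missing edges. The hypotheses pass from `E` to `E ∪ ⁅ e₀ ⁆`; in
  -- particular the boundary of `B` does not grow, since `E` already contains every edge of `E′`
  -- across `B`.
  glue : ∀ {E′ E P Q B h k} → P ⊆ B → Disjoint Q B → E ⊆ E′ →
         ∣ E ∩ boundary B ∣ ≤ h → E′ ∩ boundary B ⊆ E → MinCut E P Q h →
         Feasible E′ E P (∁ B) k → Feasible E′ E B Q k → Feasible E′ E P Q k
  glue {E′} {E} {P} {Q} {B} {h} {k} P⊆B Q#B = λ E⊆ B≤h ∂B⊆ mc fˡ fʳ F F<k c →
    go (suc ∣ E′ ─ E ∣) E ℕ.≤-refl E⊆ B≤h ∂B⊆ mc fˡ fʳ F F<k c
    where
    go : ∀ n E → ∣ E′ ─ E ∣ < n → E ⊆ E′ → ∣ E ∩ boundary B ∣ ≤ h → E′ ∩ boundary B ⊆ E →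
         MinCut E P Q h → Feasible E′ E P (∁ B) k → Feasible E′ E B Q k → Feasible E′ E P Q k
    go (suc n) E (s≤s ≤n) E⊆ B≤h ∂B⊆ mc fˡ fʳ F F<k c with nonempty? (E′ ─ E)
    ... | no none = conn-mono (─-monoˡ F λ {e} e∈ →
      decidable-stable (e ∈? E) λ e∉ → none (e , x∈p∧x∉q⇒x∈p─q e∈ e∉)) c
    ... | yes (e₀ , e₀∈─) with e₀∈ , e₀∉ ← x∈p─q⁻ E′ E e₀∈─ =
      remove-edge P⊆B Q#B E⊆ B≤h ∂B⊆ mc fˡ fʳ e₀∈ e₀∉ F F<k
        (go n (E ∪ ⁅ e₀ ⁆) (ℕ.<-≤-trans fewer ≤n) E₁⊆
          (ℕ.≤-trans (p⊆q⇒∣p∣≤∣q∣ λ e∈ → let e∈E₁ , e∈∂ = x∈p∩q⁻ (E ∪ ⁅ e₀ ⁆) _ e∈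
                                         in x∈p∩q⁺ (∂B⊆ (x∈p∩q⁺ (E₁⊆ e∈E₁ , e∈∂)) , e∈∂)) B≤h)
          (p⊆p∪q ⁅ e₀ ⁆ ∘ ∂B⊆) (minCut-mono {E = E} (p⊆p∪q ⁅ e₀ ⁆) mc)
          (feasible-mono (p⊆p∪q ⁅ e₀ ⁆) fˡ) (feasible-mono (p⊆p∪q ⁅ e₀ ⁆) fʳ) F F<k c)
      where
      E₁⊆ : E ∪ ⁅ e₀ ⁆ ⊆ E′
      E₁⊆ e∈ with x∈p∪q⁻ E ⁅ e₀ ⁆ e∈
      ... | inj₁ e∈E = E⊆ e∈E
      ... | inj₂ e∈⁅⁆ with refl ← x∈⁅y⁆⇒x≡y e₀ e∈⁅⁆ = proj₁ (x∈p─q⁻ E′ E e₀∈─)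

      fewer : ∣ E′ ─ (E ∪ ⁅ e₀ ⁆) ∣ < ∣ E′ ─ E ∣
      fewer = p⊂q⇒∣p∣<∣q∣
        ( (λ e∈ → let e∈E′ , e∉ = x∈p─q⁻ E′ (E ∪ ⁅ e₀ ⁆) e∈
                  in x∈p∧x∉q⇒x∈p─q e∈E′ (e∉ ∘ p⊆p∪q ⁅ e₀ ⁆))
        , e₀ , e₀∈─ , λ e∈ → proj₂ (x∈p─q⁻ E′ (E ∪ ⁅ e₀ ⁆) e∈) (q⊆p∪q E ⁅ e₀ ⁆ (x∈⁅x⁆ e₀)))

-- A component and its attachment to an ambient graph G[M].

module Conversion (G : Graph) where
  open Graph G
  open Walks G

  private
    variable
      e              : Edge G
      u v w x        : Vertex G
      n              : ℕ
      E E′ F S S⁻ S⁺ : Edges G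
      L M P Q R Y    : Vertices G

  -- The index is the level: cuts of size `n` between the ends are used up, at level 1 by
  -- 2-edge-connectivity, hence the bound `suc n`.
  record Local (n : ℕ) (S⁻ : Edges G) (L R Y : Vertices G) (S⁺ : Edges G) : Set where
    field
      left⊆      : L ⊆ R
      right⊆     : Y ⊆ R
      outerˡ     : e ∈ S⁻ → ∃₂ λ w x → Joins e w x × w ∉ R × x ∈ L
      outerʳ     : e ∈ S⁺ → ∃₂ λ w y → Joins e w y × w ∉ R × y ∈ Y
      disjoint   : e ∈ S⁻ → e ∉ S⁺
      from-left  : v ∈ R → ∃ λ x → x ∈ L × Star (Adj (within R)) x v
      to-right   : v ∈ L → ∃ λ y → y ∈ Y × Star (Adj (within R)) v y
      minCut     : MinCut (within R) L Y (suc n)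

  -- How the part P of the ambient graph G[M] that precedes a component R is attached to it.
  -- An initial component has no predecessors, and P is its left set.
  data Left (M P R : Vertices G) (S⁻ : Edges G) (L : Vertices G) : Set where
    start : P ⊆ L → L ⊆ P → Left M P R S⁻ L
    inner : Disjoint P R →
            L ⊆ touching G S⁻ →
            (∀ {e} → e ∈ S⁻ → e ∈ within M × ∃₂ λ p x → Joins e p x × p ∈ P × x ∈ L) →
            (∀ {e p v} → e ∈ within M → Joins e p v → p ∈ P → v ∉ P → e ∈ S⁻ × v ∈ L) →
            Left M P R S⁻ L

  -- In `end`, nothing but `P` may be adjacent to `R` within G[M]. `start` needs no such clause, as
  -- there `P` lies inside the component and its exits are those of `R`.
  data Right (M P R Y : Vertices G) (S⁺ : Edges G) (Q : Vertices G) : Set where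
    end   : Q ⊆ Y → Y ⊆ Q →
            (∀ {e u v} → e ∈ within M → Joins e u v → u ∈ R → v ∉ P → v ∈ R) →
            Right M P R Y S⁺ Q
    inner : (∀ {v} → v ∈ Q → v ∉ P × v ∉ R) →
            Y ⊆ touching G S⁺ →
            (∀ {e} → e ∈ S⁺ → e ∈ within M × ∃₂ λ q y → Joins e q y × q ∈ Q × y ∈ Y) →
            (∀ {e u v} → e ∈ within M → Joins e u v → u ∈ R → v ∉ P → v ∉ R → e ∈ S⁺ × u ∈ Y) →
            Right M P R Y S⁺ Q

  -- The vertices at which `R` can be entered from `P` when `S` is the set of surviving separator
  -- edges. The union serves both constructors: in `start` the set `P` is all of `L`, in `inner` it
  -- misses `R`.
  attached : Vertices G → Edges G → Vertices G → Vertices G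
  attached P S L = L ∩ (P ∪ touching G S)

  ∈attachedᵖ : v ∈ L → v ∈ P → v ∈ attached P S L
  ∈attachedᵖ v∈L v∈P = x∈p∩q⁺ (v∈L , x∈p∪q⁺ (inj₁ v∈P))

  ∈attachedˢ : v ∈ L → e ∈ S → Incident G v e → v ∈ attached P S L
  ∈attachedˢ v∈L e∈S v~e = x∈p∩q⁺ (v∈L , x∈p∪q⁺ (inj₂ (∈touching⁺ e∈S v~e)))

  ∈attached⁻ : ∀ P S L → v ∈ attached P S L →
               v ∈ L × (v ∈ P ⊎ ∃ λ e → e ∈ S × Incident G v e)
  ∈attached⁻ P S L v∈ with v∈L , v∈∪ ← x∈p∩q⁻ L _ v∈ with x∈p∪q⁻ P (touching G S) v∈∪
  ... | inj₁ v∈P = v∈L , inj₁ v∈P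
  ... | inj₂ v∈S = v∈L , inj₂ (∈touching⁻ v∈S)

  -- If a closed set `D` separates the attached vertices inside the component, then `P ∪ (D ∩ R)`
  -- separates `P` from `Q`: a surviving edge out of `P` enters at an attached vertex, which is in
  -- `D`, and one that leaves `R` away from `P` starts at an attached vertex of `Y`, which is not.
  -- So a walk that returns to `R` repeatedly need not be split.
  restrict : ∀ F → E ⊆ within M → Local n S⁻ L R Y S⁺ → Left M P R S⁻ L → Right M P R Y S⁺ Q →
             Conn (E ─ F) P Q →
             Conn ((E ∩ within R) ─ F) (attached P (S⁻ ─ F) L) (attached Q (S⁺ ─ F) Y)
  restrict {E} {M} {n} {S⁻} {L} {R} {Y} {S⁺} {P} {Q} F E⊆ loc ls rs conn =
    conn-by-cuts _ _ _ λ D closed X⊆D Y#D →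
      closed⇒¬conn (union-closed ls D closed X⊆D Y#D) (p⊆p∪q (D ∩ R)) (Q# rs ls D X⊆D Y#D) conn
    where
    open Local loc

    X′ Y′ : Vertices G
    X′ = attached P (S⁻ ─ F) L
    Y′ = attached Q (S⁺ ─ F) Y

    Q# : Right M P R Y S⁺ Q → Left M P R S⁻ L → ∀ D → X′ ⊆ D → Disjoint Y′ D →
         Disjoint Q (P ∪ (D ∩ R))
    Q# rs ls D X⊆D Y#D {q} q∈ q∈∪ with x∈p∪q⁻ P (D ∩ R) q∈∪
    Q# (end Q⊆Y _ _) ls D X⊆D Y#D q∈ q∈∪ | inj₂ q∈DR =
      Y#D (∈attachedᵖ (Q⊆Y q∈) q∈) (proj₁ (x∈p∩q⁻ D R q∈DR))
    Q# (inner Q-out _ _ _) ls D X⊆D Y#D q∈ q∈∪ | inj₂ q∈DR =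
      proj₂ (Q-out q∈) (proj₂ (x∈p∩q⁻ D R q∈DR))
    Q# (end Q⊆Y _ _) (start P⊆L _) D X⊆D Y#D q∈ q∈∪ | inj₁ q∈P =
      Y#D (∈attachedᵖ (Q⊆Y q∈) q∈) (X⊆D (∈attachedᵖ (P⊆L q∈P) q∈P))
    Q# (end Q⊆Y _ _) (inner P#R _ _ _) D X⊆D Y#D q∈ q∈∪ | inj₁ q∈P = P#R q∈P (right⊆ (Q⊆Y q∈))
    Q# (inner Q-out _ _ _) ls D X⊆D Y#D q∈ q∈∪ | inj₁ q∈P = proj₁ (Q-out q∈) q∈P

    leave-R : Right M P R Y S⁺ Q → ∀ {u v e} D → Closed ((E ∩ within R) ─ F) D →
              Disjoint Y′ D → e ∈ E → e ∉ F → Joins e u v →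
              u ∈ D → u ∈ R → v ∉ P → v ∈ D ∩ R
    leave-R rs {v = v} D closed Y#D e∈E e∉F j u∈D u∈R v∉P with v ∈? R
    ... | yes v∈R = x∈p∩q⁺
      (closed (_ , x∈p∧x∉q⇒x∈p─q (x∈p∩q⁺ (e∈E , ∈within⁺ j u∈R v∈R)) e∉F , j) u∈D , v∈R)
    ... | no v∉R with rs
    ...   | end _ _ cover = ⊥-elim (v∉R (cover (E⊆ e∈E) j u∈R v∉P))
    ...   | inner _ _ _ exits with e∈S⁺ , u∈Y ← exits (E⊆ e∈E) j u∈R v∉P v∉R =
      ⊥-elim (Y#D (∈attachedˢ u∈Y (x∈p∧x∉q⇒x∈p─q e∈S⁺ e∉F) (joins⇒incidentˡ j)) u∈D)

    union-closed : Left M P R S⁻ L → ∀ D → Closed ((E ∩ within R) ─ F) D → X′ ⊆ D → Disjoint Y′ D →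
                   Closed (E ─ F) (P ∪ (D ∩ R))
    union-closed ls D closed X⊆D Y#D {u} {v} (e , e∈ , j) u∈
      with v ∈? P | x∈p─q⁻ E F e∈ | x∈p∪q⁻ P (D ∩ R) u∈
    ... | yes v∈P | _ | _ = p⊆p∪q (D ∩ R) v∈P
    ... | no v∉P | e∈E , e∉F | inj₂ u∈DR with u∈D , u∈R ← x∈p∩q⁻ D R u∈DR =
      q⊆p∪q P (D ∩ R) (leave-R rs D closed Y#D e∈E e∉F j u∈D u∈R v∉P)
    ... | no v∉P | e∈E , e∉F | inj₁ u∈P with ls
    ...   | inner _ _ _ enters with e∈S⁻ , v∈L ← enters (E⊆ e∈E) j u∈P v∉P =
      q⊆p∪q P (D ∩ R) (x∈p∩q⁺
        ( X⊆D (∈attachedˢ v∈L (x∈p∧x∉q⇒x∈p─q e∈S⁻ e∉F) (joins⇒incidentˡ (joins-sym j)))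
        , left⊆ v∈L))
    ...   | start P⊆L _ = q⊆p∪q P (D ∩ R)
      (leave-R rs D closed Y#D e∈E e∉F j (X⊆D (∈attachedᵖ (P⊆L u∈P) u∈P)) (left⊆ (P⊆L u∈P)) v∉P)

  walk-from-P : Left M P R S⁻ L → S⁻ ⊆ E → v ∈ attached P (S⁻ ─ F) L →
                ∃ λ p → p ∈ P × Star (Adj ((E ∩ within M) ─ F)) p v
  walk-from-P {P = P} {S⁻ = S⁻} {L = L} {F = F} ls S⊆ v∈ with ls | ∈attached⁻ P (S⁻ ─ F) L v∈
  ... | _ | _ , inj₁ v∈P = _ , v∈P , ε
  ... | start _ L⊆P | v∈L , _ = _ , L⊆P v∈L , ε
  ... | inner _ _ ends _ | v∈L , inj₂ (e , e∈ , v~e) with e∈S , e∉F ← x∈p─q⁻ S⁻ F e∈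
    with e∈M , p , x , j , p∈ , x∈ ← ends e∈S with incident⇒either j v~e
  ...   | inj₁ refl = _ , p∈ , ε
  ...   | inj₂ refl = _ , p∈ , (e , x∈p∧x∉q⇒x∈p─q (x∈p∩q⁺ (S⊆ e∈S , e∈M)) e∉F , j) ◅ ε

  walk-from-Q : Right M P R Y S⁺ Q → S⁺ ⊆ E → v ∈ attached Q (S⁺ ─ F) Y →
                ∃ λ q → q ∈ Q × Star (Adj ((E ∩ within M) ─ F)) q v
  walk-from-Q {Y = Y} {S⁺ = S⁺} {Q = Q} {F = F} rs S⊆ v∈ with rs | ∈attached⁻ Q (S⁺ ─ F) Y v∈
  ... | _ | _ , inj₁ v∈Q = _ , v∈Q , ε
  ... | end _ Y⊆Q _ | v∈Y , _ = _ , Y⊆Q v∈Y , ε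
  ... | inner _ _ ends _ | v∈Y , inj₂ (e , e∈ , v~e) with e∈S , e∉F ← x∈p─q⁻ S⁺ F e∈
    with e∈M , q , y , j , q∈ , y∈ ← ends e∈S with incident⇒either j v~e
  ...   | inj₁ refl = _ , q∈ , ε
  ...   | inj₂ refl = _ , q∈ , (e , x∈p∧x∉q⇒x∈p─q (x∈p∩q⁺ (S⊆ e∈S , e∈M)) e∉F , j) ◅ ε

  extend : Left M P R S⁻ L → Right M P R Y S⁺ Q → S⁻ ⊆ E → S⁺ ⊆ E → E′ ⊆ (E ∩ within M) ─ F →
           Conn E′ (attached P (S⁻ ─ F) L) (attached Q (S⁺ ─ F) Y) → Conn ((E ∩ within M) ─ F) P Q
  extend ls rs S⁻⊆ S⁺⊆ E′⊆ (x , y , x∈ , y∈ , walk)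
    with p , p∈ , p→x ← walk-from-P ls S⁻⊆ x∈
    with q , q∈ , q→y ← walk-from-Q rs S⁺⊆ y∈ =
    p , q , p∈ , q∈ , p→x ◅◅ walk-mono E′⊆ walk ◅◅ walk-sym q→y

-- Equivalence of the demands on a component with the demand (P, Q, k).

module Demands (G : Graph) where
  open Graph G
  open Walks G
  open Conversion G

  private
    variable
      e             : Edge G
      u v w x       : Vertex G
      k n d         : ℕ
      E F S⁻ S⁺     : Edges G
      L M P Q R X Y : Vertices G

  ∈induced⁺ : ∀ Γ R → e ∈ Subgraph.E Γ → e ∈ within R → e ∈ Subgraph.E (induced G Γ R)
  ∈induced⁺ {e} Γ R e∈Γ e∈R =
    x∈p∩q⁺ (e∈Γ , ∈⟪⟫⁺ (within? R) (∈within⁻ R (joins-ends e) e∈R))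

  ∈induced⁻ : ∀ Γ R → e ∈ Subgraph.E (induced G Γ R) → e ∈ Subgraph.E Γ × e ∈ within R
  ∈induced⁻ {e} Γ R e∈ =
    proj₁ (x∈p∩q⁻ (Subgraph.E Γ) _ e∈) ,
    ∈within⁺ (joins-ends e) (end∈R (inj₁ refl)) (end∈R (inj₂ refl))
    where
    end∈R : ∀ {v} → Incident G v e → v ∈ R
    end∈R v~e = proj₂ (x∈p∩q⁻ (Subgraph.V Γ) R (Subgraph.closed (induced G Γ R) e∈ v~e))

  -- S_X is defined by incidence alone; this shows that an edge of S_X meets the component nowhere
  -- but in `X`.
  same-inner-end : Joins e w x → w ∉ R → u ∈ R → v ∈ R → Incident G u e → Incident G v e → u ≡ v
  same-inner-end j w∉ u∈ v∈ u~e v~e with incident⇒either j u~e | incident⇒either j v~e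
  ... | inj₁ refl | _ = ⊥-elim (w∉ u∈)
  ... | _ | inj₁ refl = ⊥-elim (w∉ v∈)
  ... | inj₂ refl | inj₂ refl = refl

  demand : ℕ → Edges G → Edges G → Vertices G → Vertices G → ℕ
  demand k S⁻ S⁺ X Y = (k + ∣ edgesAt G S⁻ X ∣ + ∣ edgesAt G S⁺ Y ∣) ∸ (∣ S⁻ ∣ + ∣ S⁺ ∣)

  rsnd⇒feasible : ∀ (H : Subgraph G) → X ⊆ R → RSND G (induced G (whole G) R) (induced G H R) X Y d →
                  Feasible (within R) (Subgraph.E H ∩ within R) X Y d
  rsnd⇒feasible {R = R} H X⊆R rsnd F F<d (x , y , x∈ , y∈ , p) =
    let x′ , y′ , x′∈ , y′∈ , _ , p′ = rsnd (F ∩ Eᵢ) (p∩q⊆q F Eᵢ)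
          (ℕ.≤-<-trans (p⊆q⇒∣p∣≤∣q∣ (p∩q⊆p F Eᵢ)) F<d)
          (x , y , x∈ , y∈ , x∈p∩q⁺ (∈⊤ , X⊆R x∈) , walk-mono into p)
    in x′ , y′ , x′∈ , y′∈ , walk-mono out p′
    where
    Eᵢ : Edges G
    Eᵢ = Subgraph.E (induced G (whole G) R)

    into : within R ─ F ⊆ Eᵢ ─ (F ∩ Eᵢ)
    into e∈ = let e∈R , e∉F = x∈p─q⁻ (within R) F e∈
              in x∈p∧x∉q⇒x∈p─q (∈induced⁺ (whole G) R ∈⊤ e∈R) (e∉F ∘ p∩q⊆p F Eᵢ)

    out : Subgraph.E (induced G H R) ─ (F ∩ Eᵢ) ⊆ (Subgraph.E H ∩ within R) ─ F
    out e∈ = let e∈Hᵢ , e∉ = x∈p─q⁻ (Subgraph.E (induced G H R)) _ e∈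
                 e∈H , e∈R = ∈induced⁻ H R e∈Hᵢ
             in x∈p∧x∉q⇒x∈p─q (x∈p∩q⁺ (e∈H , e∈R))
                  λ e∈F → e∉ (x∈p∩q⁺ (e∈F , ∈induced⁺ (whole G) R ∈⊤ e∈R))

  -- `X′` and `Y′` consist of the vertices where the component can still be entered, so all
  -- separator edges outside S_X′ and S_Y′ are in `F`. They are disjoint from the deletions inside
  -- `R`, and what `F` has left for `R` is below the demand. With `start`, `X′` is `L`, so S⁻
  -- cancels from the demand even if it lies outside G[M].
  conditions⇒feasible : ∀ Eᴴ →
    Local n S⁻ L R Y S⁺ → Left M P R S⁻ L → Right M P R Y S⁺ Q → R ⊆ M → S⁻ ⊆ Eᴴ → S⁺ ⊆ Eᴴ →
    (∀ X′ Y′ → X′ ⊆ L → Y′ ⊆ Y → (X′ , Y′) ≢ (L , Y) →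
      Feasible (within R) (Eᴴ ∩ within R) X′ Y′ (demand k S⁻ S⁺ X′ Y′)) →
    Feasible (within R) (Eᴴ ∩ within R) L Y k →
    Feasible (within M) (Eᴴ ∩ within M) P Q k
  conditions⇒feasible {S⁻ = S⁻} {L} {R} {Y} {S⁺} {M} {P} {Q} {k}
    Eᴴ loc ls rs R⊆M S⁻⊆ S⁺⊆ partial full F F<k c =
    extend ls rs S⁻⊆ S⁺⊆ back (by-demand (conn-mono into (restrict F id loc ls rs c)))
    where
    open Local loc

    Fᵢ A⁻ A⁺ : Edges G
    Fᵢ = F ∩ within R

    X′ Y′ : Vertices G
    X′ = attached P (S⁻ ─ F) L
    Y′ = attached Q (S⁺ ─ F) Y
    A⁻ = edgesAt G S⁻ X′
    A⁺ = edgesAt G S⁺ Y′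

    into : (within M ∩ within R) ─ F ⊆ within R ─ Fᵢ
    into e∈ = let e∈MR , e∉F = x∈p─q⁻ (within M ∩ within R) F e∈
              in x∈p∧x∉q⇒x∈p─q (p∩q⊆q (within M) _ e∈MR) (e∉F ∘ p∩q⊆p F _)

    back : (Eᴴ ∩ within R) ─ Fᵢ ⊆ (Eᴴ ∩ within M) ─ F
    back e∈ with e∈HR , e∉ ← x∈p─q⁻ (Eᴴ ∩ within R) Fᵢ e∈ with e∈H , e∈R ← x∈p∩q⁻ Eᴴ _ e∈HR =
      x∈p∧x∉q⇒x∈p─q (x∈p∩q⁺ (e∈H , within-mono R⊆M e∈R)) λ e∈F → e∉ (x∈p∩q⁺ (e∈F , e∈R))

    S⁻─A⁻⊆F : S⁻ ─ A⁻ ⊆ F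
    S⁻─A⁻⊆F {e} e∈ with e∈S , e∉A ← x∈p─q⁻ S⁻ A⁻ e∈ with _ , x , j , _ , x∈L ← outerˡ e∈S =
      decidable-stable (e ∈? F) λ e∉F →
        let x~e = joins⇒incidentˡ (joins-sym j)
        in e∉A (∈edgesAt⁺ e∈S (∈attachedˢ x∈L (x∈p∧x∉q⇒x∈p─q e∈S e∉F) x~e) x~e)

    S⁺─A⁺⊆F : S⁺ ─ A⁺ ⊆ F
    S⁺─A⁺⊆F {e} e∈ with e∈S , e∉A ← x∈p─q⁻ S⁺ A⁺ e∈ with _ , x , j , _ , x∈Y ← outerʳ e∈S =
      decidable-stable (e ∈? F) λ e∉F →
        let x~e = joins⇒incidentˡ (joins-sym j)
        in e∉A (∈edgesAt⁺ e∈S (∈attachedˢ x∈Y (x∈p∧x∉q⇒x∈p─q e∈S e∉F) x~e) x~e)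

    Fᵢ-outer : ∀ {e w x} → e ∈ Fᵢ → Joins e w x → ¬ w ∉ R
    Fᵢ-outer e∈ j w∉R = w∉R (proj₁ (∈within⁻ R j (p∩q⊆q F _ e∈)))

    count : ∣ Fᵢ ∣ + (∣ S⁻ ─ A⁻ ∣ + ∣ S⁺ ─ A⁺ ∣) ≤ ∣ F ∣
    count = ℕ.≤-trans
      (ℕ.+-monoʳ-≤ ∣ Fᵢ ∣ (∣p∣+∣q∣≤∣r∣ (S⁻ ─ A⁻) (S⁺ ─ A⁺) ((S⁻ ─ A⁻) ∪ (S⁺ ─ A⁺))
        (p⊆p∪q (S⁺ ─ A⁺)) (q⊆p∪q (S⁻ ─ A⁻) (S⁺ ─ A⁺))
        λ e∈ e∈′ → disjoint (p─q⊆p S⁻ A⁻ e∈) (p─q⊆p S⁺ A⁺ e∈′)))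
      (∣p∣+∣q∣≤∣r∣ Fᵢ ((S⁻ ─ A⁻) ∪ (S⁺ ─ A⁺)) F (p∩q⊆p F _)
        ([ S⁻─A⁻⊆F , S⁺─A⁺⊆F ]′ ∘ x∈p∪q⁻ (S⁻ ─ A⁻) (S⁺ ─ A⁺))
        λ e∈ e∈∪ → [ (λ e∈S → let _ , _ , j , w∉ , _ = outerˡ (p─q⊆p S⁻ A⁻ e∈S) in Fᵢ-outer e∈ j w∉)
                   , (λ e∈S → let _ , _ , j , w∉ , _ = outerʳ (p─q⊆p S⁺ A⁺ e∈S) in Fᵢ-outer e∈ j w∉)
                   ]′ (x∈p∪q⁻ (S⁻ ─ A⁻) (S⁺ ─ A⁺) e∈∪))

    by-demand : Conn (within R ─ Fᵢ) X′ Y′ → Conn ((Eᴴ ∩ within R) ─ Fᵢ) X′ Y′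
    by-demand with ×-≡-dec (Vec-≡-dec Bool._≟_) (Vec-≡-dec Bool._≟_) (X′ , Y′) (L , Y)
    ... | yes eq = subst
      (λ (X , Y) → Conn (within R ─ Fᵢ) X Y → Conn ((Eᴴ ∩ within R) ─ Fᵢ) X Y) (sym eq)
      (full Fᵢ (ℕ.≤-<-trans (p⊆q⇒∣p∣≤∣q∣ (p∩q⊆p F _)) F<k))
    ... | no neq = partial X′ Y′ (p∩q⊆p L _) (p∩q⊆p Y _) neq Fᵢ
      (below-demand (ℕ.≤-<-trans count F<k) (∣p∣≤∣q∣+∣p─q∣ S⁻ A⁻) (∣p∣≤∣q∣+∣p─q∣ S⁺ A⁺))

  -- Deleting the separator edges outside S_X and S_Y in addition to `F` forces every connection
  -- from `P` to `Q` to use `X′` and `Y′`. The two uniqueness hypotheses cover the terminals: if `P`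
  -- meets `L`, then `L` is a single vertex and the nonempty `X′` is all of it.
  feasible⇒conditions : ∀ (H : Subgraph G) →
    Local n S⁻ L R Y S⁺ → Left M P R S⁻ L → Right M P R Y S⁺ Q → R ⊆ M →
    S⁻ ⊆ Subgraph.E H → S⁺ ⊆ Subgraph.E H →
    (∀ {v x} → v ∈ L → v ∈ P → x ∈ L → v ≡ x) → (∀ {v y} → v ∈ Y → v ∈ Q → y ∈ Y → v ≡ y) →
    Disjoint P Q → Feasible (within M) (Subgraph.E H ∩ within M) P Q k →
    ∀ X′ Y′ → X′ ⊆ L → Y′ ⊆ Y →
    RSND G (induced G (whole G) R) (induced G H R) X′ Y′ (demand k S⁻ S⁺ X′ Y′)
  feasible⇒conditions {n} {S⁻} {L} {R} {Y} {S⁺} {M} {P} {Q} {k}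
    H loc ls rs R⊆M S⁻⊆ S⁺⊆ uniqˡ uniqʳ P#Q feasible X′ Y′ X⊆ Y⊆ F F⊆ F<d (x₀ , y₀ , x₀∈ , y₀∈ , _ , p₀) =
    link (restrict F′ (p∩q⊆q (Subgraph.E H) _) loc ls rs
      (feasible F′ F′<k
        (conn-mono shrink (extend {E = ⊤} ls rs (λ _ → ∈⊤) (λ _ → ∈⊤) widen
          (x₀ , y₀ , x₀-attached ls , y₀-attached rs , p₀)))))
    where
    open Local loc
    Gᵢ Hᵢ : Subgraph G
    Gᵢ = induced G (whole G) R
    Hᵢ = induced G H R

    A⁻ A⁺ F′ : Edges G
    A⁻ = edgesAt G S⁻ X′
    A⁺ = edgesAt G S⁺ Y′
    F′ = F ∪ ((S⁻ ─ A⁻) ∪ (S⁺ ─ A⁺))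

    F′<k : ∣ F′ ∣ < k
    F′<k = ℕ.≤-<-trans
      (ℕ.≤-trans (∣p∪q∣≤∣p∣+∣q∣ F _)
                 (ℕ.+-monoʳ-≤ ∣ F ∣ (∣p∪q∣≤∣p∣+∣q∣ (S⁻ ─ A⁻) (S⁺ ─ A⁺))))
      (above-demand F<d (∣q∣+∣p─q∣≤∣p∣ S⁻ A⁻ (p∩q⊆p S⁻ _)) (∣q∣+∣p─q∣≤∣p∣ S⁺ A⁺ (p∩q⊆p S⁺ _)))

    ∉F′ : ∀ {e} → e ∉ F → (e ∈ S⁻ → e ∈ A⁻) → (e ∈ S⁺ → e ∈ A⁺) → e ∉ F′
    ∉F′ e∉F to⁻ to⁺ e∈ with x∈p∪q⁻ F _ e∈
    ... | inj₁ e∈F = e∉F e∈F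
    ... | inj₂ e∈∪ with x∈p∪q⁻ (S⁻ ─ A⁻) (S⁺ ─ A⁺) e∈∪
    ...   | inj₁ e∈─ with e∈S , e∉A ← x∈p─q⁻ S⁻ A⁻ e∈─ = e∉A (to⁻ e∈S)
    ...   | inj₂ e∈─ with e∈S , e∉A ← x∈p─q⁻ S⁺ A⁺ e∈─ = e∉A (to⁺ e∈S)

    ∉withinˡ : ∀ {e} → e ∈ S⁻ → e ∉ within R
    ∉withinˡ e∈ e∈R with _ , _ , j , w∉ , _ ← outerˡ e∈ = w∉ (proj₁ (∈within⁻ R j e∈R))

    ∉withinʳ : ∀ {e} → e ∈ S⁺ → e ∉ within R
    ∉withinʳ e∈ e∈R with _ , _ , j , w∉ , _ ← outerʳ e∈ = w∉ (proj₁ (∈within⁻ R j e∈R))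

    F⊆R : F ⊆ within R
    F⊆R e∈ = proj₂ (∈induced⁻ (whole G) R (F⊆ e∈))

    x₀-attached : Left M P R S⁻ L → x₀ ∈ attached P (S⁻ ─ F′) L
    x₀-attached (start _ L⊆P) = ∈attachedᵖ (X⊆ x₀∈) (L⊆P (X⊆ x₀∈))
    x₀-attached (inner _ L⊆S _ _) with e , e∈ , x~e ← ∈touching⁻ (L⊆S (X⊆ x₀∈)) =
      ∈attachedˢ (X⊆ x₀∈)
        (x∈p∧x∉q⇒x∈p─q e∈ (∉F′ (∉withinˡ e∈ ∘ F⊆R) (λ _ → ∈edgesAt⁺ e∈ x₀∈ x~e)
                                (⊥-elim ∘ disjoint e∈))) x~e

    y₀-attached : Right M P R Y S⁺ Q → y₀ ∈ attached Q (S⁺ ─ F′) Y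
    y₀-attached (end _ Y⊆Q _) = ∈attachedᵖ (Y⊆ y₀∈) (Y⊆Q (Y⊆ y₀∈))
    y₀-attached (inner _ Y⊆S _ _) with e , e∈ , y~e ← ∈touching⁻ (Y⊆S (Y⊆ y₀∈)) =
      ∈attachedˢ (Y⊆ y₀∈)
        (x∈p∧x∉q⇒x∈p─q e∈ (∉F′ (∉withinʳ e∈ ∘ F⊆R) (λ e∈⁻ → ⊥-elim (disjoint e∈⁻ e∈))
                                (λ _ → ∈edgesAt⁺ e∈ y₀∈ y~e))) y~e

    widen : Subgraph.E Gᵢ ─ F ⊆ (⊤ ∩ within M) ─ F′
    widen e∈ with e∈Gᵢ , e∉F ← x∈p─q⁻ (Subgraph.E Gᵢ) F e∈
      with _ , e∈R ← ∈induced⁻ (whole G) R e∈Gᵢ =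
      x∈p∧x∉q⇒x∈p─q (x∈p∩q⁺ (∈⊤ , within-mono R⊆M e∈R))
        (∉F′ e∉F (λ e∈S → ⊥-elim (∉withinˡ e∈S e∈R)) (λ e∈S → ⊥-elim (∉withinʳ e∈S e∈R)))

    shrink : (⊤ ∩ within M) ─ F′ ⊆ within M ─ F′
    shrink = ─-monoˡ F′ (p∩q⊆q ⊤ (within M))

    attached⊆X : attached P (S⁻ ─ F′) L ⊆ X′
    attached⊆X v∈ with ∈attached⁻ P (S⁻ ─ F′) L v∈
    ... | v∈L , inj₁ v∈P = subst (_∈ X′) (sym (uniqˡ v∈L v∈P (X⊆ x₀∈))) x₀∈
    ... | v∈L , inj₂ (e , e∈ , v~e) with e∈S , e∉F′ ← x∈p─q⁻ S⁻ F′ e∈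
      with e ∈? A⁻
    ...   | no e∉A = ⊥-elim (e∉F′ (q⊆p∪q F _ (p⊆p∪q (S⁺ ─ A⁺) (x∈p∧x∉q⇒x∈p─q e∈S e∉A))))
    ...   | yes e∈A with _ , x , x∈ , x~e ← ∈edgesAt⁻ S⁻ X′ e∈A
      with _ , _ , j , w∉ , _ ← outerˡ e∈S =
      subst (_∈ X′) (same-inner-end j w∉ (left⊆ (X⊆ x∈)) (left⊆ v∈L) x~e v~e) x∈

    attached⊆Y : attached Q (S⁺ ─ F′) Y ⊆ Y′
    attached⊆Y v∈ with ∈attached⁻ Q (S⁺ ─ F′) Y v∈
    ... | v∈Y , inj₁ v∈Q = subst (_∈ Y′) (sym (uniqʳ v∈Y v∈Q (Y⊆ y₀∈))) y₀∈
    ... | v∈Y , inj₂ (e , e∈ , v~e) with e∈S , e∉F′ ← x∈p─q⁻ S⁺ F′ e∈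
      with e ∈? A⁺
    ...   | no e∉A = ⊥-elim (e∉F′ (q⊆p∪q F _ (q⊆p∪q (S⁻ ─ A⁻) (S⁺ ─ A⁺) (x∈p∧x∉q⇒x∈p─q e∈S e∉A))))
    ...   | yes e∈A with _ , y , y∈ , y~e ← ∈edgesAt⁻ S⁺ Y′ e∈A
      with _ , _ , j , w∉ , _ ← outerʳ e∈S =
      subst (_∈ Y′) (same-inner-end j w∉ (right⊆ (Y⊆ y∈)) (right⊆ v∈Y) y~e v~e) y∈

    in-H : ∀ {x y} → x ∈ attached P (S⁻ ─ F′) L → y ∈ attached Q (S⁺ ─ F′) Y →
           Star (Adj (((Subgraph.E H ∩ within M) ∩ within R) ─ F′)) x y → x ∈ Subgraph.V H
    in-H x∈ y∈ ((e , e∈ , j) ◅ _) = Subgraph.closed H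
      (p∩q⊆p _ (within M) (p∩q⊆p _ (within R) (p─q⊆p _ F′ e∈))) (joins⇒incidentˡ j)
    -- On a walk of length 0 an undeleted separator edge at the vertex, which is in `H`, puts the
    -- vertex into `H`; without one the vertex would lie in both `P` and `Q`.
    in-H x∈ y∈ ε with ∈attached⁻ P (S⁻ ─ F′) L x∈ | ∈attached⁻ Q (S⁺ ─ F′) Y y∈
    ... | _ , inj₂ (e , e∈ , x~e) | _ = Subgraph.closed H (S⁻⊆ (p─q⊆p S⁻ F′ e∈)) x~e
    ... | _ | _ , inj₂ (e , e∈ , x~e) = Subgraph.closed H (S⁺⊆ (p─q⊆p S⁺ F′ e∈)) x~e
    ... | _ , inj₁ x∈P | _ , inj₁ x∈Q = ⊥-elim (P#Q x∈P x∈Q)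

    link : Conn (((Subgraph.E H ∩ within M) ∩ within R) ─ F′)
                (attached P (S⁻ ─ F′) L) (attached Q (S⁺ ─ F′) Y) →
           Linked G (_∖_ G Hᵢ F) X′ Y′
    link (x , y , x∈ , y∈ , p) = x , y , attached⊆X x∈ , attached⊆Y y∈ ,
      x∈p∩q⁺ (in-H x∈ y∈ p , left⊆ (p∩q⊆p L _ x∈)) ,
      walk-mono (λ e∈ → let e∈HR , e∉F′ = x∈p─q⁻ _ F′ e∈
                            e∈HM , e∈R = x∈p∩q⁻ _ (within R) e∈HR
                        in x∈p∧x∉q⇒x∈p─q (∈induced⁺ H R (p∩q⊆p _ (within M) e∈HM) e∈R)
                                         (e∉F′ ∘ p⊆p∪q _)) p

-- Layouts of a sequence, and the effect of the first cut of a chain.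

module Layouts (G : Graph) where
  open Graph G
  open Walks G
  open Conversion G
  open Demands G
  open Subgraph

  private
    variable
      e               : Edge G
      u v w x         : Vertex G
      n               : ℕ
      F S S⁻ S⁺       : Edges G
      L M P Q R U X Y : Vertices G
      Γ               : Subgraph G
      c q             : Sequence G

  -- P grows along q, and the part of G[M] after a component R other than the last is ∁ (P ∪ R).
  data Layout (n : ℕ) (M Y : Vertices G) (S⁺ : Edges G) (Q : Vertices G) :
              (P : Vertices G) (S⁻ : Edges G) (L : Vertices G) → Sequence G → Set where
    single : Local n S⁻ L R Y S⁺ → Left M P R S⁻ L → Right M P R Y S⁺ Q → R ⊆ M →
             Layout n M Y S⁺ Q P S⁻ L (single R)
    cons   : Local n S⁻ L R (R ∩ touching G S) S → Left M P R S⁻ L →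
             Right M P R (R ∩ touching G S) S (∁ (P ∪ R)) → R ⊆ M →
             ∣ S ∣ ≤ n → Disjoint (first G q) (P ∪ R) →
             Layout n M Y S⁺ Q (P ∪ R) S (first G q ∩ touching G S) q →
             Layout n M Y S⁺ Q P S⁻ L (R —⟨ S ⟩— q)

  edges⊆within : ∀ (Γ : Subgraph G) → E Γ ⊆ within (V Γ)
  edges⊆within Γ e∈ = ∈within⁺ (joins-ends _) (closed Γ e∈ (inj₁ refl)) (closed Γ e∈ (inj₂ refl))

  reach-reachSet : ∀ (Γ : Subgraph G) → X ⊆ V Γ → ReachSet G Γ X (reach (E Γ) X)
  reach-reachSet {X} Γ X⊆ v = mk⇔
    (λ v∈ → let x , x∈ , p = reach-walk (E Γ) X v∈ in x , x∈ , X⊆ x∈ , p)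
    (λ (x , x∈ , _ , p) → closed-walk (reach-closed (E Γ) X) p (reach-⊇ (E Γ) X x∈))

  reachSet-⊇ : ∀ (Γ : Subgraph G) → X ⊆ V Γ → ReachSet G Γ X R → X ⊆ R
  reachSet-⊇ Γ X⊆ rs x∈ = Equivalence.from (rs _) (_ , x∈ , X⊆ x∈ , ε)

  reachSet-closed : ∀ (Γ : Subgraph G) → ReachSet G Γ X R → Closed (E Γ) R
  reachSet-closed Γ rs a u∈ with x , x∈ , x∈Γ , p ← Equivalence.to (rs _) u∈ =
    Equivalence.from (rs _) (x , x∈ , x∈Γ , p ◅◅ a ◅ ε)

  reachSet-least : ∀ (Γ : Subgraph G) → ReachSet G Γ X R → Closed (E Γ) U → X ⊆ U → R ⊆ U
  reachSet-least Γ rs c X⊆ v∈ with x , x∈ , _ , p ← Equivalence.to (rs _) v∈ =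
    closed-walk c p (X⊆ x∈)

  module FirstCut (Γ : Subgraph G) {n : ℕ} {S⁻ S⁺ S : Edges G} {X Y R : Vertices G}
    (full : within (V Γ) ⊆ E Γ) (loc : Local n S⁻ X (V Γ) Y S⁺)
    (important : Important G Γ X Y S) (∣S∣≡ : ∣ S ∣ ≡ suc n)
    (reachable : ReachSet G (_∖_ G Γ S) X R) where

    open Local loc

    W W′ X′ Y₀ : Vertices G
    W = V Γ
    W′ = W ∩ ∁ R
    X′ = W′ ∩ touching G S
    Y₀ = R ∩ touching G S

    S⊆Γ : S ⊆ E Γ
    S⊆Γ = proj₁ (proj₁ (proj₁ important))

    S⊆W : S ⊆ within W
    S⊆W = edges⊆within Γ ∘ S⊆Γ

    W-closed : ∀ {F} → Closed (E Γ ─ F) W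
    W-closed {F} (e , e∈ , j) _ = proj₂ (∈within⁻ W j (edges⊆within Γ (p─q⊆p (E Γ) F e∈)))

    X⊆R : X ⊆ R
    X⊆R = reachSet-⊇ (_∖_ G Γ S) left⊆ reachable

    R⊆W : R ⊆ W
    R⊆W = reachSet-least (_∖_ G Γ S) reachable W-closed left⊆

    R-closed : Closed (E Γ ─ S) R
    R-closed = reachSet-closed (_∖_ G Γ S) reachable

    R-reach : v ∈ R → ∃ λ x → x ∈ X × Star (Adj (within R)) x v
    R-reach v∈ with x , x∈ , x∈W , p ← Equivalence.to (reachable _) v∈ =
      x , x∈ , walk-mono (p∩q⊆q (E Γ ─ S) (within R)) (walk-inside R-closed p (X⊆R x∈))

    Y#R : Disjoint Y R
    Y#R y∈ y∈R with x , x∈ , p ← Equivalence.to (reachable _) y∈R =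
      proj₂ (proj₁ (proj₁ important)) (x , _ , x∈ , y∈ , p)

    ∈W′ : v ∈ W → v ∉ R → v ∈ W′
    ∈W′ v∈W v∉R = x∈p∩q⁺ (v∈W , x∉p⇒x∈∁p v∉R)

    W′⊆W : W′ ⊆ W
    W′⊆W = p∩q⊆p W (∁ R)

    W′#R : Disjoint W′ R
    W′#R v∈ = x∈∁p⇒x∉p (p∩q⊆q W (∁ R) v∈)

    Y⊆W′ : Y ⊆ W′
    Y⊆W′ y∈ = ∈W′ (right⊆ y∈) (Y#R y∈)

    crossing∈S : e ∈ within W → Joins e u v → u ∈ R → v ∉ R → e ∈ S
    crossing∈S {e} e∈ j u∈ v∉ = decidable-stable (e ∈? S) λ e∉ →
      v∉ (R-closed (e , x∈p∧x∉q⇒x∈p─q (full e∈) e∉ , j) u∈)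

    only-missing : ∀ {e₀} → e₀ ∈ S → e ∈ E Γ ─ (S - e₀) → Joins e u v → u ∈ R → v ∉ R → e ≡ e₀
    only-missing {e} {e₀ = e₀} e₀∈ e∈ j u∈ v∉ with e∈Γ , e∉ ← x∈p─q⁻ (E Γ) (S - e₀) e∈ =
      decidable-stable (e ≟ e₀) λ e≢ →
        e∉ (x∈p∧x≢y⇒x∈p-y (crossing∈S (edges⊆within Γ e∈Γ) j u∈ v∉) e≢)

    -- Both claims follow from minimality. If `e` did not cross `R`, then `R` would be closed
    -- without `e` being deleted; if its outer end did not reach `Y` outside `R`, the set of
    -- vertices that do would be. Either way `S - e` would still separate.
    S-edge : e ∈ S → ∃₂ λ u w → Joins e u w × u ∈ R × w ∈ W′ ×
                                (∃ λ y → y ∈ Y × Star (Adj (within W′)) w y)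
    S-edge {e} e∈S with crosses? R e
    ... | no ¬c = ⊥-elim (proj₂ (proj₁ important) (S - e) (x∈p⇒p-x⊂p e∈S)
      ( S⊆Γ ∘ p─q⊆p S ⁅ e ⁆
      , λ (x , y , x∈ , y∈ , _ , p) → Y#R y∈ (closed-walk R-closed′ p (X⊆R x∈))))
      where
      R-closed′ : Closed (E Γ ─ (S - e)) R
      R-closed′ {u} {v} (e′ , e′∈ , j) u∈ = decidable-stable (v ∈? R) λ v∉ →
        ¬c (subst (Crosses R) (only-missing e∈S e′∈ j u∈ v∉) (u , v , j , u∈ , v∉))
    ... | yes (u , w , j , u∈ , w∉) with w ∈? reach (within W′) Y
    ...   | yes w∈ with y , y∈ , p ← reach-walk (within W′) Y w∈ =
      u , w , j , u∈ , ∈W′ (proj₂ (∈within⁻ W j (S⊆W e∈S))) w∉ , y , y∈ , walk-sym p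
    ...   | no w∉D = ⊥-elim (proj₂ (proj₁ important) (S - e) (x∈p⇒p-x⊂p e∈S)
      ( S⊆Γ ∘ p─q⊆p S ⁅ e ⁆
      , λ (x , y , x∈ , y∈ , _ , p) →
          W′#R (D⊆W′ (closed-walk D-closed (walk-sym p) (reach-⊇ (within W′) Y y∈))) (X⊆R x∈)))
      where
      D : Vertices G
      D = reach (within W′) Y

      D⊆W′ : D ⊆ W′
      D⊆W′ = reach-least (λ (_ , a∈ , i) _ → proj₂ (∈within⁻ W′ i a∈)) Y⊆W′

      D-closed : Closed (E Γ ─ (S - e)) D
      D-closed {a} {b} (e′ , e′∈ , i) a∈ with b ∈? R
      ... | no b∉R = reach-closed (within W′) Y
        (e′ , ∈within⁺ i (D⊆W′ a∈) (∈W′ (W-closed (e′ , e′∈ , i) (W′⊆W (D⊆W′ a∈))) b∉R) , i) a∈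
      ... | yes b∈R with refl ← only-missing e∈S e′∈ (joins-sym i) b∈R (W′#R (D⊆W′ a∈))
        with joins⇒either j i
      ...   | inj₁ (refl , refl) = ⊥-elim (W′#R (D⊆W′ a∈) u∈)
      ...   | inj₂ (refl , refl) = ⊥-elim (w∉D a∈)

    -- This is where importance enters. Edges leave `R` only at `Y₀`, so the part of a cut `U₀`
    -- inside `R` has no further boundary in G[W]. If that boundary had at most as many edges as
    -- `S`, it would be a separator with a reach set properly inside `R`: the end in `R` of any edge
    -- of `S` is lost.
    head-cut : MinCut (within R) X Y₀ (suc (suc n))
    head-cut U₀ X⊆U Y₀#U = ℕ.≮⇒≥ λ small →
      proj₂ important R reachable
        ( T , reach (E Γ ─ T) X
        , (full ∘ p∩q⊆p _ _ , λ (x , y , x∈ , y∈ , _ , p) →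
            Y#R y∈ (p∩q⊆q U₀ R (closed-walk UR-closed p (X⊆UR x∈))))
        , ℕ.≤-trans (p⊆q⇒∣p∣≤∣q∣ T⊆) (subst (_ ≤_) (sym ∣S∣≡) (ℕ.≤-pred small))
        , reach-reachSet (_∖_ G Γ T) left⊆
        , p∩q⊆q U₀ R ∘ reach⊆UR
        , proper)
      where
      T : Edges G
      T = within W ∩ boundary (U₀ ∩ R)

      X⊆UR : X ⊆ U₀ ∩ R
      X⊆UR x∈ = x∈p∩q⁺ (X⊆U x∈ , X⊆R x∈)

      UR-closed : Closed (E Γ ─ T) (U₀ ∩ R)
      UR-closed = boundary⊆⇒closed λ e∈ → let e∈Γ , e∈∂ = x∈p∩q⁻ (E Γ) _ e∈
                                          in x∈p∩q⁺ (edges⊆within Γ e∈Γ , e∈∂)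

      reach⊆UR : reach (E Γ ─ T) X ⊆ U₀ ∩ R
      reach⊆UR = reach-least UR-closed X⊆UR

      T⊆ : T ⊆ within R ∩ boundary U₀
      T⊆ e∈ with e∈W , e∈∂ ← x∈p∩q⁻ (within W) _ e∈
        with a , b , j , a∈ , b∉ ← ∈boundary⁻ (U₀ ∩ R) e∈∂
        with a∈U , a∈R ← x∈p∩q⁻ U₀ R a∈ with b ∈? R
      ... | yes b∈R = x∈p∩q⁺ (∈within⁺ j a∈R b∈R , ∈boundary⁺ j a∈U λ b∈U → b∉ (x∈p∩q⁺ (b∈U , b∈R)))
      ... | no b∉R = ⊥-elim (Y₀#U
        (x∈p∩q⁺ (a∈R , ∈touching⁺ (crossing∈S e∈W j a∈R b∉R) (joins⇒incidentˡ j))) a∈U)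

      proper : ∃ λ v → v ∈ R × v ∉ reach (E Γ ─ T) X
      proper with nonempty? S
      ... | no empty with () ← trans (sym ∣S∣≡) (trans (cong ∣_∣ (Empty-unique empty)) (∣⊥∣≡0 #E))
      ... | yes (e , e∈S) with u , _ , j , u∈ , _ ← S-edge e∈S =
        u , u∈ , λ u∈reach → Y₀#U (x∈p∩q⁺ (u∈ , ∈touching⁺ e∈S (joins⇒incidentˡ j)))
                                  (p∩q⊆p U₀ R (reach⊆UR u∈reach))

    head-local : Local (suc n) S⁻ X R Y₀ S
    head-local = record
      { left⊆ = X⊆R
      ; right⊆ = p∩q⊆p R _
      ; outerˡ = λ e∈ → let w , x , j , w∉ , x∈ = outerˡ e∈ in w , x , j , w∉ ∘ R⊆W , x∈
      ; outerʳ = λ e∈ → let u , w , j , u∈ , w∈ , _ = S-edge e∈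
                        in w , u , joins-sym j , W′#R w∈ ,
                           x∈p∩q⁺ (u∈ , ∈touching⁺ e∈ (joins⇒incidentˡ j))
      ; disjoint = λ e∈ e∈S → let _ , _ , j , w∉ , _ = outerˡ e∈
                              in w∉ (proj₁ (∈within⁻ W j (S⊆W e∈S)))
      ; from-left = R-reach
      ; to-right = right-end
      ; minCut = head-cut
      }
      where
      right-end : v ∈ X → ∃ λ y → y ∈ Y₀ × Star (Adj (within R)) v y
      right-end {v} v∈ with y , y∈ , p ← to-right v∈
        with v ∈? reach (within R) Y₀
      ... | yes v∈D with z , z∈ , z→v ← reach-walk (within R) Y₀ v∈D = z , z∈ , walk-sym z→v
      ... | no v∉D = ⊥-elim (Y#R y∈ (p∩q⊆p R _
        (closed-walk stuck p (x∈p∩q⁺ (X⊆R v∈ , x∉p⇒x∈∁p v∉D)))))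
        where
        -- A vertex that cannot reach `Y₀` inside `R` could never leave `R`, yet `v` reaches `Y`.
        stuck : Closed (within W) (R ∩ ∁ (reach (within R) Y₀))
        stuck {a} {b} (e , e∈ , j) a∈ with a∈R , a∉ ← x∈p∩q⁻ R _ a∈ with b ∈? R
        ... | no b∉R = ⊥-elim (x∈∁p⇒x∉p a∉ (reach-⊇ (within R) Y₀
          (x∈p∩q⁺ (a∈R , ∈touching⁺ (crossing∈S e∈ j a∈R b∉R) (joins⇒incidentˡ j)))))
        ... | yes b∈R = x∈p∩q⁺ (b∈R ,
          closed-∁ (reach-closed (within R) Y₀) (e , ∈within⁺ j a∈R b∈R , j) a∉)

    X′∋ : e ∈ within W → Joins e u v → u ∈ R → v ∉ R → v ∈ X′
    X′∋ e∈ j u∈ v∉ = x∈p∩q⁺ (∈W′ (proj₂ (∈within⁻ W j e∈)) v∉ ,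
      ∈touching⁺ (crossing∈S e∈ j u∈ v∉) (joins⇒incidentˡ (joins-sym j)))

    tail-local : Local n S X′ W′ Y S⁺
    tail-local = record
      { left⊆ = p∩q⊆p W′ _
      ; right⊆ = Y⊆W′
      ; outerˡ = λ e∈ → let u , w , j , u∈ , w∈ , _ = S-edge e∈
                        in u , w , j , (λ u∈W′ → W′#R u∈W′ u∈) ,
                           x∈p∩q⁺ (w∈ , ∈touching⁺ e∈ (joins⇒incidentˡ (joins-sym j)))
      ; outerʳ = λ e∈ → let w , y , j , w∉ , y∈ = outerʳ e∈ in w , y , j , w∉ ∘ W′⊆W , y∈
      ; disjoint = λ e∈S e∈ → let _ , _ , j , w∉ , _ = outerʳ e∈
                              in w∉ (proj₁ (∈within⁻ W j (S⊆W e∈S)))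
      ; from-left = left-end
      ; to-right = right-end
      ; minCut = tail-cut
      }
      where
      left-end : v ∈ W′ → ∃ λ x → x ∈ X′ × Star (Adj (within W′)) x v
      left-end {v} v∈ with x , x∈ , p ← from-left (W′⊆W v∈)
        with x∈p∪q⁻ R (reach (within W′) X′) (closed-walk spread p (p⊆p∪q _ (X⊆R x∈)))
        where
        spread : Closed (within W) (R ∪ reach (within W′) X′)
        spread {a} {b} (e , e∈ , j) a∈ with b ∈? R | x∈p∪q⁻ R _ a∈
        ... | yes b∈R | _ = p⊆p∪q _ b∈R
        ... | no b∉R | inj₁ a∈R =
          q⊆p∪q R _ (reach-⊇ (within W′) X′ (X′∋ e∈ j a∈R b∉R))
        ... | no b∉R | inj₂ a∈D =
          q⊆p∪q R _ (reach-closed (within W′) X′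
            (e , ∈within⁺ j (D⊆W′ a∈D) (∈W′ (proj₂ (∈within⁻ W j e∈)) b∉R) , j) a∈D)
          where
          D⊆W′ : reach (within W′) X′ ⊆ W′
          D⊆W′ = reach-least (λ (_ , a∈ , i) _ → proj₂ (∈within⁻ W′ i a∈)) (p∩q⊆p W′ _)
      ... | inj₁ v∈R = ⊥-elim (W′#R v∈ v∈R)
      ... | inj₂ v∈D = reach-walk (within W′) X′ v∈D

      right-end : v ∈ X′ → ∃ λ y → y ∈ Y × Star (Adj (within W′)) v y
      right-end v∈ with v∈W′ , v∈t ← x∈p∩q⁻ W′ _ v∈ with e , e∈S , v~e ← ∈touching⁻ v∈t
        with u , w , j , u∈ , w∈ , y , y∈ , p ← S-edge e∈S with incident⇒either j v~e
      ... | inj₁ refl = ⊥-elim (W′#R v∈W′ u∈)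
      ... | inj₂ refl = y , y∈ , p

      -- Adding `R` to a cut of the tail gives a cut of the whole with no new edges, since edges out
      -- of `R` end in `X′`. Only the old bound is inherited; the gain of one comes with the later
      -- cuts or with the stop.
      tail-cut : MinCut (within W′) X′ Y (suc n)
      tail-cut U X′⊆U Y#U = ℕ.≤-trans (minCut U₁ (p⊆p∪q _ ∘ X⊆R) Y#U₁) (p⊆q⇒∣p∣≤∣q∣ smaller)
        where
        U₁ : Vertices G
        U₁ = R ∪ (U ∩ W′)

        Y#U₁ : Disjoint Y U₁
        Y#U₁ y∈ y∈U₁ = [ Y#R y∈ , Y#U y∈ ∘ p∩q⊆p U W′ ]′ (x∈p∪q⁻ R (U ∩ W′) y∈U₁)

        smaller : within W ∩ boundary U₁ ⊆ within W′ ∩ boundary U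
        smaller e∈ with e∈W , e∈∂ ← x∈p∩q⁻ (within W) _ e∈
          with a , b , j , a∈ , b∉ ← ∈boundary⁻ U₁ e∈∂ with x∈p∪q⁻ R (U ∩ W′) a∈
        ... | inj₁ a∈R = ⊥-elim (b∉ (q⊆p∪q R _ (x∈p∩q⁺ (X′⊆U b∈X′ , p∩q⊆p W′ _ b∈X′))))
          where b∈X′ = X′∋ e∈W j a∈R (b∉ ∘ p⊆p∪q _)
        ... | inj₂ a∈UW with a∈U , a∈W′ ← x∈p∩q⁻ U W′ a∈UW =
          x∈p∩q⁺ (∈within⁺ j a∈W′ b∈W′ ,
            ∈boundary⁺ j a∈U λ b∈U → b∉ (q⊆p∪q R _ (x∈p∩q⁺ (b∈U , b∈W′))))
          where b∈W′ = ∈W′ (proj₂ (∈within⁻ W j e∈W)) (b∉ ∘ p⊆p∪q _)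

    module _ {M P Q : Vertices G} (ls : Left M P W S⁻ X) (rs : Right M P W Y S⁺ Q) (W⊆M : W ⊆ M) where

      P#W′ : Disjoint P W′
      P#W′ = go ls
        where
        go : Left M P W S⁻ X → Disjoint P W′
        go (start P⊆X _) p∈ p∈W′ = W′#R p∈W′ (X⊆R (P⊆X p∈))
        go (inner P#W _ _ _) p∈ p∈W′ = P#W p∈ (W′⊆W p∈W′)

      -- `W` can be left away from `P` only from `Y`, and `S` keeps `Y` outside `R`.
      leaving-R : e ∈ within M → Joins e u v → u ∈ R → v ∉ P → v ∉ R → e ∈ within W
      leaving-R {v = v} e∈ j u∈ v∉P v∉R with v ∈? W
      ... | yes v∈W = ∈within⁺ j (R⊆W u∈) v∈W
      ... | no v∉W = ⊥-elim (go rs)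
        where
        go : Right M P W Y S⁺ Q → Empty.⊥
        go (end _ _ cover) = v∉W (cover e∈ j (R⊆W u∈) v∉P)
        go (inner _ _ _ exits) = Y#R (proj₂ (exits e∈ j (R⊆W u∈) v∉P v∉W)) u∈

      leaving-P∪R : e ∈ within M → Joins e u v → u ∈ P ∪ R → v ∉ P ∪ R → e ∈ S × v ∈ X′
      leaving-P∪R {e} {u} {v} e∈ j u∈ v∉ = [ from-P ls , from-R ]′ (x∈p∪q⁻ P R u∈)
        where
        from-R : u ∈ R → e ∈ S × v ∈ X′
        from-R u∈R = crossing∈S e∈W j u∈R (v∉ ∘ q⊆p∪q P R) , X′∋ e∈W j u∈R (v∉ ∘ q⊆p∪q P R)
          where e∈W = leaving-R e∈ j u∈R (v∉ ∘ p⊆p∪q R) (v∉ ∘ q⊆p∪q P R)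

        from-P : Left M P W S⁻ X → u ∈ P → e ∈ S × v ∈ X′
        from-P (start P⊆X _) u∈P = from-R (X⊆R (P⊆X u∈P))
        from-P (inner _ _ _ enters) u∈P =
          ⊥-elim (v∉ (q⊆p∪q P R (X⊆R (proj₂ (enters e∈ j u∈P (v∉ ∘ p⊆p∪q R))))))

      head-left : Left M P R S⁻ X
      head-left = go ls
        where
        go : Left M P W S⁻ X → Left M P R S⁻ X
        go (start P⊆X X⊆P) = start P⊆X X⊆P
        go (inner P#W X⊆S ends enters) = inner (λ p∈ → P#W p∈ ∘ R⊆W) X⊆S ends enters

      head-right : Right M P R Y₀ S (∁ (P ∪ R))
      head-right = inner
        (λ v∈ → let v∉ = x∈∁p⇒x∉p v∈ in v∉ ∘ p⊆p∪q R , v∉ ∘ q⊆p∪q P R)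
        (p∩q⊆q R _)
        (λ e∈ → let u , w , j , u∈ , w∈ , _ = S-edge e∈
                in within-mono W⊆M (S⊆W e∈) , w , u , joins-sym j ,
                   x∉p⇒x∈∁p (λ w∈∪ → [ (λ w∈P → P#W′ w∈P w∈) , W′#R w∈ ]′ (x∈p∪q⁻ P R w∈∪)) ,
                   x∈p∩q⁺ (u∈ , ∈touching⁺ e∈ (joins⇒incidentˡ j)))
        (λ e∈ j u∈ v∉P v∉R →
          let e∈S = crossing∈S (leaving-R e∈ j u∈ v∉P v∉R) j u∈ v∉R
          in e∈S , x∈p∩q⁺ (u∈ , ∈touching⁺ e∈S (joins⇒incidentˡ j)))

      tail-left : Left M (P ∪ R) W′ S X′
      tail-left = inner
        (λ p∈ p∈W′ → [ (λ p∈P → P#W′ p∈P p∈W′) , W′#R p∈W′ ]′ (x∈p∪q⁻ P R p∈))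
        (p∩q⊆q W′ _)
        (λ e∈ → let u , w , j , u∈ , w∈ , _ = S-edge e∈
                in within-mono W⊆M (S⊆W e∈) , u , w , j , q⊆p∪q P R u∈ ,
                   x∈p∩q⁺ (w∈ , ∈touching⁺ e∈ (joins⇒incidentˡ (joins-sym j))))
        leaving-P∪R

      tail-right : Right M (P ∪ R) W′ Y S⁺ Q
      tail-right = go rs
        where
        go : Right M P W Y S⁺ Q → Right M (P ∪ R) W′ Y S⁺ Q
        go (end Q⊆Y Y⊆Q cover) = end Q⊆Y Y⊆Q λ e∈ j u∈ v∉ →
          ∈W′ (cover e∈ j (W′⊆W u∈) (v∉ ∘ p⊆p∪q R)) (v∉ ∘ q⊆p∪q P R)
        go (inner Q-out Y⊆S ends exits) = inner
          (λ q∈ → let q∉P , q∉W = Q-out q∈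
                  in (λ q∈∪ → [ q∉P , q∉W ∘ R⊆W ]′ (x∈p∪q⁻ P R q∈∪)) , q∉W ∘ W′⊆W)
          Y⊆S ends
          (λ e∈ j u∈ v∉ v∉W′ → exits e∈ j (W′⊆W u∈) (v∉ ∘ p⊆p∪q R)
            λ v∈W → v∉W′ (∈W′ v∈W (v∉ ∘ q⊆p∪q P R)))

-- Layouts of chains, and joining them.

module Levels (G : Graph) where
  open Graph G
  open Walks G
  open Conversion G
  open Demands G
  open Layouts G
  open Subgraph

  private
    variable
      e             : Edge G
      v w x         : Vertex G
      h m n         : ℕ
      S S⁻ S⁺       : Edges G
      L M P Q R X Y : Vertices G
      Γ             : Subgraph G
      c q           : Sequence G

  -- A cut of size `suc n` would be minimum here, hence a minimal separator after passing to its
  -- boundary; descending to ever smaller reach sets would end at an important one.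
  stop-local : ∀ (Γ : Subgraph G) → within (V Γ) ⊆ E Γ →
               ¬ (∃ λ S → Important G Γ X Y S × ∣ S ∣ ≡ suc n) →
               Local n S⁻ X (V Γ) Y S⁺ → Local (suc n) S⁻ X (V Γ) Y S⁺
  stop-local {X} {Y} {n} Γ full none loc = record
    { left⊆ = left⊆ ; right⊆ = right⊆ ; outerˡ = outerˡ ; outerʳ = outerʳ ; disjoint = disjoint
    ; from-left = from-left ; to-right = to-right
    ; minCut = λ U X⊆ Y# → ℕ.≮⇒≥ λ small → refute _ U ℕ.≤-refl X⊆ Y# (ℕ.≤-pred small)
    }
    where
    open Local loc

    W : Vertices G
    W = V Γ

    Γ-boundary : ∀ {S U} → Closed (E Γ ─ S) U → within W ∩ boundary U ⊆ S
    Γ-boundary c e∈ = let e∈W , e∈∂ = x∈p∩q⁻ (within W) _ e∈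
                      in closed⇒boundary⊆ c (x∈p∩q⁺ (full e∈W , e∈∂))

    -- A set U minimal among those with a small boundary has an important separator as its boundary.
    refute : ∀ m U → ∣ U ∣ < m → X ⊆ U → Disjoint Y U → ¬ (∣ within W ∩ boundary U ∣ ≤ suc n)
    refute (suc m) U (s≤s ∣U∣≤m) X⊆U Y#U small =
      none (T , ((separator , minimal) , important) , ∣T∣≡)
      where
      T : Edges G
      T = within W ∩ boundary U

      ∣T∣≡ : ∣ T ∣ ≡ suc n
      ∣T∣≡ = ℕ.≤-antisym small (minCut U X⊆U Y#U)

      U-closed : Closed (E Γ ─ T) U
      U-closed = boundary⊆⇒closed λ e∈ →
        let e∈Γ , e∈∂ = x∈p∩q⁻ (E Γ) _ e∈ in x∈p∩q⁺ (edges⊆within Γ e∈Γ , e∈∂)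

      separator : Separator G Γ X Y T
      separator = full ∘ p∩q⊆p _ _ , λ (x , y , x∈ , y∈ , _ , p) →
        Y#U y∈ (closed-walk U-closed p (X⊆U x∈))

      minimal : ∀ T′ → T′ ⊂ T → ¬ Separator G Γ X Y T′
      minimal T′ T′⊂T (_ , unlinked) = ℕ.<⇒≱ (p⊂q⇒∣p∣<∣q∣ T′⊂T) (begin
        ∣ T ∣                                      ≡⟨ ∣T∣≡ ⟩
        suc n                                      ≤⟨ minCut D (reach-⊇ (E Γ ─ T′) X) Y#D ⟩
        ∣ within W ∩ boundary D ∣
          ≤⟨ p⊆q⇒∣p∣≤∣q∣ (Γ-boundary (reach-closed (E Γ ─ T′) X)) ⟩
        ∣ T′ ∣                                     ∎)
        where
        open ℕ.≤-Reasoning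
        D : Vertices G
        D = reach (E Γ ─ T′) X
        Y#D : Disjoint Y D
        Y#D y∈ y∈D with x , x∈ , p ← reach-walk (E Γ ─ T′) X y∈D =
          unlinked (x , _ , x∈ , y∈ , left⊆ x∈ , p)

      important : ∀ R → ReachSet G (_∖_ G Γ T) X R →
        ¬ (∃₂ λ T′ R′ → Separator G Γ X Y T′ × ∣ T′ ∣ ≤ ∣ T ∣ ×
                        ReachSet G (_∖_ G Γ T′) X R′ × R′ ⊂ R)
      important R rs (T′ , R′ , (_ , unlinked) , ∣T′∣≤ , rs′ , R′⊂R) =
        refute m R′
          (ℕ.<-≤-trans (p⊂q⇒∣p∣<∣q∣ R′⊂R)
            (ℕ.≤-trans (p⊆q⇒∣p∣≤∣q∣ (reachSet-least (_∖_ G Γ T) rs U-closed X⊆U)) ∣U∣≤m))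
          (reachSet-⊇ (_∖_ G Γ T′) left⊆ rs′)
          (λ y∈ y∈R′ → let x , x∈ , p = Equivalence.to (rs′ _) y∈R′
                       in unlinked (x , _ , x∈ , y∈ , p))
          (ℕ.≤-trans (p⊆q⇒∣p∣≤∣q∣ (Γ-boundary (reachSet-closed (_∖_ G Γ T′) rs′)))
            (ℕ.≤-trans ∣T′∣≤ small))

  total : Vertices G → Sequence G → Vertices G
  total P (single R)      = P ∪ R
  total P (R —⟨ _ ⟩— q) = total (P ∪ R) q

  first⊆ : Chain G h Γ X Y c → X ⊆ V Γ → first G c ⊆ V Γ
  first⊆ (stop _) X⊆ = id
  first⊆ {Γ = Γ} (cut {S} _ _ rs _) X⊆ =
    reachSet-least (_∖_ G Γ S) rs
      (λ (e , e∈ , j) _ → proj₂ (∈within⁻ (V Γ) j (edges⊆within Γ (p─q⊆p (E Γ) S e∈)))) X⊆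

  first⊇ : Chain G h Γ X Y c → X ⊆ V Γ → X ⊆ first G c
  first⊇ (stop _) X⊆ = X⊆
  first⊇ {Γ = Γ} (cut {S} _ _ rs _) X⊆ = reachSet-⊇ (_∖_ G Γ S) X⊆ rs

  chain-total : ∀ P → Chain G h Γ X Y c → X ⊆ V Γ → total P c ≡ P ∪ V Γ
  chain-total P (stop _) X⊆ = refl
  chain-total {Γ = Γ} P chain@(cut {S} {R} _ _ _ q) X⊆ =
    trans (chain-total (P ∪ R) q (p∩q⊆p (V Γ ∩ ∁ R) (touching G S))) (⊆-antisym to from)
    where
    to : (P ∪ R) ∪ (V Γ ∩ ∁ R) ⊆ P ∪ V Γ
    to v∈ with x∈p∪q⁻ (P ∪ R) _ v∈
    ... | inj₂ v∈V = q⊆p∪q P (V Γ) (p∩q⊆p (V Γ) _ v∈V)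
    ... | inj₁ v∈∪ with x∈p∪q⁻ P R v∈∪
    ...   | inj₁ v∈P = p⊆p∪q (V Γ) v∈P
    ...   | inj₂ v∈R = q⊆p∪q P (V Γ) (first⊆ chain X⊆ v∈R)

    from : P ∪ V Γ ⊆ (P ∪ R) ∪ (V Γ ∩ ∁ R)
    from {v} v∈ with v ∈? R | x∈p∪q⁻ P (V Γ) v∈
    ... | yes v∈R | _ = p⊆p∪q _ (q⊆p∪q P R v∈R)
    ... | no _ | inj₁ v∈P = p⊆p∪q _ (p⊆p∪q R v∈P)
    ... | no v∉R | inj₂ v∈V = q⊆p∪q (P ∪ R) _ (x∈p∩q⁺ (v∈V , x∉p⇒x∈∁p v∉R))

  chain-layout : ∀ (Γ : Subgraph G) → within (V Γ) ⊆ E Γ → Chain G (suc n) Γ X Y c →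
                 Local n S⁻ X (V Γ) Y S⁺ → Left M P (V Γ) S⁻ X → Right M P (V Γ) Y S⁺ Q → V Γ ⊆ M →
                 Layout (suc n) M Y S⁺ Q P S⁻ X c
  chain-layout {S⁻ = S⁻} Γ full (stop none) loc ls rs ⊆M =
    single (stop-local Γ full none loc) ls rs ⊆M
  chain-layout {n} {X} {Y} {S⁺ = S⁺} {M = M} {P} {Q}
               Γ full (cut {S} {R} {q} imp size reachable chain) loc ls rs ⊆M =
    cons head-local (head-left ls rs ⊆M) (head-right ls rs ⊆M) (⊆M ∘ R⊆W) (ℕ.≤-reflexive size)
      apart
      (subst (λ L → Layout (suc n) M Y S⁺ Q (P ∪ R) S L q) X′≡
        (chain-layout (induced G Γ (∁ R)) full′ chain tail-local
          (tail-left ls rs ⊆M) (tail-right ls rs ⊆M) (⊆M ∘ W′⊆W)))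
    where
    open FirstCut Γ full loc imp size reachable

    X′⊆W′ : X′ ⊆ W′
    X′⊆W′ = p∩q⊆p W′ (touching G S)

    apart : Disjoint (first G q) (P ∪ R)
    apart v∈ v∈∪ with v∈W′ ← first⊆ chain X′⊆W′ v∈ =
      [ (λ v∈P → P#W′ ls rs ⊆M v∈P v∈W′) , W′#R v∈W′ ]′ (x∈p∪q⁻ P R v∈∪)

    -- The chain takes the next left set from all remaining vertices, the list of components only
    -- from the next component. They agree because the latter contains its left set.
    X′≡ : X′ ≡ first G q ∩ touching G S
    X′≡ = ⊆-antisym
      (λ v∈ → x∈p∩q⁺ (first⊇ chain X′⊆W′ v∈ , p∩q⊆q W′ (touching G S) v∈))
      (λ v∈ → let v∈q , v∈S = x∈p∩q⁻ (first G q) (touching G S) v∈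
              in x∈p∩q⁺ (first⊆ chain X′⊆W′ v∈q , v∈S))

    full′ : within W′ ⊆ E (induced G Γ (∁ R))
    full′ e∈ = ∈induced⁺ Γ (∁ R) (full (within-mono W′⊆W e∈)) (within-mono (p∩q⊆q W (∁ R)) e∈)

  first-join : ∀ c S q → first G (join G c S q) ≡ first G c
  first-join (single R) S q = refl
  first-join (R —⟨ _ ⟩— c) S q = refl

  -- After a join, the right set of the last piece is computed from that piece alone. It is still
  -- that of the parent, whose right set lies in the last piece.
  right-end≡ : Local n S⁻ L R Y S → Y ⊆ touching G S → Y ≡ R ∩ touching G S
  right-end≡ {R = R} {Y} {S} loc Y⊆ = ⊆-antisym (λ v∈ → x∈p∩q⁺ (right⊆ v∈ , Y⊆ v∈)) from
    where
    open Local loc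
    from : R ∩ touching G S ⊆ Y
    from v∈ with v∈R , v∈S ← x∈p∩q⁻ R _ v∈ with e , e∈ , v~e ← ∈touching⁻ v∈S
      with w , y , j , w∉ , y∈ ← outerʳ e∈ with incident⇒either j v~e
    ... | inj₁ refl = ⊥-elim (w∉ v∈R)
    ... | inj₂ refl = y∈

  join-layout : Layout n M X S (∁ (total P c)) P S⁻ L c → X ⊆ touching G S → ∣ S ∣ ≤ n →
                Disjoint (first G q) (total P c) →
                Layout n M Y S⁺ Q (total P c) S (first G q ∩ touching G S) q →
                Layout n M Y S⁺ Q P S⁻ L (join G c S q)
  join-layout (single {R = R} loc ls rs ⊆M) X⊆ ∣S∣≤ apart rest with refl ← right-end≡ loc X⊆ =
    cons loc ls rs ⊆M ∣S∣≤ apart rest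
  join-layout {n = n} {M = M} {S = S} {q = q} {Y} {S⁺} {Q}
    (cons {R = R} {S = S₀} {P = P} {q = c} loc ls rs ⊆M ∣S₀∣≤ apart₀ rest₀) X⊆ ∣S∣≤ apart rest =
    cons loc ls rs ⊆M ∣S₀∣≤
      (subst (λ A → Disjoint A (P ∪ R)) (sym (first-join c S q)) apart₀)
      (subst (λ A → Layout n M Y S⁺ Q (P ∪ R) S₀ (A ∩ touching G S₀) (join G c S q))
        (sym (first-join c S q)) (join-layout rest₀ X⊆ ∣S∣≤ apart rest))

-- The invariant on all levels of the hierarchy.

module Decomposition (G : Graph) where
  open Graph G
  open Walks G
  open Conversion G
  open Demands G
  open Layouts G
  open Levels G
  open Subgraph

  private
    variable
      e             : Edge G
      u v x s t     : Vertex G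
      h k n         : ℕ
      S S⁻ S⁺       : Edges G
      L M P Q R X Y : Vertices G
      c q q′        : Sequence G

  ⊤∩≡ : ∀ {r} (p : Subset r) → ⊤ ∩ p ≡ p
  ⊤∩≡ p = ⊆-antisym (p∩q⊆q ⊤ p) λ x∈ → x∈p∩q⁺ (∈⊤ , x∈)

  component-layout : Chain G (suc n) (induced G (whole G) R) L Y c → Local n S⁻ L R Y S⁺ →
                     Left M P R S⁻ L → Right M P R Y S⁺ Q → R ⊆ M →
                     Layout (suc n) M Y S⁺ Q P S⁻ L c × total P c ≡ P ∪ R
  component-layout {n} {R} {L} {Y} {c} {S⁻} {S⁺} {M} {P} {Q} = go (⊤∩≡ R) (∈induced⁺ (whole G) R ∈⊤)
    where
    go : ∀ {Γ W} → V Γ ≡ W → within W ⊆ E Γ → Chain G (suc n) Γ L Y c → Local n S⁻ L W Y S⁺ →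
         Left M P W S⁻ L → Right M P W Y S⁺ Q → W ⊆ M →
         Layout (suc n) M Y S⁺ Q P S⁻ L c × total P c ≡ P ∪ W
    go {Γ} refl full chain loc ls rs ⊆M =
      chain-layout Γ full chain loc ls rs ⊆M , chain-total P chain (Local.left⊆ loc)

  refinement-first : Refinement G n t L q q′ → L ⊆ first G q →
                     first G q′ ⊆ first G q × L ⊆ first G q′
  refinement-first (last {R} chain) L⊆ =
    p∩q⊆q ⊤ R ∘ first⊆ chain L⊆′ , first⊇ chain L⊆′
    where L⊆′ = λ {x} x∈ → x∈p∩q⁺ {x = x} (∈⊤ , L⊆ x∈)
  refinement-first (step {R} {S} {c = c} {q′} chain _) L⊆ =
    (λ v∈ → p∩q⊆q ⊤ R (first⊆ chain L⊆′ (subst (_ ∈_) (first-join c S q′) v∈))) ,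
    (λ v∈ → subst (_ ∈_) (sym (first-join c S q′)) (first⊇ chain L⊆′ v∈))
    where L⊆′ = λ {x} x∈ → x∈p∩q⁺ {x = x} (∈⊤ , L⊆ x∈)

  refinement-left : Refinement G n t (first G q ∩ touching G S) q q′ →
                    first G q ∩ touching G S ≡ first G q′ ∩ touching G S
  refinement-left {q = q} {S} {q′} ref = ⊆-antisym
    (λ v∈ → x∈p∩q⁺ (proj₂ first-q′ v∈ , p∩q⊆q (first G q) _ v∈))
    (λ v∈ → let v∈q′ , v∈S = x∈p∩q⁻ (first G q′) _ v∈ in x∈p∩q⁺ (proj₁ first-q′ v∈q′ , v∈S))
    where first-q′ = refinement-first ref (p∩q⊆p (first G q) (touching G S))

  refinement-layout : Refinement G n t L q q′ → Layout n ⊤ ⁅ t ⁆ ⊥ ⁅ t ⁆ P S⁻ L q →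
                      Layout (suc n) ⊤ ⁅ t ⁆ ⊥ ⁅ t ⁆ P S⁻ L q′
  refinement-layout (last chain) (single loc ls rs ⊆M) = proj₁ (component-layout chain loc ls rs ⊆M)
  refinement-layout {n} {t} {P = P} {S⁻} (step {R} {S} {q} {c} {q′} chain ref)
                    (cons loc ls rs ⊆M ∣S∣≤ apart rest)
    with lay , total≡ ← component-layout chain loc ls rs ⊆M =
    join-layout {c = c} (subst (λ A → Layout _ _ _ _ (∁ A) _ _ _ c) (sym total≡) lay)
      -- Separators of coarser levels survive in finer ones, so a layout only bounds their sizes
      -- from above.
      (p∩q⊆q R _) (ℕ.m≤n⇒m≤1+n ∣S∣≤)
      (λ {v} v∈ v∈t → apart (proj₁ (refinement-first ref (p∩q⊆p (first G q) _)) v∈)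
                            (subst (v ∈_) total≡ v∈t))
      (subst (λ A → Layout _ _ _ _ _ (total P c) S A q′) (refinement-left ref)
        (subst (λ A → Layout _ _ _ _ _ A S (first G q ∩ touching G S) q′) (sym total≡)
          (refinement-layout ref rest)))

  -- 2-edge-connectivity supplies the bound 2 at level 1.
  top-layout : TwoEdgeConnected G → ∀ s t → Layout 1 ⊤ ⁅ t ⁆ ⊥ ⁅ t ⁆ ⁅ s ⁆ ⊥ ⁅ s ⁆ (single ⊤)
  top-layout connected s t = single
    record
      { left⊆ = λ _ → ∈⊤ ; right⊆ = λ _ → ∈⊤
      ; outerˡ = ⊥-elim ∘ ∉⊥ ; outerʳ = ⊥-elim ∘ ∉⊥ ; disjoint = λ e∈ _ → ∉⊥ e∈
      ; from-left = λ {v} _ → s , x∈⁅x⁆ s , walk s v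
      ; to-right = λ {v} _ → t , x∈⁅x⁆ t , walk v t
      ; minCut = λ U s∈U t∉U → ℕ.≮⇒≥ λ small →
          t∉U (x∈⁅x⁆ t) (closed-walk (boundary⊆⇒closed {E = ⊤} λ e∈ →
              let _ , e∈∂ = x∈p∩q⁻ ⊤ _ e∈
              in x∈p∩q⁺ (∈within⁺ (joins-ends _) ∈⊤ ∈⊤ , e∈∂))
            (proj₂ (connected (within ⊤ ∩ boundary U) small s t ∈⊤ ∈⊤)) (s∈U (x∈⁅x⁆ s)))
      }
    (start id id) (end id id λ _ _ _ _ → ∈⊤) id
    where
    walk : ∀ u v → Star (Adj (within ⊤)) u v
    walk u v = walk-mono (λ _ → ∈within⁺ (joins-ends _) ∈⊤ ∈⊤)
      (proj₂ (connected ⊥ (subst (_< 2) (sym (∣⊥∣≡0 #E)) (s≤s z≤n)) u v ∈⊤ ∈⊤))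

  level-layout : TwoEdgeConnected G → (D : Hierarchy G s t k) → ∀ h → 1 ≤ h → h < k →
                 Layout h ⊤ ⁅ t ⁆ ⊥ ⁅ t ⁆ ⁅ s ⁆ ⊥ ⁅ s ⁆ (Hierarchy.level D h)
  level-layout {s} {t} connected D 1 _ _ =
    subst (Layout 1 ⊤ ⁅ t ⁆ ⊥ ⁅ t ⁆ ⁅ s ⁆ ⊥ ⁅ s ⁆) (sym (Hierarchy.level-1 D))
      (top-layout connected s t)
  level-layout {k = k} connected D (suc (suc h)) _ h<k =
    refinement-layout
      (Hierarchy.refine D (suc h) (s≤s z≤n) (subst (_≤ k) (ℕ.+-comm 2 (suc h)) h<k))
      (level-layout connected D (suc h) (s≤s z≤n) (ℕ.<⇒≤ h<k))

  -- In contrast to `componentsFrom`, the right end is arbitrary, so the chain inside a single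
  -- component is covered too.
  Each : (Component G → Set) → Edges G → (L Y : Vertices G) → Edges G → Sequence G → Set
  Each Φ S⁻ L Y S⁺ (single R)     = Φ (component S⁻ L R Y S⁺)
  Each Φ S⁻ L Y S⁺ (R —⟨ S ⟩— q) =
    Φ (component S⁻ L R (R ∩ touching G S) S) × Each Φ S (first G q ∩ touching G S) Y S⁺ q

  private
    variable
      Φ Ψ : Component G → Set

  each⇒∈ : ∀ q → Each Φ S⁻ L ⁅ t ⁆ ⊥ q → ∀ {C} → C ∈ₗ componentsFrom G S⁻ L t q → Φ C
  each⇒∈ (single R) φ (here refl) = φ
  each⇒∈ (R —⟨ S ⟩— q) (φ , _) (here refl) = φ
  each⇒∈ (R —⟨ S ⟩— q) (_ , φs) (there C∈) = each⇒∈ q φs C∈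

  ∈⇒each : ∀ {H : Edges G} q → S⁻ ⊆ H → (∀ {e} → Any (e ∈_) (separators G q) → e ∈ H) →
           (∀ {C} → C ∈ₗ componentsFrom G S⁻ L t q → Φ C) →
           Each (λ C → Component.sepˡ C ⊆ H × Component.sepʳ C ⊆ H × Φ C) S⁻ L ⁅ t ⁆ ⊥ q
  ∈⇒each (single R) S⁻⊆ _ φ = S⁻⊆ , ⊥-elim ∘ ∉⊥ , φ (here refl)
  ∈⇒each (R —⟨ S ⟩— q) S⁻⊆ seps φ =
    (S⁻⊆ , (λ e∈ → seps (here e∈)) , φ (here refl)) ,
    ∈⇒each q (λ e∈ → seps (here e∈)) (seps ∘ there) (φ ∘ there)

  each-map : (∀ {S⁻ L R Y S⁺} → Local n S⁻ L R Y S⁺ →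
               Φ (component S⁻ L R Y S⁺) → Ψ (component S⁻ L R Y S⁺)) →
             Layout n M Y S⁺ Q P S⁻ L q → Each Φ S⁻ L Y S⁺ q → Each Ψ S⁻ L Y S⁺ q
  each-map f (single loc _ _ _) φ = f loc φ
  each-map f (cons loc _ _ _ _ _ rest) (φ , φs) = f loc φ , each-map f rest φs

  each-zip : ∀ q → Each Φ S⁻ L Y S⁺ q → Each Ψ S⁻ L Y S⁺ q → Each (λ C → Φ C × Ψ C) S⁻ L Y S⁺ q
  each-zip (single _) φ ψ = φ , ψ
  each-zip (_ —⟨ _ ⟩— q) (φ , φs) (ψ , ψs) = (φ , ψ) , each-zip q φs ψs

  each-proj₁ : ∀ q → Each (λ C → Φ C × Ψ C) S⁻ L Y S⁺ q → Each Φ S⁻ L Y S⁺ q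
  each-proj₁ (single _) (φ , _) = φ
  each-proj₁ (_ —⟨ _ ⟩— q) ((φ , _) , φs) = φ , each-proj₁ q φs

  each-proj₂ : ∀ q → Each (λ C → Φ C × Ψ C) S⁻ L Y S⁺ q → Each Ψ S⁻ L Y S⁺ q
  each-proj₂ (single _) (_ , ψ) = ψ
  each-proj₂ (_ —⟨ _ ⟩— q) ((_ , ψ) , ψs) = ψ , each-proj₂ q ψs

  each-join : Layout n M X S Q P S⁻ L c → X ⊆ touching G S → Each Φ S⁻ L Y S⁺ (join G c S q) →
              Each Φ S⁻ L X S c × Each Φ S (first G q ∩ touching G S) Y S⁺ q
  each-join (single loc _ _ _) X⊆ (φ , φs) with refl ← right-end≡ loc X⊆ = φ , φs
  each-join {S = S} {q = q} (cons {S = S₀} {q = c} loc _ _ _ _ _ rest) X⊆ (φ , φs)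
    rewrite first-join c S q with ψ , ψs ← each-join rest X⊆ φs = (φ , ψ) , ψs

  layout-boundary : Local n S⁻ L R Y S → Left M P R S⁻ L → Right M P R Y S (∁ (P ∪ R)) →
                    within M ∩ boundary (P ∪ R) ⊆ S
  layout-boundary {R = R} {Y} {S} {M} {P} loc ls rs {e} e∈ with e∈M , e∈∂ ← x∈p∩q⁻ (within M) _ e∈
    with u , v , j , u∈ , v∉ ← ∈boundary⁻ (P ∪ R) e∈∂ = go ls (x∈p∪q⁻ P R u∈)
    where
    open Local loc
    from-R : Right M P R Y S (∁ (P ∪ R)) → u ∈ R → e ∈ S
    from-R (end _ _ cover) u∈R = ⊥-elim (v∉ (q⊆p∪q P R (cover e∈M j u∈R (v∉ ∘ p⊆p∪q R))))
    from-R (inner _ _ _ exits) u∈R =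
      proj₁ (exits e∈M j u∈R (v∉ ∘ p⊆p∪q R) (v∉ ∘ q⊆p∪q P R))

    go : Left M P R _ _ → u ∈ P ⊎ u ∈ R → e ∈ S
    go _ (inj₂ u∈R) = from-R rs u∈R
    go (start P⊆L _) (inj₁ u∈P) = from-R rs (left⊆ (P⊆L u∈P))
    go (inner _ _ _ enters) (inj₁ u∈P) =
      ⊥-elim (v∉ (q⊆p∪q P R (left⊆ (proj₂ (enters e∈M j u∈P (v∉ ∘ p⊆p∪q R))))))

  layout-right# : Layout n M Y S⁺ Q P S⁻ L q → Disjoint (first G q) P → Disjoint Y P
  layout-right# (single loc _ _ _) apart y∈ = apart (Local.right⊆ loc y∈)
  layout-right# {P = P} (cons {R = R} _ _ _ _ _ apart rest) _ y∈ y∈P =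
    layout-right# rest apart y∈ (p⊆p∪q R y∈P)

  total-join : ∀ P c → total P (join G c S q) ≡ total (total P c) q
  total-join P (single R)      = refl
  total-join P (R —⟨ _ ⟩— c) = total-join (P ∪ R) c

  refinement-total : Refinement G n t L q q′ → Layout n ⊤ ⁅ t ⁆ ⊥ ⁅ t ⁆ P S⁻ L q →
                     total P q′ ≡ total P q
  refinement-total (last chain) (single loc ls rs ⊆M) = proj₂ (component-layout chain loc ls rs ⊆M)
  refinement-total {P = P} (step {c = c} {q′} chain ref) (cons loc ls rs ⊆M _ _ rest) =
    trans (total-join P c)
      (trans (cong (λ A → total A q′) (proj₂ (component-layout chain loc ls rs ⊆M)))
             (refinement-total ref rest))

  level-total : TwoEdgeConnected G → (D : Hierarchy G s t k) → ∀ h → 1 ≤ h → h < k →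
                total ⁅ s ⁆ (Hierarchy.level D h) ≡ ⊤
  level-total {s} connected D 1 _ _ = trans (cong (total ⁅ s ⁆) (Hierarchy.level-1 D))
    (⊆-antisym (λ _ → ∈⊤) (q⊆p∪q ⁅ s ⁆ ⊤))
  level-total {k = k} connected D (suc (suc h)) _ h<k = trans
    (refinement-total
      (Hierarchy.refine D (suc h) (s≤s z≤n) (subst (_≤ k) (ℕ.+-comm 2 (suc h)) h<k))
      (level-layout connected D (suc h) (s≤s z≤n) (ℕ.<⇒≤ h<k)))
    (level-total connected D (suc h) (s≤s z≤n) (ℕ.<⇒≤ h<k))

-- Sufficiency of the conditions.

module Sufficiency (G : Graph) (H : Subgraph G) (k : ℕ) where
  open Graph G
  open Walks G
  open Conversion G
  open Demands G
  open Layouts G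
  open Levels G
  open Decomposition G

  private
    variable
      t         : Vertex G
      h n       : ℕ
      S⁻ S⁺     : Edges G
      L M P R Y : Vertices G
      c q q′    : Sequence G

    Eᴴ : Edges G
    Eᴴ = Subgraph.E H

  H-feasible : Vertices G → Vertices G → Vertices G → ℕ → Set
  H-feasible R = Feasible (within R) (Eᴴ ∩ within R)

  Partial : Component G → Set
  Partial (component S⁻ L R Y S⁺) =
    ∀ X′ Y′ → X′ ⊆ L → Y′ ⊆ Y → (X′ , Y′) ≢ (L , Y) → H-feasible R X′ Y′ (demand k S⁻ S⁺ X′ Y′)

  Full : ℕ → Component G → Set
  Full d (component S⁻ L R Y S⁺) = H-feasible R L Y d

  Bounded : Component G → Set
  Bounded C = Component.sepˡ C ⊆ Eᴴ × Component.sepʳ C ⊆ Eᴴ × Partial C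

  Conditions : ℕ → Component G → Set
  Conditions h (component S⁻ L R Y S⁺) =
    let Gᵢ = induced G (whole G) R
        Hᵢ = induced G H R
    in (∀ X′ Y′ → X′ ⊆ L → Y′ ⊆ Y → (X′ , Y′) ≢ (L , Y) → RSND G Gᵢ Hᵢ X′ Y′ (demand k S⁻ S⁺ X′ Y′))
     × RSND G Gᵢ Hᵢ L Y (h + 1)
     × RSND G Gᵢ Hᵢ L Y (k ∸ 1)

  conditions⇒bounded : Local n S⁻ L R Y S⁺ →
                       S⁻ ⊆ Eᴴ × S⁺ ⊆ Eᴴ × Conditions h (component S⁻ L R Y S⁺) →
                       Bounded (component S⁻ L R Y S⁺) × Full (suc h) (component S⁻ L R Y S⁺)
  conditions⇒bounded {L = L} {R} {Y} {h = h} loc (S⁻⊆ , S⁺⊆ , partial , full , _) =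
    ( S⁻⊆ , S⁺⊆
    , λ X′ Y′ X⊆ Y⊆ neq → rsnd⇒feasible H (λ x∈ → left⊆ (X⊆ x∈)) (partial X′ Y′ X⊆ Y⊆ neq)) ,
    rsnd⇒feasible H left⊆
      (subst (RSND G (induced G (whole G) R) (induced G H R) L Y) (ℕ.+-comm h 1) full)
    where open Local loc

  -- Glue at `B = P ∪ R`: the first component supplies the demand from `P` to `∁ B`, the remaining
  -- ones that from `B` to `Y`. Enlarging `P` leaves fewer cuts, so the minimum cut bound persists
  -- along the sequence.
  glue-layout : Layout h M Y S⁺ Y P S⁻ L q → MinCut (Eᴴ ∩ within M) P Y h →
                Each (λ C → Bounded C × Full k C) S⁻ L Y S⁺ q → H-feasible M P Y k
  glue-layout (single loc ls rs ⊆M) mc ((S⁻⊆ , S⁺⊆ , partial) , full) =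
    conditions⇒feasible Eᴴ loc ls rs ⊆M S⁻⊆ S⁺⊆ partial full
  glue-layout {M = M} {P = P} (cons {R = R} {S = S} loc ls rs ⊆M ∣S∣≤ apart rest) mc
              (((S⁻⊆ , S⊆ , partial) , full) , good) =
    glue (p⊆p∪q R) (layout-right# rest apart) (p∩q⊆q Eᴴ (within M))
      (ℕ.≤-trans (p⊆q⇒∣p∣≤∣q∣ λ e∈ →
        let e∈HM , e∈∂ = x∈p∩q⁻ (Eᴴ ∩ within M) _ e∈
        in boundary⊆S (x∈p∩q⁺ (p∩q⊆q Eᴴ _ e∈HM , e∈∂))) ∣S∣≤)
      (λ e∈ → x∈p∩q⁺ (S⊆ (boundary⊆S e∈) , p∩q⊆p (within M) _ e∈))
      mc
      (conditions⇒feasible Eᴴ loc ls rs ⊆M S⁻⊆ S⊆ partial full)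
      (glue-layout rest (λ U PR⊆ → mc U (PR⊆ ∘ p⊆p∪q R)) good)
    where
    boundary⊆S : within M ∩ boundary (P ∪ R) ⊆ S
    boundary⊆S = layout-boundary loc ls rs

  -- Deleting a cut of H[R] with at most `n` edges would leave the ends connected in G[R], and by
  -- the demand also in H[R].
  H-minCut : Local n S⁻ L R Y S⁺ → H-feasible R L Y (suc n) → MinCut (Eᴴ ∩ within R) L Y (suc n)
  H-minCut {L = L} {R} {Y} loc feasible U L⊆U Y#U = ℕ.≮⇒≥ λ small →
    closed⇒¬conn (boundary⊆⇒closed id) L⊆U Y#U
      (feasible F small (conn-by-cuts (within R ─ F) L Y λ D closed L⊆D Y#D →
        ℕ.<⇒≱ small (ℕ.≤-trans (Local.minCut loc D L⊆D Y#D)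
          (p⊆q⇒∣p∣≤∣q∣ (closed⇒boundary⊆ closed)))))
    where
    F : Edges G
    F = (Eᴴ ∩ within R) ∩ boundary U

  -- Inside G[R] the chain is laid out between `L` and `Y` themselves. Its separators have `suc n`
  -- edges, exactly the lower bound for cuts of H[R], as gluing requires.
  refined-component : Local n S⁻ L R Y S⁺ → Chain G (suc n) (induced G (whole G) R) L Y c →
                      Full (suc n) (component S⁻ L R Y S⁺) →
                      Each (λ C → Bounded C × Full k C) S⁻ L Y S⁺ c → Full k (component S⁻ L R Y S⁺)
  refined-component {R = R} loc chain full good = glue-layout
    (proj₁ (component-layout chain loc (start id id)
      (end id id λ e∈ j _ _ → proj₂ (∈within⁻ R j e∈)) id))
    (H-minCut loc full) good

  refined : Refinement G n t L q q′ → Layout n ⊤ ⁅ t ⁆ ⊥ ⁅ t ⁆ P S⁻ L q →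
            Each (Full (suc n)) S⁻ L ⁅ t ⁆ ⊥ q →
            Each (λ C → Bounded C × Full k C) S⁻ L ⁅ t ⁆ ⊥ q′ → Each (Full k) S⁻ L ⁅ t ⁆ ⊥ q
  refined (last chain) (single loc _ _ _) full good = refined-component loc chain full good
  refined {t = t} {q′ = .(join G c S q′)} (step {R} {S} {q} {c} {q′} chain ref)
          (cons loc ls rs ⊆M _ _ rest) (full , fulls) good
    with goods , goods′ ← each-join (proj₁ (component-layout chain loc ls rs ⊆M)) (p∩q⊆q R _) good =
    refined-component loc chain full goods ,
    refined ref rest fulls
      (subst (λ A → Each _ S A ⁅ t ⁆ ⊥ q′) (sym (refinement-left ref)) goods′)

-- Necessity of the conditions.

module Necessity (G : Graph) (H : Subgraph G) (s t : Vertex G) (k : ℕ) where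
  open Graph G
  open Walks G
  open Conversion G
  open Demands G
  open Layouts G
  open Levels G
  open Decomposition G

  private
    variable
      e           : Edge G
      v           : Vertex G
      m n d       : ℕ
      S S⁻ S⁺     : Edges G
      L P Q R X Y : Vertices G
      q           : Sequence G

    Eᴴ : Edges G
    Eᴴ = Subgraph.E H

  H-feasible : Vertices G → Vertices G → ℕ → Set
  H-feasible = Feasible (within ⊤) (Eᴴ ∩ within ⊤)

  ∈within-⊤ : e ∈ within ⊤
  ∈within-⊤ = ∈within⁺ (joins-ends _) ∈⊤ ∈⊤

  separate-feasible : H-feasible ⁅ s ⁆ ⁅ t ⁆ k → Disjoint P Q →
    (∀ {p} → p ∈ P → Star (Adj (within P)) s p) → s ∈ P →
    (∀ {q} → q ∈ Q → Star (Adj (within Q)) q t) → t ∈ Q → H-feasible P Q k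
  separate-feasible {P} {Q} feasible P#Q from-s s∈ to-t t∈ F F<k (p , q , p∈ , q∈ , walk) =
    conn-by-cuts _ P Q λ U closed P⊆U Q#U →
      closed⇒¬conn (still-closed U closed P⊆U Q#U)
        (λ x∈ → subst (_∈ U) (sym (x∈⁅y⁆⇒x≡y s x∈)) (P⊆U s∈))
        (λ x∈ → Q#U (subst (_∈ Q) (sym (x∈⁅y⁆⇒x≡y t x∈)) t∈))
        (feasible F′ (ℕ.≤-<-trans (p⊆q⇒∣p∣≤∣q∣ F′⊆F) F<k)
          (s , t , x∈⁅x⁆ s , x∈⁅x⁆ t ,
           walk-mono (λ e∈ → keep λ e∈F′ → proj₂ (x∈p─q⁻ F _ (p─q⊆p _ (within Q) e∈F′)) e∈) (from-s p∈)
           ◅◅ walk-mono (λ e∈ → keep (proj₂ (x∈p─q⁻ (within ⊤) F e∈) ∘ F′⊆F)) walk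
           ◅◅ walk-mono (λ e∈ → keep λ e∈F′ → proj₂ (x∈p─q⁻ (F ─ within P) _ e∈F′) e∈) (to-t q∈)))
    where
    -- Edges inside P or inside Q are irrelevant for separating P from Q.
    F′ : Edges G
    F′ = (F ─ within P) ─ within Q

    F′⊆F : F′ ⊆ F
    F′⊆F = p─q⊆p F (within P) ∘ p─q⊆p _ (within Q)

    keep : e ∉ F′ → e ∈ within ⊤ ─ F′
    keep = x∈p∧x∉q⇒x∈p─q ∈within-⊤

    still-closed : ∀ U → Closed ((Eᴴ ∩ within ⊤) ─ F) U → P ⊆ U → Disjoint Q U →
                   Closed ((Eᴴ ∩ within ⊤) ─ F′) U
    still-closed U closed P⊆U Q#U (e , e∈ , j) u∈ with e∈H , e∉F′ ← x∈p─q⁻ _ F′ e∈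
      with e ∈? F | e ∈? within P | e ∈? within Q
    ... | no e∉F | _ | _ = closed (e , x∈p∧x∉q⇒x∈p─q e∈H e∉F , j) u∈
    ... | yes _ | yes e∈P | _ = P⊆U (proj₂ (∈within⁻ P j e∈P))
    ... | yes _ | no _ | yes e∈Q = ⊥-elim (Q#U (proj₁ (∈within⁻ Q j e∈Q)) u∈)
    ... | yes e∈F | no e∉P | no e∉Q =
      ⊥-elim (e∉F′ (x∈p∧x∉q⇒x∈p─q (x∈p∧x∉q⇒x∈p─q e∈F e∉P) e∉Q))

  layout-outerˡ : Layout n ⊤ Y S⁺ Q P S⁻ L q →
                  e ∈ S⁻ → ∃₂ λ w x → Joins e w x × x ∈ first G q
  layout-outerˡ (single loc _ _ _) e∈ with w , x , j , _ , x∈ ← Local.outerˡ loc e∈ =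
    w , x , j , Local.left⊆ loc x∈
  layout-outerˡ (cons loc _ _ _ _ _ _) e∈ with w , x , j , _ , x∈ ← Local.outerˡ loc e∈ =
    w , x , j , Local.left⊆ loc x∈

  component-walk : Local n S⁻ L R Y S⁺ → v ∈ R → ∃ λ y → y ∈ Y × Star (Adj (within R)) v y
  component-walk loc v∈ with x , x∈ , p ← Local.from-left loc v∈
    with y , y∈ , p′ ← Local.to-right loc x∈ = y , y∈ , walk-sym p ◅◅ p′

  S-crosses : Local n S⁻ L R Y S → Disjoint (first G q) (P ∪ R) →
              Layout m ⊤ X S⁺ Q (P ∪ R) S (first G q ∩ touching G S) q →
              e ∈ S → ∃₂ λ y x → Joins e y x × y ∈ R × x ∉ P ∪ R
  S-crosses {P = P} loc apart rest e∈ with w , x , j , x∈ ← layout-outerˡ rest e∈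
    with _ , y , j′ , _ , y∈ ← Local.outerʳ loc e∈ with joins⇒either j j′
  ... | inj₁ (refl , refl) = ⊥-elim (apart x∈ (q⊆p∪q P _ (Local.right⊆ loc y∈)))
  ... | inj₂ (refl , refl) = y , x , j , Local.right⊆ loc y∈ , apart x∈

  leave-component : Local n S⁻ L R Y S → Disjoint (first G q) (P ∪ R) →
                    Layout m ⊤ X S⁺ Q (P ∪ R) S (first G q ∩ touching G S) q →
                    v ∈ R ∩ touching G S → ∃₂ λ e x → Joins e v x × x ∉ P ∪ R
  leave-component {R = R} {P = P} loc apart rest v∈ with v∈R , v∈S ← x∈p∩q⁻ R _ v∈
    with e , e∈ , v~e ← ∈touching⁻ v∈S with y , x , j , _ , x∉ ← S-crosses loc apart rest e∈
    with incident⇒either j v~e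
  ... | inj₁ refl = e , x , j , x∉
  ... | inj₂ refl = ⊥-elim (x∉ (q⊆p∪q P R v∈R))

  -- Walk to the right end of the component, cross its separator, and repeat; this never returns to
  -- `P`.
  outside-walk : Layout n ⊤ ⁅ t ⁆ ⊥ Q P S⁻ L q → Disjoint (first G q) P → total P q ≡ ⊤ →
                 v ∉ P → Star (Adj (within (∁ P))) v t
  outside-walk {P = P} {v = v} (single {R = R} loc _ _ _) apart total≡ v∉
    with x∈p∪q⁻ P R (subst (v ∈_) (sym total≡) ∈⊤)
  ... | inj₁ v∈P = ⊥-elim (v∉ v∈P)
  ... | inj₂ v∈R with y , y∈ , p ← component-walk loc v∈R with refl ← x∈⁅y⁆⇒x≡y t y∈ =
    walk-mono (within-mono (x∉p⇒x∈∁p ∘ apart)) p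
  outside-walk {P = P} {v = v} (cons {R = R} loc _ _ _ _ apart′ rest) apart total≡ v∉ =
    by-cases (v ∈? R)
    where
    ∁PR⊆ : ∁ (P ∪ R) ⊆ ∁ P
    ∁PR⊆ = p⊆q⇒∁p⊇∁q (p⊆p∪q R)

    beyond : ∀ {x} → x ∉ P ∪ R → Star (Adj (within (∁ P))) x t
    beyond x∉ = walk-mono (within-mono ∁PR⊆) (outside-walk rest apart′ total≡ x∉)

    by-cases : Dec (v ∈ R) → Star (Adj (within (∁ P))) v t
    by-cases (no v∉R) = beyond ([ v∉ , v∉R ]′ ∘ x∈p∪q⁻ P R)
    by-cases (yes v∈R) =
      let y , y∈ , p = component-walk loc v∈R
          e , x , j , x∉ = leave-component loc apart′ rest y∈
      in
      walk-mono (within-mono (x∉p⇒x∈∁p ∘ apart)) p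
      ◅◅ (e , ∈within⁺ j (x∉p⇒x∈∁p (apart (p∩q⊆p R _ y∈))) (x∉p⇒x∈∁p (x∉ ∘ p⊆p∪q R)) , j)
      ◅ beyond x∉

  Demanded : Component G → Set
  Demanded (component S⁻ L R Y S⁺) =
    (∀ X′ Y′ → X′ ⊆ L → Y′ ⊆ Y →
      RSND G (induced G (whole G) R) (induced G H R) X′ Y′ (demand k S⁻ S⁺ X′ Y′)) ×
    (∀ d → d ≤ k → RSND G (induced G (whole G) R) (induced G H R) L Y d)

  -- With the full left and right sets every separator edge is attached, so the demand is at least
  -- `k`; conditions 2 and 3 are the cases `d = h + 1` and `d = k ∸ 1`.
  demanded : Local n S⁻ L R Y S⁺ →
    (∀ X′ Y′ → X′ ⊆ L → Y′ ⊆ Y →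
      RSND G (induced G (whole G) R) (induced G H R) X′ Y′ (demand k S⁻ S⁺ X′ Y′)) →
    Demanded (component S⁻ L R Y S⁺)
  demanded {S⁻ = S⁻} {L} {Y = Y} {S⁺} loc all =
    all , λ d d≤k F F⊆ F<d → all L Y id id F F⊆ (ℕ.<-≤-trans F<d (ℕ.≤-trans d≤k k≤demand))
    where
    open Local loc
    attached-all : ∣ S⁻ ∣ + ∣ S⁺ ∣ ≤ ∣ edgesAt G S⁻ L ∣ + ∣ edgesAt G S⁺ Y ∣
    attached-all = ℕ.+-mono-≤
      (p⊆q⇒∣p∣≤∣q∣ λ e∈ → let _ , _ , j , _ , x∈ = outerˡ e∈
                          in ∈edgesAt⁺ e∈ x∈ (joins⇒incidentˡ (joins-sym j)))
      (p⊆q⇒∣p∣≤∣q∣ λ e∈ → let _ , _ , j , _ , y∈ = outerʳ e∈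
                          in ∈edgesAt⁺ e∈ y∈ (joins⇒incidentˡ (joins-sym j)))

    k≤demand : k ≤ demand k S⁻ S⁺ L Y
    k≤demand = ℕ.m+n≤o⇒m≤o∸n k
      (ℕ.≤-trans (ℕ.+-monoʳ-≤ k attached-all) (ℕ.≤-reflexive (sym (ℕ.+-assoc k _ _))))

  module _ (feasible : H-feasible ⁅ s ⁆ ⁅ t ⁆ k) where

    -- Delete `S - e`, fewer than `k` edges. In G the terminals remain connected through `e`, so H
    -- must connect them too, and `e` is the only edge left across `P ∪ R`.
    separator⊆ : n < k → Local n S⁻ L R Y S → Left ⊤ P R S⁻ L → Right ⊤ P R Y S (∁ (P ∪ R)) →
      ∣ S ∣ ≤ n → Disjoint (first G q) (P ∪ R) →
      Layout n ⊤ ⁅ t ⁆ ⊥ ⁅ t ⁆ (P ∪ R) S (first G q ∩ touching G S) q → total (P ∪ R) q ≡ ⊤ →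
      (∀ {v} → v ∈ P ∪ R → Star (Adj (within (P ∪ R))) s v) → s ∈ P ∪ R → S ⊆ Eᴴ
    separator⊆ {R = R} {S = S} {P = P} n<k loc ls rs ∣S∣≤ apart rest total≡ from-s s∈ {e} e∈S =
      remaining (feasible (S - e)
        (ℕ.<-≤-trans (x∈p⇒∣p-x∣<∣p∣ e∈S) (ℕ.≤-trans ∣S∣≤ (ℕ.<⇒≤ n<k))) through-e)
      where
      keep : ∀ {e′} → e′ ∉ S - e → e′ ∈ within ⊤ ─ (S - e)
      keep = x∈p∧x∉q⇒x∈p─q ∈within-⊤

      inside∉S : ∀ {e′} → e′ ∈ within (P ∪ R) → e′ ∉ S
      inside∉S e′∈ e′∈S with _ , _ , j , _ , x∉ ← S-crosses loc apart rest e′∈S =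
        x∉ (proj₂ (∈within⁻ (P ∪ R) j e′∈))

      outside∉S : ∀ {e′} → e′ ∈ within (∁ (P ∪ R)) → e′ ∉ S
      outside∉S e′∈ e′∈S with _ , _ , j , y∈ , _ ← S-crosses loc apart rest e′∈S =
        x∈∁p⇒x∉p (proj₁ (∈within⁻ (∁ (P ∪ R)) j e′∈)) (q⊆p∪q P R y∈)

      through-e : Conn (within ⊤ ─ (S - e)) ⁅ s ⁆ ⁅ t ⁆
      through-e with y , x , j , y∈ , x∉ ← S-crosses loc apart rest e∈S =
        s , t , x∈⁅x⁆ s , x∈⁅x⁆ t ,
        walk-mono (λ e∈ → keep (inside∉S e∈ ∘ p─q⊆p S ⁅ e ⁆)) (from-s (q⊆p∪q P R y∈))
        ◅◅ (e , keep (λ e∈S′ → proj₂ (x∈p─q⁻ S ⁅ e ⁆ e∈S′) (x∈⁅x⁆ e)) , j)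
        ◅ walk-mono (λ e∈ → keep (outside∉S e∈ ∘ p─q⊆p S ⁅ e ⁆)) (outside-walk rest apart total≡ x∉)

      remaining : Conn ((Eᴴ ∩ within ⊤) ─ (S - e)) ⁅ s ⁆ ⁅ t ⁆ → e ∈ Eᴴ
      remaining (s′ , t′ , s′∈ , t′∈ , walk)
        with refl ← x∈⁅y⁆⇒x≡y s s′∈ | refl ← x∈⁅y⁆⇒x≡y t t′∈
        with a , b , (e′ , e′∈ , j) , a∈ , b∉ ←
          exit (P ∪ R) walk s∈ (layout-right# rest apart (x∈⁅x⁆ t))
        with e′∈H , e′∉ ← x∈p─q⁻ _ (S - e) e′∈
        with e′∈S ← layout-boundary loc ls rs (x∈p∩q⁺ (∈within-⊤ , ∈boundary⁺ j a∈ b∉)) =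
        subst (_∈ Eᴴ) (decidable-stable (e′ ≟ e) λ e′≢e → e′∉ (x∈p∧x≢y⇒x∈p-y e′∈S e′≢e))
          (p∩q⊆p Eᴴ _ e′∈H)

    extend-walks : Local n S⁻ L R Y S⁺ → Left ⊤ P R S⁻ L →
                   (∀ {v} → v ∈ P → Star (Adj (within P)) s v) →
                   ∀ {v} → v ∈ P ∪ R → Star (Adj (within (P ∪ R))) s v
    extend-walks {L = L} {R = R} {P = P} loc ls from-s {v} v∈ with x∈p∪q⁻ P R v∈
    ... | inj₁ v∈P = walk-mono (within-mono (p⊆p∪q R)) (from-s v∈P)
    ... | inj₂ v∈R with x , x∈ , p ← Local.from-left loc v∈R =
      to-L ls x∈ ◅◅ walk-mono (within-mono (q⊆p∪q P R)) p
      where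
      from-P : ∀ {x} → x ∈ P → Star (Adj (within (P ∪ R))) s x
      from-P = walk-mono (within-mono (p⊆p∪q R)) ∘ from-s

      to-L : Left ⊤ P R _ L → ∀ {x} → x ∈ L → Star (Adj (within (P ∪ R))) s x
      to-L (start _ L⊆P) x∈ = from-P (L⊆P x∈)
      to-L (inner _ L⊆S ends _) x∈ with e , e∈ , x~e ← ∈touching⁻ (L⊆S x∈)
        with _ , p , x′ , j , p∈ , x′∈ ← ends e∈ with incident⇒either j x~e
      ... | inj₁ refl = from-P p∈
      ... | inj₂ refl = from-P p∈ ◅◅
        (e , ∈within⁺ j (p⊆p∪q R p∈) (q⊆p∪q P R (Local.left⊆ loc x∈)) , j) ◅ ε

    necessary : n < k → Layout n ⊤ ⁅ t ⁆ ⊥ ⁅ t ⁆ P S⁻ L q → total P q ≡ ⊤ → t ∉ P →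
      (∀ {v} → v ∈ P → Star (Adj (within P)) s v) → s ∈ P → S⁻ ⊆ Eᴴ →
      (∀ {v x} → v ∈ L → v ∈ P → x ∈ L → v ≡ x) →
      (∀ {e} → Any (e ∈_) (separators G q) → e ∈ Eᴴ) × Each Demanded S⁻ L ⁅ t ⁆ ⊥ q
    necessary {P = P} n<k (single loc ls rs ⊆M) total≡ t∉P from-s s∈ S⁻⊆ uniq =
      (λ ()) ,
      demanded loc (feasible⇒conditions H loc ls rs ⊆M S⁻⊆ (⊥-elim ∘ ∉⊥) uniq
        (λ v∈ _ y∈ → trans (x∈⁅y⁆⇒x≡y t v∈) (sym (x∈⁅y⁆⇒x≡y t y∈))) P#t
        (separate-feasible feasible P#t from-s s∈
          (λ {q} q∈ → subst (λ q → Star _ q t) (sym (x∈⁅y⁆⇒x≡y t q∈)) ε) (x∈⁅x⁆ t)))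
      where
      P#t : Disjoint P ⁅ t ⁆
      P#t p∈ p∈t = t∉P (subst (_∈ P) (x∈⁅y⁆⇒x≡y t p∈t) p∈)
    necessary {P = P} n<k (cons {R = R} {S = S} {q = q} loc ls rs ⊆M ∣S∣≤ apart rest)
              total≡ t∉P from-s s∈ S⁻⊆ uniq =
      let seps , conds = necessary n<k rest total≡ (layout-right# rest apart (x∈⁅x⁆ t))
             (extend-walks loc ls from-s) (p⊆p∪q R s∈) S⊆
             -- From the second component on, the left set misses `P`, so uniqueness is vacuous.
             (λ v∈ v∈PR _ → ⊥-elim (apart (p∩q⊆p (first G q) _ v∈) v∈PR))
      in
      (λ { (here e∈) → S⊆ e∈ ; (there e∈) → seps e∈ }) ,
      demanded loc (feasible⇒conditions H loc ls rs ⊆M S⁻⊆ S⊆ uniq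
        (λ v∈ v∈∁ _ → ⊥-elim (x∈∁p⇒x∉p v∈∁ (q⊆p∪q P R (p∩q⊆p R _ v∈)))) P#∁
        (separate-feasible feasible P#∁ from-s s∈
          (outside-walk rest apart total≡ ∘ x∈∁p⇒x∉p)
          (x∉p⇒x∈∁p (layout-right# rest apart (x∈⁅x⁆ t))))) ,
      conds
      where
      S⊆ : S ⊆ Eᴴ
      S⊆ = separator⊆ n<k loc ls rs ∣S∣≤ apart rest total≡ (extend-walks loc ls from-s) (p⊆p∪q R s∈)

      P#∁ : Disjoint P (∁ (P ∪ R))
      P#∁ p∈ p∈∁ = x∈∁p⇒x∉p p∈∁ (p⊆p∪q R p∈)

-- The terminals as one-element sets.

module Terminals (G : Graph) (s t : Vertex G) (k : ℕ) (H : Subgraph G) where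
  open Graph G
  open Walks G

  private
    Eᴴ : Edges G
    Eᴴ = Subgraph.E H

  sd-rsnd⇒feasible : SD-RSND G s t k H → Feasible (within ⊤) (Eᴴ ∩ within ⊤) ⁅ s ⁆ ⁅ t ⁆ k
  sd-rsnd⇒feasible sd F F<k (s′ , t′ , s′∈ , t′∈ , walk)
    with refl ← x∈⁅y⁆⇒x≡y s s′∈ | refl ← x∈⁅y⁆⇒x≡y t t′∈ =
    s , t , s′∈ , t′∈ ,
    walk-mono (─-monoˡ F λ e∈ → x∈p∩q⁺ (e∈ , ∈within⁺ (joins-ends _) ∈⊤ ∈⊤))
      (proj₂ (sd F F<k (∈⊤ , walk-mono (─-monoˡ F λ _ → ∈⊤) walk)))

  feasible⇒sd-rsnd : s ≢ t → Feasible (within ⊤) (Eᴴ ∩ within ⊤) ⁅ s ⁆ ⁅ t ⁆ k → SD-RSND G s t k H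
  feasible⇒sd-rsnd s≢t feasible F F<k (_ , walk)
    with s′ , t′ , s′∈ , t′∈ , walk′ ← feasible F F<k (s , t , x∈⁅x⁆ s , x∈⁅x⁆ t ,
           walk-mono (─-monoˡ F λ _ → ∈within⁺ (joins-ends _) ∈⊤ ∈⊤) walk)
    with refl ← x∈⁅y⁆⇒x≡y s s′∈ | refl ← x∈⁅y⁆⇒x≡y t t′∈ =
    s∈H walk′ , walk-mono (─-monoˡ F (p∩q⊆p Eᴴ _)) walk′
    where
    s∈H : Star (Adj ((Eᴴ ∩ within ⊤) ─ F)) s t → s ∈ Subgraph.V H
    s∈H ε = ⊥-elim (s≢t refl)
    s∈H ((e , e∈ , j) ◅ _) =
      Subgraph.closed H (p∩q⊆p Eᴴ _ (p─q⊆p _ F e∈)) (joins⇒incidentˡ j)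

theorem4p2 :
  (G : Graph) → TwoEdgeConnected G →
  (s t : Vertex G) → s ≢ t →
  (k : ℕ) → 2 ≤ k →
  (D : Hierarchy G s t k) →
  (H : Subgraph G) →
  SD-RSND G s t k H ⇔
    ( (∀ e → InSeparators G D e → e ∈ Subgraph.E H)
    × (∀ h → 1 ≤ h → h < k →
       ∀ S⁻ Vˡ R Vʳ S⁺ → component S⁻ Vˡ R Vʳ S⁺ ∈ₗ components G D h →
       let Gᵢ = induced G (whole G) R
           Hᵢ = induced G H R
       in (∀ X Y → X ⊆ Vˡ → Y ⊆ Vʳ → (X , Y) ≢ (Vˡ , Vʳ) →
             RSND G Gᵢ Hᵢ X Y
               ((k + ∣ edgesAt G S⁻ X ∣ + ∣ edgesAt G S⁺ Y ∣) ∸ (∣ S⁻ ∣ + ∣ S⁺ ∣)))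
        × RSND G Gᵢ Hᵢ Vˡ Vʳ (h + 1)
        × RSND G Gᵢ Hᵢ Vˡ Vʳ (k ∸ 1)))
theorem4p2 G connected s t s≢t k 2≤k D H = mk⇔
  (λ sd →
    let at-level = λ h 1≤h h<k → necessary (sd-rsnd⇒feasible sd) h<k
          (level-layout connected D h 1≤h h<k) (level-total connected D h 1≤h h<k)
          (λ t∈ → s≢t (sym (x∈⁅y⁆⇒x≡y s t∈)))
          (λ {v} v∈ → subst (Star _ s) (sym (x∈⁅y⁆⇒x≡y s v∈)) ε) (x∈⁅x⁆ s) (⊥-elim ∘ ∉⊥)
          (λ v∈ _ x∈ → trans (x∈⁅y⁆⇒x≡y s v∈) (sym (x∈⁅y⁆⇒x≡y s x∈)))
    in (λ e (h , 1≤h , h<k , e∈) → proj₁ (at-level h 1≤h h<k) e∈) ,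
       λ h 1≤h h<k S⁻ Vˡ R Vʳ S⁺ C∈ →
         demanded⇒conditions (component S⁻ Vˡ R Vʳ S⁺) h<k
           (each⇒∈ (Hierarchy.level D h) (proj₂ (at-level h 1≤h h<k)) C∈))
  (λ (seps , conditions) → feasible⇒sd-rsnd s≢t
    -- The single 1-component is G with ends `s` and `t`, so its full demand is the claim.
    (subst (Each (Full k) ⊥ ⁅ s ⁆ ⁅ t ⁆ ⊥) (Hierarchy.level-1 D)
      (all-full (λ h 1≤h h<k → each-map conditions⇒bounded (level-layout connected D h 1≤h h<k)
          (∈⇒each {Φ = Conditions h} (Hierarchy.level D h) (⊥-elim ∘ ∉⊥)
            (λ e∈ → seps _ (h , 1≤h , h<k , e∈)) (conditions h 1≤h h<k _ _ _ _ _)))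
        (k ∸ 2) 1 ℕ.≤-refl (ℕ.m+[n∸m]≡n 2≤k))))
  where
  open Decomposition G
  open Sufficiency G H k
  open Terminals G s t k H
  open Necessity G H s t k using (Demanded; necessary)

  demanded⇒conditions : ∀ {h} C → h < k → Demanded C → Conditions h C
  demanded⇒conditions {h} C h<k (partial , full) =
    (λ X Y X⊆ Y⊆ _ → partial X Y X⊆ Y⊆) ,
    full (h + 1) (subst (_≤ k) (ℕ.+-comm 1 h) h<k) , full (k ∸ 1) (ℕ.m∸n≤m k 1)

  -- `j` is the distance from `h` to the last level k - 1; each step passes from the components of
  -- level `h + 1` to their parents.
  all-full : (∀ h → 1 ≤ h → h < k →
               Each (λ C → Bounded C × Full (suc h) C) ⊥ ⁅ s ⁆ ⁅ t ⁆ ⊥ (Hierarchy.level D h)) →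
             ∀ j h → 1 ≤ h → suc (h + j) ≡ k → Each (Full k) ⊥ ⁅ s ⁆ ⁅ t ⁆ ⊥ (Hierarchy.level D h)
  all-full conditions zero h 1≤h refl =
    subst (λ d → Each (Full d) ⊥ ⁅ s ⁆ ⁅ t ⁆ ⊥ (Hierarchy.level D h))
      (cong suc (sym (ℕ.+-identityʳ h)))
      (each-proj₂ (Hierarchy.level D h) (conditions h 1≤h (s≤s (ℕ.m≤m+n h 0))))
  all-full conditions (suc j) h 1≤h eq =
    refined (Hierarchy.refine D h 1≤h h+2≤k) (level-layout connected D h 1≤h h<k)
      (each-proj₂ (Hierarchy.level D h) (conditions h 1≤h h<k))
      (each-zip (Hierarchy.level D (suc h))
        (each-proj₁ (Hierarchy.level D (suc h)) (conditions (suc h) (s≤s z≤n) 1+h<k))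
        (all-full conditions j (suc h) (s≤s z≤n) (trans (cong suc (sym (ℕ.+-suc h j))) eq)))
    where
    1+h<k : suc h < k
    1+h<k = subst (suc h <_) eq (s≤s (subst (suc h ≤_) (sym (ℕ.+-suc h j)) (s≤s (ℕ.m≤m+n h j))))

    h<k : h < k
    h<k = ℕ.<⇒≤ 1+h<k

    h+2≤k : h + 2 ≤ k
    h+2≤k = subst (_≤ k) (ℕ.+-comm 2 h) 1+h<k
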